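{- Let $M$ be a connected regular matroid. Then $M$ is a circuit-difference matroid if and only if $M$ has no pair of skew circuits.
   Context: All matroids are finite. A matroid $M$ is circuit-difference if the symmetric difference $C_1\triangle C_2$ is a circuit of $M$ whenever $C_1$ and $C_2$ are distinct circuits of $M$ with $C_1\cap C_2\neq\emptyset$. Subsets $X$ and $Y$ of $E(M)$ are skew if $r(X\cup Y)=r(X)+r(Y)$, where $r$ is the rank function of $M$. A pair of skew circuits consists of two distinct circuits that are skew. -}

module Defs where

open import Algebra.Definitions.RawMonoid using (sum)
open import Data.Fin.Base using (Fin; zero; suc; punchIn)
open import Data.Fin.Subset
open import Data.Fin.Subset.Properties using (_⊆?_)
open import Data.List.Base as List using (List; []; _∷_; _++_; filter)
open import Data.List.Extrema.Nat using (max)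
open import Data.Nat.Base as ℕ using (ℕ; zero; suc)
open import Data.Product.Base using (Σ; ∃; ∃-syntax; _×_; _,_)
open import Data.Rational.Base using (ℚ; 0ℚ; 1ℚ; _*_; -_; +-0-rawMonoid)
open import Data.Sum.Base using (_⊎_)
open import Data.Vec.Base using ([]; _∷_)
open import Function.Bundles using (_⇔_)
open import Function.Definitions using (Injective)
open import Relation.Binary.PropositionalEquality.Core using (_≡_; _≢_)
open import Relation.Nullary using (¬_)
open import Relation.Nullary.Decidable using (_×-dec_)
open import Relation.Unary using (Decidable)

infixr 6 _△_

_△_ : ∀ {n} → Subset n → Subset n → Subset n
X △ Y = (X ─ Y) ∪ (Y ─ X)

subsets : ∀ n → List (Subset n)
subsets zero    = [] ∷ []
subsets (suc n) =
  List.map (outside ∷_) (subsets n) ++ List.map (inside ∷_) (subsets n)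

-- A matroid on the ground set Fin n, given by its independent sets.
-- Independence is a property of finitely many finite sets, so its
-- decidability, automatic classically, is recorded as part of the data;
-- the rank function is computed from it.

record Matroid (n : ℕ) : Set₁ where
  field
    Indep      : Subset n → Set
    indep?     : Decidable Indep
    indep-⊥    : Indep ⊥
    hereditary : ∀ {I J} → I ⊆ J → Indep J → Indep I
    augment    : ∀ {I J} → Indep I → Indep J → ∣ I ∣ ℕ.< ∣ J ∣ →
                 ∃[ e ] e ∈ J × e ∉ I × Indep (I ∪ ⁅ e ⁆)

  Circuit : Subset n → Set
  Circuit C = ¬ Indep C × (∀ {D} → D ⊂ C → Indep D)

  -- The largest size of an independent subset of X.
  rank : Subset n → ℕ
  rank X =
    max 0 (List.map ∣_∣ (filter (λ I → (I ⊆? X) ×-dec indep? I) (subsets n)))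

  Skew : Subset n → Subset n → Set
  Skew X Y = rank (X ∪ Y) ≡ rank X ℕ.+ rank Y

  HasSkewCircuits : Set
  HasSkewCircuits =
    ∃[ C₁ ] ∃[ C₂ ] Circuit C₁ × Circuit C₂ × C₁ ≢ C₂ × Skew C₁ C₂

  CircuitDifference : Set
  CircuitDifference =
    ∀ {C₁ C₂} → Circuit C₁ → Circuit C₂ → C₁ ≢ C₂ → Nonempty (C₁ ∩ C₂) →
    Circuit (C₁ △ C₂)

  Connected : Set
  Connected = ∀ {e f} → e ≢ f → ∃[ C ] Circuit C × e ∈ C × f ∈ C

Matrix : ℕ → ℕ → Set
Matrix m n = Fin m → Fin n → ℚ

∑ : ∀ {n} → (Fin n → ℚ) → ℚ
∑ = sum +-0-rawMonoid

-- (-1)^i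
sign : ∀ {n} → Fin n → ℚ
sign zero    = 1ℚ
sign (suc i) = - sign i

-- Laplace expansion along the first row.
det : ∀ {n} → Matrix n n → ℚ
det {zero}  A = 1ℚ
det {suc n} A =
  ∑ λ j → sign j * A zero j * det λ i k → A (suc i) (punchIn j k)

-- Square submatrices are indexed by injections, so their rows and columns
-- may come reordered; this changes the determinant only by a sign.
TotallyUnimodular : ∀ {m n} → Matrix m n → Set
TotallyUnimodular {m} {n} A =
  ∀ {k} (f : Fin k → Fin m) (g : Fin k → Fin n) →
  Injective _≡_ _≡_ f → Injective _≡_ _≡_ g →
  let d = det λ i j → A (f i) (g j) in
  d ≡ 0ℚ ⊎ d ≡ 1ℚ ⊎ d ≡ - 1ℚ

-- The family of columns of A labelled by X is linearly independent
-- (equal columns with distinct labels are dependent).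
IndependentColumns : ∀ {m n} → Matrix m n → Subset n → Set
IndependentColumns {n = n} A X =
  ∀ (c : Fin n → ℚ) → (∀ {e} → e ∉ X → c e ≡ 0ℚ) →
  (∀ i → ∑ (λ e → c e * A i e) ≡ 0ℚ) → ∀ e → c e ≡ 0ℚ

Represents : ∀ {m n} → Matrix m n → Matroid n → Set
Represents A M = ∀ X → Matroid.Indep M X ⇔ IndependentColumns A X

-- Representable by a totally unimodular matrix.  Such a matrix has entries
-- in {0, 1, -1}, and linear independence of rational vectors is the same
-- over ℚ as over ℝ, so rational matrices lose no generality.
Regular : ∀ {n} → Matroid n → Set
Regular {n} M =
  ∃[ m ] Σ (Matrix m n) λ A → TotallyUnimodular A × Represents A M

{-# OPTIONS --safe #-}
-- Suppose C₁ and C₂ are skew circuits of a connected circuit-difference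
-- matroid.  They are disjoint, and a maximal independent subset B of C₁ ∪ C₂
-- misses one element e of C₁ and one element f of C₂.  If D is a circuit through
-- e and f, then C₂ △ (C₁ △ D) is a circuit that avoids e and f: it lies in B if
-- D ⊆ C₁ ∪ C₂, and otherwise it meets D in such a way that C₁ ∪ C₂ would be a
-- circuit.
--
-- Conversely, let C₁ and C₂ be intersecting circuits with C₁ ∪ C₂ minimal such
-- that T = C₁ △ C₂ is not a circuit.  By minimality every nonempty cycle (modulo
-- 2) inside C₁ ∪ C₂ other than T is a circuit, and every circuit in C₁ ∪ C₂ that
-- meets N = C₁ ∩ C₂ contains N.  Hence a regular representation can be reoriented
-- so that the indicators of C₁ and of T lie in its integral kernel.  Total
-- unimodularity allows us to write each g in this kernel as v + 2 h with v, h in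
-- the kernel and v a sign vector.  Applied to suitable g, this shows
-- that C₁ is the only positive circuit containing N, and that a sign vector
-- supported on T and nonnegative off C₁ is nonnegative.  If there are no skew
-- circuits, then T contains positive circuits P and Q dividing T into four
-- blocks.  Writing the sum of the indicators of C₁, P and Q minus that of T as
-- v + 2 h, one finds that C₁ cannot meet two opposite blocks, whereas it meets
-- every union of two blocks.

module Submission where

open import Defs
open import Algebra.Bundles using (CommutativeMonoid; CommutativeRing)
open import Data.Bool.Base using (_xor_; if_then_else_)
open import Data.Bool.Properties as Bool using (xor-assoc; xor-comm)
open import Data.Empty as Empty using (⊥-elim)
open import Data.Fin.Base using (Fin; zero; suc; punchIn; pinch)
open import Data.Fin.Properties as Fin using (_≟_; all?; punchIn-injective; punchInᵢ≢i)
open import Data.Fin.Subset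
open import Data.Fin.Subset.Properties
open import Data.Integer.Base as ℤ using (ℤ; 0ℤ; 1ℤ; -1ℤ; +0; +[1+_]; -[1+_])
open import Data.Integer.Properties as ℤ using ()
open import Data.Integer.Solver as ℤ using ()
open import Data.List.Base as List using (List; filter)
open import Data.List.Extrema.Nat using (xs≤max; argmax-sel)
open import Data.List.Membership.Propositional using () renaming (_∈_ to _∈ˡ_)
open import Data.List.Membership.Propositional.Properties
  using (∈-map⁺; ∈-map⁻; ∈-filter⁺; ∈-filter⁻; ∈-++⁺ˡ; ∈-++⁺ʳ)
open import Data.List.Relation.Unary.All as All using ()
open import Data.List.Relation.Unary.Any using (here)
open import Data.Nat.Base as ℕ using (ℕ; zero; suc; s≤s; z≤n)
open import Data.Nat.Properties as ℕ using ()
open import Data.Product.Base using (Σ; ∃; ∃-syntax; _×_; _,_; proj₁; proj₂)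
open import Data.Rational.Base as ℚ using (ℚ; 0ℚ; 1ℚ; ½; _+_; _*_; -_; _/_)
open import Data.Rational.Literals using (fromℤ)
open import Data.Rational.Properties as ℚ using ()
open import Data.Rational.Solver using (module +-*-Solver)
open import Data.Sum.Base using (_⊎_; inj₁; inj₂; [_,_]′)
open import Data.Vec.Base using ([]; _∷_; here; there; tabulate; zipWith)
open import Data.Vec.Functional as Vector using ()
open import Data.Vec.Properties
  using (zipWith-assoc; zipWith-comm; lookup⇒[]=; []=⇒lookup; lookup∘tabulate; ≡-dec)
open import Function.Base using (_∘_; id)
open import Function.Bundles using (_⇔_; mk⇔; module Equivalence)
open import Function.Definitions using (Injective)
open import Relation.Binary.PropositionalEquality
open import Relation.Nullary using (¬_; Dec; yes; no; does; contradiction)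
open import Relation.Nullary.Decidable
  using (_×-dec_; _→-dec_; ¬?; map′; dec-true; dec-false; decidable-stable)
open import Relation.Unary using (Decidable)
open import Algebra.Properties.AbelianGroup ℤ.+-0-abelianGroup using (∙-cancelˡ)
open import Algebra.Properties.CommutativeSemigroup
  (CommutativeMonoid.commutativeSemigroup ℤ.+-0-commutativeMonoid) using (interchange)
open import Algebra.Properties.Ring ℚ.+-*-ring using (-‿involutive)
open import Algebra.Properties.Semiring.Sum
  (CommutativeRing.semiring ℚ.+-*-commutativeRing) as Sum using ()

-- Subsets

-- The integral kernel plays two roles at once: the odd supports of its vectors are the cycles
-- modulo 2, and the signs of its vectors carry the orientation. Total unimodularity ties the two
-- together, because independent columns stay independent modulo 2; so circuit vectors can be
-- subtracted from g until nothing odd is left, and what remains can be halved inside the kernel.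
-- The half h is the useful product. It is forced wherever g is even and open by one step wherever g
-- is odd, so each g is assembled from indicators to be even at the decisive elements. On N the
-- ambiguity is removed differently: two kernel vectors supported in C₁ ∪ C₂ that agree at one
-- element of N agree on all of N.
--
-- In the combinatorial part the constraint is that minimality speaks only of circuits that share an
-- element and both miss some element of C₁ ∪ C₂, so every symmetric difference has to come with
-- such witnesses. They exist because T avoids N: a circuit inside T cannot lie in C₁ or in C₂,
-- hence meets both sides of T.

module _ where
  private
    variable
      n : ℕ
      p q r : Subset n
      x y : Fin n

  p─q-disjoint : ∀ (p q : Subset n) → x ∈ p ─ q → x ∉ q
  p─q-disjoint (_ ∷ p) (outside ∷ q) (there x∈p─q) (there x∈q) = p─q-disjoint p q x∈p─q x∈q
  p─q-disjoint (_ ∷ p) (inside  ∷ q) (there x∈p─q) (there x∈q) = p─q-disjoint p q x∈p─q x∈q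

  x∈△ˡ : x ∈ p → x ∉ q → x ∈ p △ q
  x∈△ˡ x∈p x∉q = x∈p∪q⁺ (inj₁ (x∈p∧x∉q⇒x∈p─q x∈p x∉q))

  x∈△ʳ : x ∉ p → x ∈ q → x ∈ p △ q
  x∈△ʳ x∉p x∈q = x∈p∪q⁺ (inj₂ (x∈p∧x∉q⇒x∈p─q x∈q x∉p))

  x∈△⁻ : ∀ (p q : Subset n) → x ∈ p △ q → (x ∈ p × x ∉ q) ⊎ (x ∉ p × x ∈ q)
  x∈△⁻ p q x∈ with x∈p∪q⁻ (p ─ q) (q ─ p) x∈
  ... | inj₁ x∈p─q = inj₁ (p─q⊆p p q x∈p─q , p─q-disjoint p q x∈p─q)
  ... | inj₂ x∈q─p = inj₂ (p─q-disjoint q p x∈q─p , p─q⊆p q p x∈q─p)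

  x∉△-both : x ∈ p → x ∈ q → x ∉ p △ q
  x∉△-both {p = p} {q} x∈p x∈q x∈ with x∈△⁻ p q x∈
  ... | inj₁ (_ , x∉q) = x∉q x∈q
  ... | inj₂ (x∉p , _) = x∉p x∈p

  x∉△-neither : x ∉ p → x ∉ q → x ∉ p △ q
  x∉△-neither {p = p} {q} x∉p x∉q x∈ with x∈△⁻ p q x∈
  ... | inj₁ (x∈p , _) = x∉p x∈p
  ... | inj₂ (_ , x∈q) = x∉q x∈q

  △-⊆ : p ⊆ r → q ⊆ r → p △ q ⊆ r
  △-⊆ {p = p} {q = q} p⊆r q⊆r x∈ with x∈△⁻ p q x∈
  ... | inj₁ (x∈p , _) = p⊆r x∈p
  ... | inj₂ (_ , x∈q) = q⊆r x∈q

  △≡xor : ∀ (p q : Subset n) → p △ q ≡ zipWith _xor_ p q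
  △≡xor []            []            = refl
  △≡xor (inside  ∷ p) (inside  ∷ q) = cong (outside ∷_) (△≡xor p q)
  △≡xor (inside  ∷ p) (outside ∷ q) = cong (inside  ∷_) (△≡xor p q)
  △≡xor (outside ∷ p) (inside  ∷ q) = cong (inside  ∷_) (△≡xor p q)
  △≡xor (outside ∷ p) (outside ∷ q) = cong (outside ∷_) (△≡xor p q)

  △-assoc : ∀ (p q r : Subset n) → (p △ q) △ r ≡ p △ (q △ r)
  △-assoc p q r = begin
    (p △ q) △ r                       ≡⟨ △≡xor (p △ q) r ⟩
    zipWith _xor_ (p △ q) r           ≡⟨ cong (λ s → zipWith _xor_ s r) (△≡xor p q) ⟩
    zipWith _xor_ (zipWith _xor_ p q) r ≡⟨ zipWith-assoc xor-assoc p q r ⟩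
    zipWith _xor_ p (zipWith _xor_ q r) ≡⟨ cong (zipWith _xor_ p) (△≡xor q r) ⟨
    zipWith _xor_ p (q △ r)           ≡⟨ △≡xor p (q △ r) ⟨
    p △ (q △ r)                       ∎
    where open ≡-Reasoning

  △-comm : ∀ (p q : Subset n) → p △ q ≡ q △ p
  △-comm p q = trans (△≡xor p q) (trans (zipWith-comm xor-comm p q) (sym (△≡xor q p)))

  △-cancelˡ : ∀ (p q : Subset n) → p △ (p △ q) ≡ q
  △-cancelˡ p q = ⊆-antisym ⊆q q⊆
    where
    ⊆q : p △ (p △ q) ⊆ q
    ⊆q {x} x∈ with x ∈? q
    ... | yes x∈q = x∈q
    ... | no  x∉q with x∈△⁻ p (p △ q) x∈
    ...   | inj₁ (x∈p , x∉) = contradiction (x∈△ˡ x∈p x∉q) x∉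
    ...   | inj₂ (x∉p , x∈′) = contradiction x∈′ (x∉△-neither x∉p x∉q)
    q⊆ : q ⊆ p △ (p △ q)
    q⊆ {x} x∈q with x ∈? p
    ... | yes x∈p = x∈△ˡ x∈p (x∉△-both x∈p x∈q)
    ... | no  x∉p = x∈△ʳ x∉p (x∈△ʳ x∉p x∈q)

  △-cancelʳ : ∀ (p q : Subset n) → (p △ q) △ q ≡ p
  △-cancelʳ p q = begin
    (p △ q) △ q   ≡⟨ △-comm (p △ q) q ⟩
    q △ (p △ q)   ≡⟨ cong (q △_) (△-comm p q) ⟩
    q △ (q △ p)   ≡⟨ △-cancelˡ q p ⟩
    p             ∎
    where open ≡-Reasoning

  ⊈⇒∃ : ¬ p ⊆ q → ∃[ x ] x ∈ p × x ∉ q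
  ⊈⇒∃ {p = p} {q} p⊈q with nonempty? (p ─ q)
  ... | yes (x , x∈) = x , p─q⊆p p q x∈ , p─q-disjoint p q x∈
  ... | no  empty = ⊥-elim (p⊈q p⊆q)
    where
    p⊆q : p ⊆ q
    p⊆q {x} x∈p = decidable-stable (x ∈? q) λ x∉q → empty (x , x∈p∧x∉q⇒x∈p─q x∈p x∉q)

  ∣p-x∣ : x ∈ p → suc ∣ p - x ∣ ≡ ∣ p ∣
  ∣p-x∣ {p = inside ∷ p}  here        = cong (suc ∘ ∣_∣) (p─⊥≡p p)
  ∣p-x∣ {p = inside ∷ p}  (there x∈p) = cong suc (∣p-x∣ x∈p)
  ∣p-x∣ {p = outside ∷ p} (there x∈p) = ∣p-x∣ x∈p

  ∣p∪q∣+∣p∩q∣ : ∀ (p q : Subset n) → ∣ p ∪ q ∣ ℕ.+ ∣ p ∩ q ∣ ≡ ∣ p ∣ ℕ.+ ∣ q ∣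
  ∣p∪q∣+∣p∩q∣ []            []            = refl
  ∣p∪q∣+∣p∩q∣ (outside ∷ p) (outside ∷ q) = ∣p∪q∣+∣p∩q∣ p q
  ∣p∪q∣+∣p∩q∣ (inside  ∷ p) (outside ∷ q) = cong suc (∣p∪q∣+∣p∩q∣ p q)
  ∣p∪q∣+∣p∩q∣ (outside ∷ p) (inside  ∷ q) =
    trans (cong suc (∣p∪q∣+∣p∩q∣ p q)) (sym (ℕ.+-suc ∣ p ∣ ∣ q ∣))
  ∣p∪q∣+∣p∩q∣ (inside  ∷ p) (inside  ∷ q) = cong suc (trans (ℕ.+-suc ∣ p ∪ q ∣ ∣ p ∩ q ∣)
    (trans (cong suc (∣p∪q∣+∣p∩q∣ p q)) (sym (ℕ.+-suc ∣ p ∣ ∣ q ∣))))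

  disjoint⇒∣p∪q∣ : ∀ (p q : Subset n) → Empty (p ∩ q) → ∣ p ∪ q ∣ ≡ ∣ p ∣ ℕ.+ ∣ q ∣
  disjoint⇒∣p∪q∣ {n} p q empty = begin
    ∣ p ∪ q ∣                    ≡⟨ ℕ.+-identityʳ _ ⟨
    ∣ p ∪ q ∣ ℕ.+ 0              ≡⟨ cong (∣ p ∪ q ∣ ℕ.+_) (trans (cong ∣_∣ (Empty-unique empty)) (∣⊥∣≡0 n)) ⟨
    ∣ p ∪ q ∣ ℕ.+ ∣ p ∩ q ∣      ≡⟨ ∣p∪q∣+∣p∩q∣ p q ⟩
    ∣ p ∣ ℕ.+ ∣ q ∣              ∎
    where open ≡-Reasoning

  p⊆q-x : p ⊆ q → x ∉ p → p ⊆ q - x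
  p⊆q-x p⊆q x∉p y∈p = x∈p∧x≢y⇒x∈p-y (p⊆q y∈p) λ { refl → x∉p y∈p }

  ∣⊆-x∣ : p ⊆ q → x ∈ q → x ∉ p → 1 ℕ.+ ∣ p ∣ ℕ.≤ ∣ q ∣
  ∣⊆-x∣ p⊆q x∈q x∉p = p⊂q⇒∣p∣<∣q∣ (p⊆q , _ , x∈q , x∉p)

  ∣⊆-x-y∣ : p ⊆ q → x ∈ q → x ∉ p → y ∈ q → y ∉ p → y ≢ x → 2 ℕ.+ ∣ p ∣ ℕ.≤ ∣ q ∣
  ∣⊆-x-y∣ p⊆q x∈q x∉p y∈q y∉p y≢x = ℕ.≤-trans
    (s≤s (∣⊆-x∣ (p⊆q-x p⊆q x∉p) (x∈p∧x≢y⇒x∈p-y y∈q y≢x) y∉p)) (ℕ.≤-reflexive (∣p-x∣ x∈q))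

  ∣⊆-x-y-z∣ : ∀ {z} → p ⊆ q → x ∈ q → x ∉ p → y ∈ q → y ∉ p → z ∈ q → z ∉ p →
    y ≢ x → z ≢ x → z ≢ y → 3 ℕ.+ ∣ p ∣ ℕ.≤ ∣ q ∣
  ∣⊆-x-y-z∣ p⊆q x∈q x∉p y∈q y∉p z∈q z∉p y≢x z≢x z≢y = ℕ.≤-trans
    (s≤s (∣⊆-x-y∣ (p⊆q-x p⊆q x∉p) (x∈p∧x≢y⇒x∈p-y y∈q y≢x) y∉p (x∈p∧x≢y⇒x∈p-y z∈q z≢x) z∉p z≢y))
    (ℕ.≤-reflexive (∣p-x∣ x∈q))

  ∈-subsets : ∀ (p : Subset n) → p ∈ˡ subsets n
  ∈-subsets []            = here refl
  ∈-subsets (outside ∷ p) = ∈-++⁺ˡ (∈-map⁺ (outside ∷_) (∈-subsets p))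
  ∈-subsets {suc n} (inside ∷ p) =
    ∈-++⁺ʳ (List.map (outside ∷_) (subsets n)) (∈-map⁺ (inside ∷_) (∈-subsets p))

-- Circuits and rank

module MatroidProperties {n} (M : Matroid n) where
  open Matroid M

  circuit-minimal : ∀ {C S} → Circuit C → S ⊆ C → ¬ Indep S → S ≡ C
  circuit-minimal {C} {S} (_ , minimal) S⊆C ¬indep with C ⊆? S
  ... | yes C⊆S = ⊆-antisym S⊆C C⊆S
  ... | no  C⊈S = contradiction (minimal (S⊆C , ⊈⇒∃ C⊈S)) ¬indep

  circuit-⊈ : ∀ {C D} → Circuit C → Circuit D → C ≢ D → ∃[ x ] x ∈ C × x ∉ D
  circuit-⊈ circC circD C≢D = ⊈⇒∃ λ C⊆D → C≢D (circuit-minimal circD C⊆D (proj₁ circC))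

  circuit⁻ : ∀ {C e} → Circuit C → e ∈ C → Indep (C - e)
  circuit⁻ (_ , minimal) e∈C = minimal (x∈p⇒p-x⊂p e∈C)

  -- Independence is hereditary, so only deletions of single elements need checking. This makes
  -- `Circuit` decidable, which the proof by contradiction of the converse direction relies on.
  circuit⁺ : ∀ {C} → ¬ Indep C → (∀ e → e ∈ C → Indep (C - e)) → Circuit C
  circuit⁺ ¬indep minimal = ¬indep ,
    λ { (D⊆C , e , e∈C , e∉D) → hereditary (p⊆q-x D⊆C e∉D) (minimal e e∈C) }

  circuit? : ∀ C → Dec (Circuit C)
  circuit? C = map′ (λ { (¬indep , minimal) → circuit⁺ ¬indep minimal })
                    (λ circ → proj₁ circ , λ _ → circuit⁻ circ)
                    (¬? (indep? C) ×-dec all? λ e → (e ∈? C) →-dec indep? (C - e))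

  abstract
    circuit-within : ∀ {S} → ¬ Indep S → ∃[ C ] Circuit C × C ⊆ S
    circuit-within {S} = search ∣ S ∣ S ℕ.≤-refl
      where
      search : ∀ k S → ∣ S ∣ ℕ.≤ k → ¬ Indep S → ∃[ C ] Circuit C × C ⊆ S
      search k S ∣S∣≤k ¬indep with all? (λ e → (e ∈? S) →-dec indep? (S - e))
      ... | yes minimal = S , circuit⁺ ¬indep minimal , id
      ... | no ¬minimal with Fin.¬∀⟶∃¬ n _ (λ e → (e ∈? S) →-dec indep? (S - e)) ¬minimal
      search k S ∣S∣≤k ¬indep | no _ | e , ¬min with e ∈? S
      ... | no e∉S = contradiction (λ e∈S → contradiction e∈S e∉S) ¬min
      search zero    S ∣S∣≤k _ | no _ | e , ¬min | yes e∈S =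
        contradiction (ℕ.<-≤-trans (x∈p⇒∣p-x∣<∣p∣ e∈S) ∣S∣≤k) λ ()
      search (suc k) S ∣S∣≤k _ | no _ | e , ¬min | yes e∈S
        with search k (S - e) (ℕ.≤-pred (ℕ.<-≤-trans (x∈p⇒∣p-x∣<∣p∣ e∈S) ∣S∣≤k)) (λ ind → ¬min λ _ → ind)
      ... | C , circ , C⊆ = C , circ , p─q⊆p S ⁅ e ⁆ ∘ C⊆

  private
    independentSubsets : Subset n → List (Subset n)
    independentSubsets X = filter (λ I → (I ⊆? X) ×-dec indep? I) (subsets n)

  ∣I∣≤rank : ∀ {I X} → Indep I → I ⊆ X → ∣ I ∣ ℕ.≤ rank X
  ∣I∣≤rank {I} {X} indep I⊆X = All.lookup (xs≤max 0 (List.map ∣_∣ (independentSubsets X)))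
    (∈-map⁺ ∣_∣ (∈-filter⁺ (λ I → (I ⊆? X) ×-dec indep? I) (∈-subsets I) (I⊆X , indep)))

  maximal-independent : ∀ X → ∃[ I ] Indep I × I ⊆ X × ∣ I ∣ ≡ rank X
  maximal-independent X with argmax-sel id 0 (List.map ∣_∣ (independentSubsets X))
  ... | inj₁ rank≡0 = ⊥ , indep-⊥ , ⊥⊆ , trans (∣⊥∣≡0 n) (sym rank≡0)
  ... | inj₂ rank∈ with ∈-map⁻ ∣_∣ rank∈
  ...   | I , I∈ , eq with ∈-filter⁻ (λ I → (I ⊆? X) ×-dec indep? I) {xs = subsets n} I∈
  ...     | _ , I⊆X , indep = I , indep , I⊆X , sym eq

  rank-circuit : ∀ {C} → Circuit C → suc (rank C) ≡ ∣ C ∣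
  rank-circuit {C} circ with maximal-independent C
  ... | I , indep , I⊆C , ∣I∣≡rank with ⊈⇒∃ (λ C⊆I → proj₁ circ (hereditary C⊆I indep))
  ...   | e , e∈C , e∉I = ℕ.≤-antisym
    (subst (λ k → suc k ℕ.≤ ∣ C ∣) ∣I∣≡rank (∣⊆-x∣ I⊆C e∈C e∉I))
    (subst (ℕ._≤ suc (rank C)) (∣p-x∣ e∈C) (s≤s (∣I∣≤rank (circuit⁻ circ e∈C) (p─q⊆p C ⁅ e ⁆))))

  ⊉circuit : ∀ {B C} → Indep B → Circuit C → ∃[ x ] x ∈ C × x ∉ B
  ⊉circuit indep circ = ⊈⇒∃ λ C⊆B → proj₁ circ (hereditary C⊆B indep)

  rank-circuits : ∀ {C₁ C₂} → Circuit C₁ → Circuit C₂ → 2 ℕ.+ (rank C₁ ℕ.+ rank C₂) ≡ ∣ C₁ ∣ ℕ.+ ∣ C₂ ∣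
  rank-circuits {C₁} {C₂} circ₁ circ₂ = trans (cong suc (sym (ℕ.+-suc (rank C₁) (rank C₂))))
    (cong₂ ℕ._+_ (rank-circuit circ₁) (rank-circuit circ₂))

  -- Skew circuits in circuit-difference matroids

  skew⇒spanning : ∀ {C₁ C₂} → Circuit C₁ → Circuit C₂ → Skew C₁ C₂ →
    ∃[ B ] Indep B × B ⊆ C₁ ∪ C₂ × 2 ℕ.+ ∣ B ∣ ≡ ∣ C₁ ∣ ℕ.+ ∣ C₂ ∣
  skew⇒spanning {C₁} {C₂} circ₁ circ₂ skew with maximal-independent (C₁ ∪ C₂)
  ... | B , indep , B⊆ , ∣B∣≡rank =
    B , indep , B⊆ , trans (cong (2 ℕ.+_) (trans ∣B∣≡rank skew)) (rank-circuits circ₁ circ₂)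

  -- If the circuits met, the size of `B` would leave at most one element of `C₁ ∪ C₂` outside `B`.
  -- That element would have to lie in each of the circuits `C₁`, `C₂` and `C₁ △ C₂`, which have no
  -- element in common.
  skew⇒disjoint : CircuitDifference → ∀ {C₁ C₂} → Circuit C₁ → Circuit C₂ → C₁ ≢ C₂ →
    Skew C₁ C₂ → Empty (C₁ ∩ C₂)
  skew⇒disjoint cd {C₁} {C₂} circ₁ circ₂ C₁≢C₂ skew meet@(c , c∈) =
    let B , indep , B⊆ , ∣B∣ = skew⇒spanning circ₁ circ₂ skew
        e , e∈C₁ , e∉B = ⊉circuit indep circ₁
        f , f∈C₂ , f∉B = ⊉circuit indep circ₂
        g , g∈△ , g∉B = ⊉circuit indep (cd circ₁ circ₂ C₁≢C₂ meet)
    in x∉△-both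
      (subst (_∈ C₁) (sym (unique B⊆ ∣B∣ (△-⊆ (p⊆p∪q C₂) (q⊆p∪q C₁ C₂) g∈△) g∉B (p⊆p∪q C₂ e∈C₁) e∉B)) e∈C₁)
      (subst (_∈ C₂) (sym (unique B⊆ ∣B∣ (△-⊆ (p⊆p∪q C₂) (q⊆p∪q C₁ C₂) g∈△) g∉B (q⊆p∪q C₁ C₂ f∈C₂) f∉B)) f∈C₂)
      g∈△
    where
    gap : ∀ B → 2 ℕ.+ ∣ B ∣ ≡ ∣ C₁ ∣ ℕ.+ ∣ C₂ ∣ → ¬ 2 ℕ.+ ∣ B ∣ ℕ.≤ ∣ C₁ ∪ C₂ ∣
    gap B ∣B∣ ≤∪ = ℕ.<-irrefl refl (begin-strict
      2 ℕ.+ ∣ B ∣                    ≤⟨ ≤∪ ⟩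
      ∣ C₁ ∪ C₂ ∣                    <⟨ ℕ.m<m+n ∣ C₁ ∪ C₂ ∣ (ℕ.≤-<-trans z≤n (∣⊆-x∣ ⊥⊆ c∈ ∉⊥)) ⟩
      ∣ C₁ ∪ C₂ ∣ ℕ.+ ∣ C₁ ∩ C₂ ∣    ≡⟨ ∣p∪q∣+∣p∩q∣ C₁ C₂ ⟩
      ∣ C₁ ∣ ℕ.+ ∣ C₂ ∣              ≡⟨ ∣B∣ ⟨
      2 ℕ.+ ∣ B ∣                    ∎)
      where open ℕ.≤-Reasoning
    unique : ∀ {B} → B ⊆ C₁ ∪ C₂ → 2 ℕ.+ ∣ B ∣ ≡ ∣ C₁ ∣ ℕ.+ ∣ C₂ ∣ →
      ∀ {g e} → g ∈ C₁ ∪ C₂ → g ∉ B → e ∈ C₁ ∪ C₂ → e ∉ B → g ≡ e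
    unique {B} B⊆ ∣B∣ {g} {e} g∈ g∉B e∈ e∉B with g ≟ e
    ... | yes g≡e = g≡e
    ... | no  g≢e = ⊥-elim (gap B ∣B∣ (∣⊆-x-y∣ B⊆ e∈ e∉B g∈ g∉B g≢e))

  private
    module DisjointCircuits (cd : CircuitDifference) {C₁ C₂} (circ₁ : Circuit C₁) (circ₂ : Circuit C₂)
      (disjoint : Empty (C₁ ∩ C₂)) {D e f} (circD : Circuit D)
      (e∈C₁ : e ∈ C₁) (f∈C₂ : f ∈ C₂) (e∈D : e ∈ D) (f∈D : f ∈ D) where

      C₁∌ : ∀ {x} → x ∈ C₂ → x ∉ C₁
      C₁∌ x∈C₂ x∈C₁ = disjoint (_ , x∈p∩q⁺ (x∈C₁ , x∈C₂))

      e∉C₂ : e ∉ C₂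
      e∉C₂ e∈C₂ = C₁∌ e∈C₂ e∈C₁

      C₁≢D : C₁ ≢ D
      C₁≢D C₁≡D = C₁∌ f∈C₂ (subst (f ∈_) (sym C₁≡D) f∈D)

      f∈C₁△D : f ∈ C₁ △ D
      f∈C₁△D = x∈△ʳ (C₁∌ f∈C₂) f∈D

      circ-C₁△D : Circuit (C₁ △ D)
      circ-C₁△D = cd circ₁ circD C₁≢D (e , x∈p∩q⁺ (e∈C₁ , e∈D))

      C₂≢C₁△D : C₂ ≢ C₁ △ D
      C₂≢C₁△D C₂≡ =
        let x , x∈C₁ , x∉D = circuit-⊈ circ₁ circD C₁≢D
        in C₁∌ (subst (x ∈_) (sym C₂≡) (x∈△ˡ x∈C₁ x∉D)) x∈C₁

      D″ : Subset n
      D″ = C₂ △ (C₁ △ D)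

      circ-D″ : Circuit D″
      circ-D″ = cd circ₂ circ-C₁△D C₂≢C₁△D (f , x∈p∩q⁺ (f∈C₂ , f∈C₁△D))

      e∉D″ : e ∉ D″
      e∉D″ = x∉△-neither e∉C₂ (x∉△-both e∈C₁ e∈D)

      f∉D″ : f ∉ D″
      f∉D″ = x∉△-both f∈C₂ f∈C₁△D

      D⊆C₁∪C₂ : D ⊆ C₁ ∪ C₂
      D⊆C₁∪C₂ {x} x∈D with x ∈? (C₁ ∪ C₂)
      ... | yes x∈ = x∈
      ... | no  x∉ = ⊥-elim (e∉C₂ (subst (e ∈_) C₁≡C₂ e∈C₁))
        where
        x∈D″ : x ∈ D″
        x∈D″ = x∈△ʳ (λ x∈ → x∉ (q⊆p∪q C₁ C₂ x∈)) (x∈△ʳ (λ x∈ → x∉ (p⊆p∪q C₂ x∈)) x∈D)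
        -- `D △ D″` cancels to `C₂ △ C₁`, which is the whole union by disjointness. A circuit that
        -- contains both `C₁` and `C₂` equals both.
        circ∪ : Circuit (C₂ △ C₁)
        circ∪ = subst Circuit
          (trans (△-comm D D″) (trans (cong (_△ D) (sym (△-assoc C₂ C₁ D))) (△-cancelʳ (C₂ △ C₁) D)))
          (cd circD circ-D″ (λ D≡D″ → e∉D″ (subst (e ∈_) D≡D″ e∈D)) (x , x∈p∩q⁺ (x∈D , x∈D″)))
        C₁≡C₂ : C₁ ≡ C₂
        C₁≡C₂ = trans
          (circuit-minimal circ∪ (λ y∈C₁ → x∈△ʳ (λ y∈C₂ → C₁∌ y∈C₂ y∈C₁) y∈C₁) (proj₁ circ₁))
          (sym (circuit-minimal circ∪ (λ y∈C₂ → x∈△ˡ y∈C₂ (C₁∌ y∈C₂)) (proj₁ circ₂)))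

      D″⊆C₁∪C₂ : D″ ⊆ C₁ ∪ C₂
      D″⊆C₁∪C₂ = △-⊆ (q⊆p∪q C₁ C₂) (△-⊆ (p⊆p∪q C₂) D⊆C₁∪C₂)

  circuitDifference⇒¬skew : Connected → CircuitDifference → ¬ HasSkewCircuits
  circuitDifference⇒¬skew connected cd (C₁ , C₂ , circ₁ , circ₂ , C₁≢C₂ , skew) =
    let B , indep , B⊆ , ∣B∣ = skew⇒spanning circ₁ circ₂ skew
        disjoint = skew⇒disjoint cd circ₁ circ₂ C₁≢C₂ skew
        e , e∈C₁ , e∉B = ⊉circuit indep circ₁
        f , f∈C₂ , f∉B = ⊉circuit indep circ₂
        f≢e = λ f≡e → disjoint (e , x∈p∩q⁺ (e∈C₁ , subst (_∈ C₂) f≡e f∈C₂))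
        D , circD , e∈D , f∈D = connected λ e≡f → f≢e (sym e≡f)
        open DisjointCircuits cd circ₁ circ₂ disjoint circD e∈C₁ f∈C₂ e∈D f∈D
        x , x∈D″ , x∉B = ⊉circuit indep circ-D″
    -- `B` misses exactly two elements of the disjoint union, but `e`, `f` and `x` are three.
    in ℕ.<-irrefl (trans ∣B∣ (sym (disjoint⇒∣p∪q∣ C₁ C₂ disjoint)))
      (∣⊆-x-y-z∣ B⊆ (p⊆p∪q C₂ e∈C₁) e∉B (q⊆p∪q C₁ C₂ f∈C₂) f∉B (D″⊆C₁∪C₂ x∈D″) x∉B f≢e
        (λ x≡e → e∉D″ (subst (_∈ D″) x≡e x∈D″)) (λ x≡f → f∉D″ (subst (_∈ D″) x≡f x∈D″)))

  abstract
    -- Deleting one element from each circuit leaves a set of size `rank C + rank D`. If it is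
    -- independent, it has the largest possible size, since every independent set misses an element
    -- of each circuit, and the pair is skew. Otherwise it contains a circuit, which avoids both
    -- deleted elements and so differs from `C` and `D`.
    ¬skew⇒circuit : ¬ HasSkewCircuits → ∀ {C D} → Circuit C → Circuit D → (∀ {x} → x ∈ C → x ∉ D) →
      ∃[ Z ] Circuit Z × Z ⊆ C ∪ D × Z ≢ C × Z ≢ D
    ¬skew⇒circuit ¬skew {C} {D} circC circD disjoint with ⊉circuit indep-⊥ circC | ⊉circuit indep-⊥ circD
    ... | e , e∈C , _ | f , f∈D , _ with indep? ((C - e) ∪ (D - f))
    ...   | no dep =
      let Z , circZ , Z⊆ = circuit-within dep
      in Z , circZ , J⊆ ∘ Z⊆ , (λ Z≡C → e∉J (Z⊆ (subst (e ∈_) (sym Z≡C) e∈C)))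
                             , (λ Z≡D → f∉J (Z⊆ (subst (f ∈_) (sym Z≡D) f∈D)))
      where
      J⊆ : (C - e) ∪ (D - f) ⊆ C ∪ D
      J⊆ x∈ with x∈p∪q⁻ (C - e) (D - f) x∈
      ... | inj₁ x∈C = p⊆p∪q D (p─q⊆p C ⁅ e ⁆ x∈C)
      ... | inj₂ x∈D = q⊆p∪q C D (p─q⊆p D ⁅ f ⁆ x∈D)
      e∉J : e ∉ (C - e) ∪ (D - f)
      e∉J e∈ with x∈p∪q⁻ (C - e) (D - f) e∈
      ... | inj₁ e∈C-e = p─q-disjoint C ⁅ e ⁆ e∈C-e (x∈⁅x⁆ e)
      ... | inj₂ e∈D-f = disjoint e∈C (p─q⊆p D ⁅ f ⁆ e∈D-f)
      f∉J : f ∉ (C - e) ∪ (D - f)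
      f∉J f∈ with x∈p∪q⁻ (C - e) (D - f) f∈
      ... | inj₁ f∈C-e = disjoint (p─q⊆p C ⁅ e ⁆ f∈C-e) f∈D
      ... | inj₂ f∈D-f = p─q-disjoint D ⁅ f ⁆ f∈D-f (x∈⁅x⁆ f)
    ...   | yes indep = contradiction
      (C , D , circC , circD , (λ C≡D → disjoint e∈C (subst (e ∈_) C≡D e∈C)) , ℕ.≤-antisym upper lower) ¬skew
      where
      J⊆ : (C - e) ∪ (D - f) ⊆ C ∪ D
      J⊆ x∈ with x∈p∪q⁻ (C - e) (D - f) x∈
      ... | inj₁ x∈C = p⊆p∪q D (p─q⊆p C ⁅ e ⁆ x∈C)
      ... | inj₂ x∈D = q⊆p∪q C D (p─q⊆p D ⁅ f ⁆ x∈D)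
      ∣C∪D∣ : ∣ C ∪ D ∣ ≡ 2 ℕ.+ (rank C ℕ.+ rank D)
      ∣C∪D∣ = trans
        (disjoint⇒∣p∪q∣ C D λ { (x , x∈) → let x∈C , x∈D = x∈p∩q⁻ C D x∈ in disjoint x∈C x∈D })
        (sym (rank-circuits circC circD))
      ∣J∣ : ∣ (C - e) ∪ (D - f) ∣ ≡ rank C ℕ.+ rank D
      ∣J∣ = trans
        (disjoint⇒∣p∪q∣ (C - e) (D - f) λ { (x , x∈) →
          let x∈C , x∈D = x∈p∩q⁻ (C - e) (D - f) x∈ in disjoint (p─q⊆p C ⁅ e ⁆ x∈C) (p─q⊆p D ⁅ f ⁆ x∈D) })
        (cong₂ ℕ._+_
          (ℕ.suc-injective (trans (∣p-x∣ e∈C) (sym (rank-circuit circC))))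
          (ℕ.suc-injective (trans (∣p-x∣ f∈D) (sym (rank-circuit circD)))))
      lower : rank C ℕ.+ rank D ℕ.≤ rank (C ∪ D)
      lower = subst (ℕ._≤ rank (C ∪ D)) ∣J∣ (∣I∣≤rank indep J⊆)
      upper : rank (C ∪ D) ℕ.≤ rank C ℕ.+ rank D
      upper =
        let B , indepB , B⊆ , ∣B∣ = maximal-independent (C ∪ D)
            x , x∈C , x∉B = ⊉circuit indepB circC
            y , y∈D , y∉B = ⊉circuit indepB circD
            y≢x = λ y≡x → disjoint x∈C (subst (_∈ D) y≡x y∈D)
        in subst (ℕ._≤ rank C ℕ.+ rank D) ∣B∣ (ℕ.≤-pred (ℕ.≤-pred (subst (2 ℕ.+ ∣ B ∣ ℕ.≤_) ∣C∪D∣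
             (∣⊆-x-y∣ B⊆ (p⊆p∪q D x∈C) x∉B (q⊆p∪q C D y∈D) y∉B y≢x))))

-- Determinants

∑-cong : ∀ {n} {f g : Fin n → ℚ} → (∀ i → f i ≡ g i) → ∑ f ≡ ∑ g
∑-cong = Sum.sum-cong-≗

∑-+ : ∀ {n} (f g : Fin n → ℚ) → ∑ (λ i → f i + g i) ≡ ∑ f + ∑ g
∑-+ = Sum.∑-distrib-+

∑-*ˡ : ∀ {n} x (f : Fin n → ℚ) → ∑ (λ i → x * f i) ≡ x * ∑ f
∑-*ˡ x f = sym (Sum.*-distribˡ-sum x f)

∑-*ʳ : ∀ {n} x (f : Fin n → ℚ) → ∑ (λ i → f i * x) ≡ ∑ f * x
∑-*ʳ x f = sym (Sum.*-distribʳ-sum x f)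

∑-0 : ∀ {n} {f : Fin n → ℚ} → (∀ i → f i ≡ 0ℚ) → ∑ f ≡ 0ℚ
∑-0 {n} f≡0 = trans (∑-cong f≡0) (Sum.sum-replicate-zero n)

∑-neg : ∀ {n} (f : Fin n → ℚ) → ∑ (λ i → - f i) ≡ - ∑ f
∑-neg {zero}  f = refl
∑-neg {suc n} f = trans (cong (- f zero +_) (∑-neg (λ i → f (suc i))))
  (sym (ℚ.neg-distrib-+ (f zero) (∑ λ i → f (suc i))))

-- The substitution (j , k) ↦ (punchIn j k , pinch k j) exchanges the two
-- entries of an ordered pair of distinct indices (j , punchIn j k).

punchIn-pinch : ∀ {n} (j : Fin (suc n)) (k : Fin n) →
  punchIn (punchIn j k) (pinch k j) ≡ j
punchIn-pinch zero    zero    = refl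
punchIn-pinch zero    (suc k) = refl
punchIn-pinch (suc j) zero    = refl
punchIn-pinch (suc j) (suc k) = cong suc (punchIn-pinch j k)

punchIn-punchIn : ∀ {n} (j : Fin (2 ℕ.+ n)) (k : Fin (suc n)) (l : Fin n) →
  punchIn (punchIn j k) (punchIn (pinch k j) l) ≡ punchIn j (punchIn k l)
punchIn-punchIn zero    zero    l       = refl
punchIn-punchIn zero    (suc k) l       = refl
punchIn-punchIn (suc j) zero    l       = refl
punchIn-punchIn (suc j) (suc k) zero    = refl
punchIn-punchIn (suc j) (suc k) (suc l) = cong suc (punchIn-punchIn j k l)

-- The same two columns are listed in opposite orders. The index of the larger one drops by one
-- exactly when the smaller has been deleted before it, so the two index sums differ by one.
sign-swap : ∀ {n} (j : Fin (suc n)) (k : Fin n) →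
  sign (punchIn j k) * sign (pinch k j) ≡ - (sign j * sign k)
sign-swap {suc n} zero    zero    = refl
sign-swap {suc n} zero    (suc k) =
  solve 1 (λ x → (:- (:- x)) :* con 1ℚ := :- (con 1ℚ :* (:- x))) refl (sign k)
  where open +-*-Solver
sign-swap {suc n} (suc j) zero    =
  solve 1 (λ x → con 1ℚ :* x := :- ((:- x) :* con 1ℚ)) refl (sign j)
  where open +-*-Solver
sign-swap {suc n} (suc j) (suc k) = begin
  (- sign (punchIn j k)) * (- sign (pinch k j)) ≡⟨ neg*neg (sign (punchIn j k)) (sign (pinch k j)) ⟩
  sign (punchIn j k) * sign (pinch k j)         ≡⟨ sign-swap j k ⟩
  - (sign j * sign k)                           ≡⟨ cong -_ (neg*neg (sign j) (sign k)) ⟨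
  - ((- sign j) * (- sign k))                   ∎
  where
  open ≡-Reasoning
  open +-*-Solver
  neg*neg : ∀ x y → (- x) * (- y) ≡ x * y
  neg*neg = solve 2 (λ x y → (:- x) :* (:- y) := x :* y) refl

-- The substitution exchanges the pairs with column zero in first place and those with column zero
-- in second place; the remaining pairs form the same sum with one column less.
∑∑-swap : ∀ {n} (F : Fin (suc n) → Fin n → ℚ) →
  ∑ (λ j → ∑ (F j)) ≡ ∑ (λ j → ∑ λ k → F (punchIn j k) (pinch k j))
∑∑-swap {zero}  F = refl
∑∑-swap {suc n} F = begin
  ∑ (F zero) + ∑ (λ j → F (suc j) zero + ∑ (λ k → F (suc j) (suc k)))
    ≡⟨ cong (∑ (F zero) +_) (∑-+ (λ j → F (suc j) zero) λ j → ∑ λ k → F (suc j) (suc k)) ⟩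
  ∑ (F zero) + (∑ (λ j → F (suc j) zero) + ∑ (λ j → ∑ (λ k → F (suc j) (suc k))))
    ≡⟨ cong (λ s → ∑ (F zero) + (∑ (λ j → F (suc j) zero) + s)) (∑∑-swap λ j k → F (suc j) (suc k)) ⟩
  ∑ (F zero) + (∑ (λ j → F (suc j) zero) + ∑ (λ j → ∑ (λ k → F (suc (punchIn j k)) (suc (pinch k j)))))
    ≡⟨ solve 3 (λ a b c → a :+ (b :+ c) := b :+ (a :+ c)) refl (∑ (F zero)) (∑ (λ j → F (suc j) zero))
         (∑ λ j → ∑ λ k → F (suc (punchIn j k)) (suc (pinch k j))) ⟩
  ∑ (λ j → F (suc j) zero) + (∑ (F zero) + ∑ (λ j → ∑ (λ k → F (suc (punchIn j k)) (suc (pinch k j)))))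
    ≡⟨ cong (∑ (λ j → F (suc j) zero) +_) (∑-+ (F zero) λ j → ∑ λ k → F (suc (punchIn j k)) (suc (pinch k j))) ⟨
  ∑ (λ j → F (suc j) zero) + ∑ (λ j → F zero j + ∑ (λ k → F (suc (punchIn j k)) (suc (pinch k j)))) ∎
  where
  open ≡-Reasoning
  open +-*-Solver

det-cong : ∀ {n} {A B : Matrix n n} → (∀ i j → A i j ≡ B i j) → det A ≡ det B
det-cong {zero}  A≡B = refl
det-cong {suc n} A≡B = ∑-cong λ j →
  cong₂ (λ a d → sign j * a * d) (A≡B zero j) (det-cong λ i k → A≡B (suc i) (punchIn j k))

swap₀₁ : ∀ {n} → Fin (2 ℕ.+ n) → Fin (2 ℕ.+ n)
swap₀₁ zero          = suc zero
swap₀₁ (suc zero)    = zero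
swap₀₁ (suc (suc i)) = suc (suc i)

-- Expansion along the first two rows is a sum over ordered pairs of distinct columns. Swapping the
-- rows amounts to reversing each pair, which keeps the complementary minor and flips the sign.
det-swap₀₁ : ∀ {n} (A : Matrix (2 ℕ.+ n) (2 ℕ.+ n)) →
  det (λ i → A (swap₀₁ i)) ≡ - det A
det-swap₀₁ {n} A = begin
  det (λ i → A (swap₀₁ i))                                ≡⟨ expand₂ (λ i → A (swap₀₁ i)) ⟩
  ∑ (λ j → ∑ (F (λ i → A (swap₀₁ i)) j))                  ≡⟨ ∑-cong (λ j → ∑-cong (antisym j)) ⟩
  ∑ (λ j → ∑ λ k → - F A (punchIn j k) (pinch k j))       ≡⟨ ∑-cong (λ j → ∑-neg λ k → F A (punchIn j k) (pinch k j)) ⟩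
  ∑ (λ j → - ∑ λ k → F A (punchIn j k) (pinch k j))       ≡⟨ ∑-neg (λ j → ∑ λ k → F A (punchIn j k) (pinch k j)) ⟩
  - ∑ (λ j → ∑ λ k → F A (punchIn j k) (pinch k j))       ≡⟨ cong -_ (∑∑-swap (F A)) ⟨
  - ∑ (λ j → ∑ (F A j))                                   ≡⟨ cong -_ (expand₂ A) ⟨
  - det A                                                 ∎
  where
  open ≡-Reasoning
  open +-*-Solver
  minor : Matrix (2 ℕ.+ n) (2 ℕ.+ n) → Fin (2 ℕ.+ n) → Fin (suc n) → ℚ
  minor B j k = det λ i l → B (suc (suc i)) (punchIn j (punchIn k l))
  F : Matrix (2 ℕ.+ n) (2 ℕ.+ n) → Fin (2 ℕ.+ n) → Fin (suc n) → ℚ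
  F B j k = sign j * B zero j * (sign k * B (suc zero) (punchIn j k) * minor B j k)
  expand₂ : ∀ B → det B ≡ ∑ (λ j → ∑ (F B j))
  expand₂ B = ∑-cong λ j → sym (∑-*ˡ (sign j * B zero j)
    λ k → sign k * B (suc zero) (punchIn j k) * minor B j k)
  rearrange : ∀ s t a b d → s * a * (t * b * d) ≡ s * t * (a * b * d)
  rearrange = solve 5 (λ s t a b d → s :* a :* (t :* b :* d) := s :* t :* (a :* b :* d)) refl
  rearrange′ : ∀ s t s′ t′ a b d → s′ * t′ ≡ - (s * t) →
    s * t * (a * b * d) ≡ - (s′ * t′ * (b * a * d))
  rearrange′ s t s′ t′ a b d e = trans
    (solve 4 (λ st a b d → st :* (a :* b :* d) := :- ((:- st) :* (b :* a :* d))) refl (s * t) a b d)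
    (cong (λ x → - (x * (b * a * d))) (sym e))
  antisym : ∀ j k → F (λ i → A (swap₀₁ i)) j k ≡ - F A (punchIn j k) (pinch k j)
  antisym j k = begin
    F (λ i → A (swap₀₁ i)) j k
      ≡⟨ rearrange (sign j) (sign k) (A (suc zero) j) (A zero j′) (minor A j k) ⟩
    sign j * sign k * (A (suc zero) j * A zero j′ * minor A j k)
      ≡⟨ rearrange′ (sign j) (sign k) (sign j′) (sign k′) (A (suc zero) j) (A zero j′) (minor A j k) (sign-swap j k) ⟩
    - (sign j′ * sign k′ * (A zero j′ * A (suc zero) j * minor A j k))
      ≡⟨ cong₂ (λ a d → - (sign j′ * sign k′ * (A zero j′ * a * d)))
           (cong (A (suc zero)) (punchIn-pinch j k))
           (det-cong λ i l → cong (A (suc (suc i))) (punchIn-punchIn j k l)) ⟨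
    - (sign j′ * sign k′ * (A zero j′ * A (suc zero) (punchIn j′ k′) * minor A j′ k′))
      ≡⟨ cong -_ (rearrange (sign j′) (sign k′) (A zero j′) (A (suc zero) (punchIn j′ k′)) (minor A j′ k′)) ⟨
    - F A j′ k′ ∎
    where
    j′ = punchIn j k
    k′ = pinch k j

x+x≡0⇒x≡0 : ∀ x → x + x ≡ 0ℚ → x ≡ 0ℚ
x+x≡0⇒x≡0 x x+x≡0 = begin
  x             ≡⟨ solve 1 (λ x → x := con ½ :* (x :+ x)) refl x ⟩
  ½ * (x + x)   ≡⟨ cong (½ *_) x+x≡0 ⟩
  ½ * 0ℚ        ≡⟨ ℚ.*-zeroʳ ½ ⟩
  0ℚ            ∎
  where
  open ≡-Reasoning
  open +-*-Solver

-- Adjacent top rows are settled by antisymmetry, since 2 is invertible. Otherwise swapping the top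
-- two rows and expanding along the new first row leaves both equal rows in every minor, with one of
-- them on top again.
det-equal-rows : ∀ {n} (A : Matrix (suc n) (suc n)) (i : Fin n) →
  (∀ j → A zero j ≡ A (suc i) j) → det A ≡ 0ℚ
det-equal-rows A zero eq = x+x≡0⇒x≡0 (det A)
  (trans (cong (det A +_) (trans (det-cong swapped) (det-swap₀₁ A))) (ℚ.+-inverseʳ (det A)))
  where
  swapped : ∀ i j → A i j ≡ A (swap₀₁ i) j
  swapped zero          j = eq j
  swapped (suc zero)    j = sym (eq j)
  swapped (suc (suc i)) j = refl
det-equal-rows {suc (suc n)} A (suc i) eq = begin
  det A                         ≡⟨ -‿involutive (det A) ⟨
  - (- det A)                   ≡⟨ cong -_ (det-swap₀₁ A) ⟨
  - det (λ i → A (swap₀₁ i))    ≡⟨ cong -_ (∑-0 vanish) ⟩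
  0ℚ                            ∎
  where
  open ≡-Reasoning
  vanish : ∀ j → sign j * A (suc zero) j * det (λ i k → A (swap₀₁ (suc i)) (punchIn j k)) ≡ 0ℚ
  vanish j = trans
    (cong (sign j * A (suc zero) j *_)
      (det-equal-rows (λ i k → A (swap₀₁ (suc i)) (punchIn j k)) i λ k → eq (punchIn j k)))
    (ℚ.*-zeroʳ (sign j * A (suc zero) j))

-- Totally unimodular matrices

IsSign : ℚ → Set
IsSign q = q ≡ 0ℚ ⊎ q ≡ 1ℚ ⊎ q ≡ - 1ℚ

record IsSubgroup (P : ℚ → Set) : Set where
  field
    0∈ : P 0ℚ
    +∈ : ∀ {x y} → P x → P y → P (x + y)
    -∈ : ∀ {x} → P x → P (- x)

  sign*∈ : ∀ {s x} → IsSign s → P x → P (s * x)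
  sign*∈ {x = x} (inj₁ refl)        Px = subst P (sym (ℚ.*-zeroˡ x)) 0∈
  sign*∈ {x = x} (inj₂ (inj₁ refl)) Px = subst P (sym (ℚ.*-identityˡ x)) Px
  sign*∈ {x = x} (inj₂ (inj₂ refl)) Px =
    subst P (trans (cong -_ (sym (ℚ.*-identityˡ x))) (ℚ.neg-distribˡ-* 1ℚ x)) (-∈ Px)

  ∑∈ : ∀ {n} {f : Fin n → ℚ} → (∀ i → P (f i)) → P (∑ f)
  ∑∈ {zero}  Pf = 0∈
  ∑∈ {suc n} Pf = +∈ (Pf zero) (∑∈ (Pf ∘ suc))

IsSign-* : ∀ {s t} → IsSign s → IsSign t → IsSign (s * t)
IsSign-* {t = t} (inj₁ refl)        _  = inj₁ (ℚ.*-zeroˡ t)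
IsSign-* {t = t} (inj₂ (inj₁ refl)) t± = subst IsSign (sym (ℚ.*-identityˡ t)) t±
IsSign-* (inj₂ (inj₂ refl)) (inj₁ refl)        = inj₁ refl
IsSign-* (inj₂ (inj₂ refl)) (inj₂ (inj₁ refl)) = inj₂ (inj₂ refl)
IsSign-* (inj₂ (inj₂ refl)) (inj₂ (inj₂ refl)) = inj₂ (inj₁ refl)

IsSign-sign : ∀ {n} (i : Fin n) → IsSign (sign i)
IsSign-sign zero    = inj₂ (inj₁ refl)
IsSign-sign (suc i) with IsSign-sign i
... | inj₁ eq        = inj₁ (cong -_ eq)
... | inj₂ (inj₁ eq) = inj₂ (inj₂ (cong -_ eq))
... | inj₂ (inj₂ eq) = inj₂ (inj₁ (cong -_ eq))

IsSign-square : ∀ {s} → IsSign s → s ≢ 0ℚ → s * s ≡ 1ℚ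
IsSign-square (inj₁ refl)        s≢0 = contradiction refl s≢0
IsSign-square (inj₂ (inj₁ refl)) s≢0 = refl
IsSign-square (inj₂ (inj₂ refl)) s≢0 = refl

δ : ∀ {n} → Fin n → Fin n → ℚ
δ i j = if does (i ≟ j) then 1ℚ else 0ℚ

δ-refl : ∀ {n} (i : Fin n) → δ i i ≡ 1ℚ
δ-refl i rewrite dec-true (i ≟ i) refl = refl

δ-≢ : ∀ {n} {i j : Fin n} → i ≢ j → δ i j ≡ 0ℚ
δ-≢ {i = i} {j} i≢j rewrite dec-false (i ≟ j) i≢j = refl

δ-injective : ∀ {m n} {g : Fin m → Fin n} → Injective _≡_ _≡_ g → ∀ i j → δ (g i) (g j) ≡ δ i j
δ-injective {g = g} g-inj i j with i ≟ j
... | yes refl = δ-refl (g i)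
... | no  i≢j  = δ-≢ (i≢j ∘ g-inj)

∑-δ : ∀ {n} (i : Fin n) (w : Fin n → ℚ) → ∑ (λ e → δ i e * w e) ≡ w i
∑-δ {suc n} i w = begin
  ∑ (λ e → δ i e * w e)
    ≡⟨ Sum.sum-remove {i = i} (λ e → δ i e * w e) ⟩
  δ i i * w i + ∑ (λ k → δ i (punchIn i k) * w (punchIn i k))
    ≡⟨ cong₂ _+_ (cong (_* w i) (δ-refl i)) (∑-0 λ k →
         trans (cong (_* w (punchIn i k)) (δ-≢ (punchInᵢ≢i i k ∘ sym))) (ℚ.*-zeroˡ (w (punchIn i k)))) ⟩
  1ℚ * w i + 0ℚ
    ≡⟨ ℚ.+-identityʳ (1ℚ * w i) ⟩
  1ℚ * w i
    ≡⟨ ℚ.*-identityˡ (w i) ⟩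
  w i ∎
  where open ≡-Reasoning

-- For injective `g`, extension by zero of coefficients indexed by positions to a vector on the
-- ground set.
push : ∀ {j n} → (Fin j → Fin n) → (Fin j → ℚ) → Fin n → ℚ
push g a e = ∑ λ l → δ (g l) e * a l

∑-push : ∀ {j n} (g : Fin j → Fin n) a (w : Fin n → ℚ) →
  ∑ (λ e → push g a e * w e) ≡ ∑ (λ l → a l * w (g l))
∑-push g a w = begin
  ∑ (λ e → push g a e * w e)                     ≡⟨ ∑-cong (λ e → ∑-*ʳ (w e) (λ l → δ (g l) e * a l)) ⟨
  ∑ (λ e → ∑ λ l → δ (g l) e * a l * w e)        ≡⟨ Sum.∑-comm (λ e l → δ (g l) e * a l * w e) ⟩
  ∑ (λ l → ∑ λ e → δ (g l) e * a l * w e)        ≡⟨ ∑-cong (λ l → ∑-cong λ e → rearrange (δ (g l) e) (a l) (w e)) ⟩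
  ∑ (λ l → ∑ λ e → a l * (δ (g l) e * w e))      ≡⟨ ∑-cong (λ l → ∑-*ˡ (a l) (λ e → δ (g l) e * w e)) ⟩
  ∑ (λ l → a l * ∑ λ e → δ (g l) e * w e)        ≡⟨ ∑-cong (λ l → cong (a l *_) (∑-δ (g l) w)) ⟩
  ∑ (λ l → a l * w (g l))                        ∎
  where
  open ≡-Reasoning
  open +-*-Solver
  rearrange : ∀ d a w → d * a * w ≡ a * (d * w)
  rearrange = solve 3 (λ d a w → d :* a :* w := a :* (d :* w)) refl

push-image : ∀ {j n} {g : Fin j → Fin n} → Injective _≡_ _≡_ g → ∀ a l → push g a (g l) ≡ a l
push-image {g = g} g-inj a l = trans
  (∑-cong λ k → cong (_* a k) (trans (δ-injective g-inj k l) (δ-comm k l))) (∑-δ l a)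
  where
  δ-comm : ∀ {n} (i j : Fin n) → δ i j ≡ δ j i
  δ-comm i j with i ≟ j
  ... | yes refl = sym (δ-refl i)
  ... | no  i≢j  = sym (δ-≢ (i≢j ∘ sym))

push-∉image : ∀ {j n} (g : Fin j → Fin n) a {e} → (∀ l → g l ≢ e) → push g a e ≡ 0ℚ
push-∉image g a g≢e = ∑-0 λ l → trans (cong (_* a l) (δ-≢ (g≢e l))) (ℚ.*-zeroˡ (a l))

∷-injective : ∀ {j n} {g : Fin j → Fin n} {e} →
  Injective _≡_ _≡_ g → (∀ l → g l ≢ e) → Injective _≡_ _≡_ (e Vector.∷ g)
∷-injective g-inj g≢e {zero}  {zero}  eq = refl
∷-injective g-inj g≢e {zero}  {suc l} eq = contradiction (sym eq) (g≢e l)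
∷-injective g-inj g≢e {suc k} {zero}  eq = contradiction eq (g≢e k)
∷-injective g-inj g≢e {suc k} {suc l} eq = cong suc (g-inj eq)

-- Column bases and dependencies with entries 0, 1, -1

module _ {m n} (A : Matrix m n) (tu : TotallyUnimodular A) where

  minor : ∀ {j} → (Fin j → Fin m) → (Fin j → Fin n) → ℚ
  minor f g = det λ r l → A (f r) (g l)

  IsSign-entry : ∀ i e → IsSign (A i e)
  IsSign-entry i e = subst IsSign
    (solve 1 (λ x → con 1ℚ :* x :* con 1ℚ :+ con 0ℚ := x) refl (A i e))
    (tu {1} (λ _ → i) (λ _ → e) (λ { {zero} {zero} _ → refl }) (λ { {zero} {zero} _ → refl }))
    where open +-*-Solver

  -- The columns g are independent, as witnessed by the rows f of a unimodular
  -- square submatrix.  Quantifying over subgroups covers linear independence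
  -- (P = 0) and reduction modulo 2 (P = 2ℤ) alike.
  record Basis {j} (g : Fin j → Fin n) : Set₁ where
    field
      rows           : Fin j → Fin m
      rows-injective : Injective _≡_ _≡_ rows
      minor≢0        : minor rows g ≢ 0ℚ
      unimodular     : ∀ {P} → IsSubgroup P → (c : Fin j → ℚ) →
        (∀ r → P (∑ λ l → c l * A (rows r) (g l))) → ∀ l → P (c l)

  emptyBasis : (g : Fin 0 → Fin n) → Basis g
  emptyBasis g = record
    { rows           = λ ()
    ; rows-injective = λ { {()} }
    ; minor≢0        = λ ()
    ; unimodular     = λ _ _ _ ()
    }

  module _ {j} {g : Fin (suc j) → Fin n} (g-inj : Injective _≡_ _≡_ g) (B : Basis (g ∘ suc)) where
    open Basis B

    -- Cramer's rule: the only candidate dependency among the columns g.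
    cramer : Fin (suc j) → ℚ
    cramer l = sign l * minor rows (g ∘ punchIn l)

    IsSign-cramer : ∀ l → IsSign (cramer l)
    IsSign-cramer l = IsSign-* (IsSign-sign l)
      (tu rows (g ∘ punchIn l) rows-injective (punchIn-injective l _ _ ∘ g-inj))

    cramer₀≢0 : cramer zero ≢ 0ℚ
    cramer₀≢0 = minor≢0 ∘ trans (sym (ℚ.*-identityˡ (minor rows (g ∘ suc))))

    -- Laplace expansion along the bordering row. The value is zero for a row already in use, so a
    -- nonzero value both shows that row `i` is new and makes it the next row of the basis.
    ∑-cramer : ∀ i → ∑ (λ l → cramer l * A i (g l)) ≡ minor (i Vector.∷ rows) g
    ∑-cramer i = ∑-cong λ l → solve 3 (λ s d a → s :* d :* a := s :* a :* d) refl
      (sign l) (minor rows (g ∘ punchIn l)) (A i (g l))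
      where open +-*-Solver

    ∑-cramer-rows : ∀ r → ∑ (λ l → cramer l * A (rows r) (g l)) ≡ 0ℚ
    ∑-cramer-rows r = trans (∑-cramer (rows r))
      (det-equal-rows (λ s l → A ((rows r Vector.∷ rows) s) (g l)) r λ _ → refl)

    extendBasis : ∀ i → minor (i Vector.∷ rows) g ≢ 0ℚ → Basis g
    extendBasis i minor′≢0 = record
      { rows           = i Vector.∷ rows
      ; rows-injective = inj
      ; minor≢0        = minor′≢0
      ; unimodular     = unimodular′
      }
      where
      inj : Injective _≡_ _≡_ (i Vector.∷ rows)
      inj = ∷-injective rows-injective λ { r refl → minor′≢0 (trans (sym (∑-cramer i)) (∑-cramer-rows r)) }
      M : ℚ
      M = minor (i Vector.∷ rows) g
      M± : IsSign M
      M± = tu (i Vector.∷ rows) g inj g-inj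
      v₀ : ℚ
      v₀ = cramer zero

      module _ {P : ℚ → Set} (P-sub : IsSubgroup P) (c : Fin (suc j) → ℚ)
               (Pc : ∀ r → P (∑ λ l → c l * A ((i Vector.∷ rows) r) (g l))) where
        open IsSubgroup P-sub
        open +-*-Solver
        open ≡-Reasoning

        -- Since `v₀` is a nonzero sign, it squares to one, and subtracting this multiple of the
        -- Cramer vector clears the coefficient of the new column. The old rows do not notice the
        -- change, so the old basis applies to the rest of `d`.
        d : Fin (suc j) → ℚ
        d l = c l + - (c zero * v₀) * cramer l

        d₀≡0 : d zero ≡ 0ℚ
        d₀≡0 = begin
          c zero + - (c zero * v₀) * v₀
            ≡⟨ solve 2 (λ c v → c :+ (:- (c :* v)) :* v := c :* (con 1ℚ :+ (:- (v :* v)))) refl (c zero) v₀ ⟩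
          c zero * (1ℚ + - (v₀ * v₀))
            ≡⟨ cong (λ x → c zero * (1ℚ + - x)) (IsSign-square (IsSign-cramer zero) cramer₀≢0) ⟩
          c zero * 0ℚ
            ≡⟨ ℚ.*-zeroʳ (c zero) ⟩
          0ℚ ∎

        ∑-d : ∀ k → ∑ (λ l → d l * A k (g l)) ≡
          ∑ (λ l → c l * A k (g l)) + - (c zero * v₀) * ∑ (λ l → cramer l * A k (g l))
        ∑-d k = begin
          ∑ (λ l → d l * A k (g l))
            ≡⟨ ∑-cong (λ l → solve 4 (λ c s v a → (c :+ s :* v) :* a := c :* a :+ s :* (v :* a)) refl
                 (c l) (- (c zero * v₀)) (cramer l) (A k (g l))) ⟩
          ∑ (λ l → c l * A k (g l) + - (c zero * v₀) * (cramer l * A k (g l)))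
            ≡⟨ ∑-+ (λ l → c l * A k (g l)) (λ l → - (c zero * v₀) * (cramer l * A k (g l))) ⟩
          ∑ (λ l → c l * A k (g l)) + ∑ (λ l → - (c zero * v₀) * (cramer l * A k (g l)))
            ≡⟨ cong (∑ (λ l → c l * A k (g l)) +_) (∑-*ˡ (- (c zero * v₀)) λ l → cramer l * A k (g l)) ⟩
          ∑ (λ l → c l * A k (g l)) + - (c zero * v₀) * ∑ (λ l → cramer l * A k (g l)) ∎

        ∑-d-tail : ∀ r → P (∑ λ l → d (suc l) * A (rows r) (g (suc l)))
        ∑-d-tail r = subst P (begin
          ∑ (λ l → c l * A (rows r) (g l))
            ≡⟨ solve 2 (λ s x → s := s :+ x :* con 0ℚ) refl (∑ λ l → c l * A (rows r) (g l)) (- (c zero * v₀)) ⟩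
          ∑ (λ l → c l * A (rows r) (g l)) + - (c zero * v₀) * 0ℚ
            ≡⟨ cong (λ x → ∑ (λ l → c l * A (rows r) (g l)) + - (c zero * v₀) * x) (∑-cramer-rows r) ⟨
          ∑ (λ l → c l * A (rows r) (g l)) + - (c zero * v₀) * ∑ (λ l → cramer l * A (rows r) (g l))
            ≡⟨ ∑-d (rows r) ⟨
          d zero * A (rows r) (g zero) + tail
            ≡⟨ cong (λ x → x * A (rows r) (g zero) + tail) d₀≡0 ⟩
          0ℚ * A (rows r) (g zero) + tail
            ≡⟨ solve 2 (λ a t → con 0ℚ :* a :+ t := t) refl (A (rows r) (g zero)) tail ⟩
          tail ∎) (Pc (suc r))
          where tail = ∑ λ l → d (suc l) * A (rows r) (g (suc l))

        d∈ : ∀ l → P (d l)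
        d∈ zero    = subst P (sym d₀≡0) 0∈
        d∈ (suc l) = unimodular P-sub (d ∘ suc) ∑-d-tail l

        -- Against row `i` the sums of `c` and of `d` both lie in `P`, and they differ by
        -- `c zero * v₀` times the bordered minor `M`, a unit that can be cancelled.
        c₀*v₀*M∈ : P (c zero * v₀ * M)
        c₀*v₀*M∈ = subst P (begin
          ∑ (λ l → c l * A i (g l)) + - ∑ (λ l → d l * A i (g l))
            ≡⟨ cong (λ x → ∑ (λ l → c l * A i (g l)) + - x) (∑-d i) ⟩
          ∑ (λ l → c l * A i (g l)) + - (∑ (λ l → c l * A i (g l)) + - (c zero * v₀) * ∑ (λ l → cramer l * A i (g l)))
            ≡⟨ cong (λ x → ∑ (λ l → c l * A i (g l)) + - (∑ (λ l → c l * A i (g l)) + - (c zero * v₀) * x)) (∑-cramer i) ⟩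
          ∑ (λ l → c l * A i (g l)) + - (∑ (λ l → c l * A i (g l)) + - (c zero * v₀) * M)
            ≡⟨ solve 3 (λ s x m → s :+ :- (s :+ (:- x) :* m) := x :* m) refl (∑ λ l → c l * A i (g l)) (c zero * v₀) M ⟩
          c zero * v₀ * M ∎)
          (+∈ (Pc zero) (-∈ (∑∈ λ l → subst P (ℚ.*-comm (A i (g l)) (d l)) (sign*∈ (IsSign-entry i (g l)) (d∈ l)))))

        c₀*v₀∈ : P (c zero * v₀)
        c₀*v₀∈ = subst P (begin
          M * (c zero * v₀ * M)   ≡⟨ solve 2 (λ m x → m :* (x :* m) := x :* (m :* m)) refl M (c zero * v₀) ⟩
          c zero * v₀ * (M * M)   ≡⟨ cong (c zero * v₀ *_) (IsSign-square M± minor′≢0) ⟩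
          c zero * v₀ * 1ℚ        ≡⟨ ℚ.*-identityʳ (c zero * v₀) ⟩
          c zero * v₀             ∎) (sign*∈ M± c₀*v₀*M∈)

        unimodular′ : ∀ l → P (c l)
        unimodular′ l = subst P
          (solve 3 (λ c x v → c :+ (:- x) :* v :+ v :* x := c) refl (c l) (c zero * v₀) (cramer l))
          (+∈ (d∈ l) (sign*∈ (IsSign-cramer l) c₀*v₀∈))

    extend : (∀ i → ∑ (λ l → cramer l * A i (g l)) ≡ 0ℚ) ⊎ Basis g
    extend with Fin.all? (λ i → ∑ (λ l → cramer l * A i (g l)) ℚ.≟ 0ℚ)
    ... | yes kernel = inj₁ kernel
    ... | no ¬kernel with Fin.¬∀⟶∃¬ m _ (λ i → ∑ (λ l → cramer l * A i (g l)) ℚ.≟ 0ℚ) ¬kernel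
    ...   | i , nonzero = inj₂ (extendBasis i (nonzero ∘ trans (∑-cramer i)))

  SignDependency : Subset n → Set
  SignDependency S = Σ (Fin n → ℚ) λ v → (∀ e → IsSign (v e)) × (∀ {e} → e ∉ S → v e ≡ 0ℚ) ×
    (∃[ e ] v e ≢ 0ℚ) × (∀ i → ∑ (λ e → v e * A i e) ≡ 0ℚ)

  UnimodularColumns : Subset n → Set₁
  UnimodularColumns S = ∀ {P} → IsSubgroup P → (c : Fin n → ℚ) → (∀ {e} → e ∉ S → c e ≡ 0ℚ) →
    (∀ i → P (∑ λ e → c e * A i e)) → ∀ e → P (c e)

  record Enumeration (S : Subset n) : Set₁ where
    field
      {size}            : ℕ
      column            : Fin size → Fin n
      column-injective  : Injective _≡_ _≡_ column
      column-∈          : ∀ l → column l ∈ S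
      column-surjective : ∀ {e} → e ∈ S → ∃[ l ] column l ≡ e
      basis             : Basis column

  -- The columns of `S` join the basis one at a time. The first one that cannot join has a Cramer
  -- vector orthogonal to all rows, which is the sign dependency. `k` bounds the recursion on the
  -- size of `S`.
  enumerate : ∀ k S → ∣ S ∣ ℕ.≤ k → SignDependency S ⊎ Enumeration S
  enumerate k S ∣S∣≤k with nonempty? S
  ... | no  S-empty = inj₂ record
    { column            = λ ()
    ; column-injective  = λ { {()} }
    ; column-∈          = λ ()
    ; column-surjective = λ e∈S → contradiction (_ , e∈S) S-empty
    ; basis             = emptyBasis (λ ())
    }
  enumerate zero    S ∣S∣≤k | yes (e , e∈S) = contradiction (ℕ.<-≤-trans (x∈p⇒∣p-x∣<∣p∣ e∈S) ∣S∣≤k) λ ()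
  enumerate (suc k) S ∣S∣≤k | yes (e , e∈S)
    with enumerate k (S - e) (ℕ.≤-pred (ℕ.<-≤-trans (x∈p⇒∣p-x∣<∣p∣ e∈S) ∣S∣≤k))
  ... | inj₁ (v , v± , v-off , v≢0 , Av≡0) =
    inj₁ (v , v± , (λ e∉S → v-off (e∉S ∘ p─q⊆p S ⁅ e ⁆)) , v≢0 , Av≡0)
  ... | inj₂ E = result
    where
    open Enumeration E
    column′ : Fin (suc size) → Fin n
    column′ = e Vector.∷ column
    column≢e : ∀ l → column l ≢ e
    column≢e l eq = p─q-disjoint S ⁅ e ⁆ (column-∈ l) (subst (_∈ ⁅ e ⁆) (sym eq) (x∈⁅x⁆ e))
    column′-injective : Injective _≡_ _≡_ column′
    column′-injective = ∷-injective column-injective column≢e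
    column′-∈ : ∀ l → column′ l ∈ S
    column′-∈ zero    = e∈S
    column′-∈ (suc l) = p─q⊆p S ⁅ e ⁆ (column-∈ l)
    column′-surjective : ∀ {x} → x ∈ S → ∃[ l ] column′ l ≡ x
    column′-surjective {x} x∈S with x ≟ e
    ... | yes refl = zero , refl
    ... | no  x≢e with column-surjective (x∈p∧x≢y⇒x∈p-y x∈S x≢e)
    ...   | l , eq = suc l , eq
    result : SignDependency S ⊎ Enumeration S
    result with extend column′-injective basis
    ... | inj₂ B = inj₂ record
      { column            = column′
      ; column-injective  = column′-injective
      ; column-∈          = column′-∈
      ; column-surjective = column′-surjective
      ; basis             = B
      }
    ... | inj₁ kernel = inj₁
      ( push column′ v , v± , v-off , (e , v≢0)
      , λ i → trans (∑-push column′ v (A i)) (kernel i))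
      where
      v = cramer column′-injective basis
      v-off : ∀ {x} → x ∉ S → push column′ v x ≡ 0ℚ
      v-off x∉S = push-∉image column′ v λ l eq → x∉S (subst (_∈ S) eq (column′-∈ l))
      v≢0 : push column′ v e ≢ 0ℚ
      v≢0 = cramer₀≢0 column′-injective basis ∘ trans (sym (push-image column′-injective v zero))
      v± : ∀ x → IsSign (push column′ v x)
      v± x with x ∈? S
      ... | no  x∉S = inj₁ (v-off x∉S)
      ... | yes x∈S with column′-surjective x∈S
      ...   | l , refl = subst IsSign (sym (push-image column′-injective v l))
        (IsSign-cramer column′-injective basis l)

  enumeration⇒unimodular : ∀ {S} → Enumeration S → UnimodularColumns S
  enumeration⇒unimodular {S} E {P} P-sub c c-off Pc e = c∈
    where
    open Enumeration E
    open Basis basis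
    c≡push : ∀ x → c x ≡ push column (c ∘ column) x
    c≡push x with x ∈? S
    ... | no  x∉S = trans (c-off x∉S)
      (sym (push-∉image column (c ∘ column) λ k eq → x∉S (subst (_∈ S) eq (column-∈ k))))
    ... | yes x∈S =
      let k , eq = column-surjective x∈S
      in subst (λ y → c y ≡ push column (c ∘ column) y) eq
           (sym (push-image column-injective (c ∘ column) k))
    c∘column∈ : ∀ l → P (c (column l))
    c∘column∈ = unimodular P-sub (c ∘ column) λ r → subst P
      (trans (∑-cong λ x → cong (_* A (rows r) x) (c≡push x)) (∑-push column (c ∘ column) (A (rows r))))
      (Pc (rows r))
    c∈ : P (c e)
    c∈ with e ∈? S
    ... | no  e∉S = subst P (sym (c-off e∉S)) (IsSubgroup.0∈ P-sub)
    ... | yes e∈S = let l , eq = column-surjective e∈S in subst (P ∘ c) eq (c∘column∈ l)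

  dichotomy : ∀ S → SignDependency S ⊎ UnimodularColumns S
  dichotomy S with enumerate ∣ S ∣ S ℕ.≤-refl
  ... | inj₁ dependency = inj₁ dependency
  ... | inj₂ E = inj₂ (enumeration⇒unimodular E)

-- The integral kernel of a totally unimodular matrix

Even : ℤ → Set
Even k = ∃[ h ] k ≡ h ℤ.+ h

IsUnit : ℤ → Set
IsUnit k = k ≡ 1ℤ ⊎ k ≡ -1ℤ

-- The integral kernel of a totally unimodular representation of M, reduced to
-- the properties that survive a change of orientation.
record CircuitLattice {n} (M : Matroid n) : Set₁ where
  open Matroid M
  field
    K                : (Fin n → ℤ) → Set
    K-cong           : ∀ {u v} → (∀ e → u e ≡ v e) → K u → K v
    K-+              : ∀ {u v} → K u → K v → K (λ e → u e ℤ.+ v e)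
    K-neg            : ∀ {u} → K u → K (λ e → ℤ.- u e)
    K-halve          : ∀ {u} → K (λ e → u e ℤ.+ u e) → K u
    independent⇒0    : ∀ {S u} → Indep S → K u → (∀ {e} → e ∉ S → u e ≡ 0ℤ) → ∀ e → u e ≡ 0ℤ
    independent⇒even : ∀ {S u} → Indep S → K u → (∀ {e} → e ∉ S → Even (u e)) → ∀ e → Even (u e)
    circuitVector    : ∀ {C} → Circuit C →
      Σ (Fin n → ℤ) λ u → K u × (∀ {e} → e ∈ C → IsUnit (u e)) × (∀ {e} → e ∉ C → u e ≡ 0ℤ)

fromℤ-injective : ∀ {a b} → fromℤ a ≡ fromℤ b → a ≡ b
fromℤ-injective = cong ℚ.numerator

fromℤ-+ : ∀ a b → fromℤ (a ℤ.+ b) ≡ fromℤ a + fromℤ b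
fromℤ-+ a b = begin
  fromℤ (a ℤ.+ b)               ≡⟨ ℚ.↥p/↧p≡p (fromℤ (a ℤ.+ b)) ⟨
  (a ℤ.+ b) / 1                 ≡⟨ cong₂ (λ x y → (x ℤ.+ y) / 1) (ℤ.*-identityʳ a) (ℤ.*-identityʳ b) ⟨
  (a ℤ.* 1ℤ ℤ.+ b ℤ.* 1ℤ) / 1 ∎
  where open ≡-Reasoning

fromℤ-neg : ∀ a → fromℤ (ℤ.- a) ≡ - fromℤ a
fromℤ-neg +0  = refl
fromℤ-neg +[1+ _ ]  = refl
fromℤ-neg -[1+ _ ]  = refl

IsZero : ℚ → Set
IsZero q = q ≡ 0ℚ

IsEven : ℚ → Set
IsEven q = ∃[ h ] q ≡ fromℤ (h ℤ.+ h)

zeroSubgroup : IsSubgroup IsZero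
zeroSubgroup = record
  { 0∈ = refl
  ; +∈ = λ { refl refl → refl }
  ; -∈ = λ { refl → refl }
  }

evenSubgroup : IsSubgroup IsEven
evenSubgroup = record
  { 0∈ = 0ℤ , refl
  ; +∈ = λ { (h , refl) (k , refl) → h ℤ.+ k ,
      trans (sym (fromℤ-+ (h ℤ.+ h) (k ℤ.+ k))) (cong fromℤ (interchange h h k k)) }
  ; -∈ = λ { (h , refl) → ℤ.- h ,
      trans (sym (fromℤ-neg (h ℤ.+ h))) (cong fromℤ (ℤ.neg-distrib-+ h h)) }
  }

sign⇒fromℤ : ∀ {q} → IsSign q → ∃[ k ] fromℤ k ≡ q × (k ≡ 0ℤ ⊎ IsUnit k)
sign⇒fromℤ (inj₁ refl)        = 0ℤ , refl , inj₁ refl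
sign⇒fromℤ (inj₂ (inj₁ refl)) = 1ℤ , refl , inj₂ (inj₁ refl)
sign⇒fromℤ (inj₂ (inj₂ refl)) = -1ℤ , refl , inj₂ (inj₂ refl)

module _ {m n} {M : Matroid n} (A : Matrix m n) (tu : TotallyUnimodular A) (rep : Represents A M) where
  open Matroid M
  open MatroidProperties M

  private
    row : Fin m → (Fin n → ℤ) → ℚ
    row i u = ∑ λ e → fromℤ (u e) * A i e

    Kernel : (Fin n → ℤ) → Set
    Kernel u = ∀ i → row i u ≡ 0ℚ

    row-+ : ∀ i u v → row i (λ e → u e ℤ.+ v e) ≡ row i u + row i v
    row-+ i u v = trans
      (∑-cong λ e → trans (cong (_* A i e) (fromℤ-+ (u e) (v e))) (ℚ.*-distribʳ-+ (A i e) (fromℤ (u e)) (fromℤ (v e))))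
      (∑-+ (λ e → fromℤ (u e) * A i e) (λ e → fromℤ (v e) * A i e))

    row-neg : ∀ i u → row i (λ e → ℤ.- u e) ≡ - row i u
    row-neg i u = trans
      (∑-cong λ e → trans (cong (_* A i e) (fromℤ-neg (u e))) (sym (ℚ.neg-distribˡ-* (fromℤ (u e)) (A i e))))
      (∑-neg λ e → fromℤ (u e) * A i e)

    columns : ∀ {S} → Indep S → IndependentColumns A S
    columns {S} = Equivalence.to (rep S)

    kernel⇒0 : ∀ {S u} → Indep S → Kernel u → (∀ {e} → e ∉ S → u e ≡ 0ℤ) → ∀ e → u e ≡ 0ℤ
    kernel⇒0 {u = u} indep Ku u-off e =
      fromℤ-injective (columns indep (fromℤ ∘ u) (cong fromℤ ∘ u-off) Ku e)

    -- Off S the vector u is even, so its part on S is mapped into 2ℤ by the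
    -- rows of A, and unimodularity of S makes that part even as well.
    kernel⇒even : ∀ {S u} → Indep S → Kernel u → (∀ {e} → e ∉ S → Even (u e)) → ∀ e → Even (u e)
    kernel⇒even {S} {u} indep Ku u-off e with dichotomy A tu S
    ... | inj₁ (v , _ , v-off , (x , v≢0) , Av≡0) = contradiction (columns indep v v-off Av≡0 x) v≢0
    ... | inj₂ unimodular = even e
      where
      on : Fin n → ℤ
      on x with x ∈? S
      ... | yes _ = u x
      ... | no  _ = 0ℤ
      off : Fin n → ℤ
      off x with x ∈? S
      ... | yes _ = 0ℤ
      ... | no  _ = u x
      on-off : ∀ {x} → x ∉ S → on x ≡ 0ℤ
      on-off {x} x∉S with x ∈? S
      ... | yes x∈S = contradiction x∈S x∉S
      ... | no  _   = refl
      on-∈ : ∀ {x} → x ∈ S → on x ≡ u x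
      on-∈ {x} x∈S with x ∈? S
      ... | yes _   = refl
      ... | no  x∉S = contradiction x∈S x∉S
      on+off : ∀ x → on x ℤ.+ off x ≡ u x
      on+off x with x ∈? S
      ... | yes _ = ℤ.+-identityʳ (u x)
      ... | no  _ = ℤ.+-identityˡ (u x)
      off-even : ∀ x → IsEven (fromℤ (off x))
      off-even x with x ∈? S
      ... | yes _   = 0ℤ , refl
      ... | no  x∉S = let h , eq = u-off x∉S in h , cong fromℤ eq
      open IsSubgroup evenSubgroup
      row-on : ∀ i → IsEven (row i on)
      row-on i = subst IsEven
        (begin
          - row i off                            ≡⟨ ℚ.+-identityˡ (- row i off) ⟨
          0ℚ + - row i off                       ≡⟨ cong (_+ - row i off) (Ku i) ⟨
          row i u + - row i off                  ≡⟨ cong (_+ - row i off) (∑-cong λ x → cong (λ k → fromℤ k * A i x) (on+off x)) ⟨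
          row i (λ x → on x ℤ.+ off x) + - row i off ≡⟨ cong (_+ - row i off) (row-+ i on off) ⟩
          row i on + row i off + - row i off     ≡⟨ ℚ.+-assoc (row i on) (row i off) (- row i off) ⟩
          row i on + (row i off + - row i off)   ≡⟨ cong (row i on +_) (ℚ.+-inverseʳ (row i off)) ⟩
          row i on + 0ℚ                          ≡⟨ ℚ.+-identityʳ (row i on) ⟩
          row i on                               ∎)
        (-∈ (∑∈ λ x → subst IsEven (ℚ.*-comm (A i x) (fromℤ (off x)))
          (sign*∈ (IsSign-entry A tu i x) (off-even x))))
        where open ≡-Reasoning
      even : ∀ x → Even (u x)
      even x with x ∈? S
      ... | no  x∉S = u-off x∉S
      ... | yes x∈S =
        let h , eq = unimodular evenSubgroup (fromℤ ∘ on) (cong fromℤ ∘ on-off) row-on x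
        in h , trans (sym (on-∈ x∈S)) (fromℤ-injective eq)

    signVector : ∀ {C} → Circuit C →
      Σ (Fin n → ℤ) λ u → Kernel u × (∀ {e} → e ∈ C → IsUnit (u e)) × (∀ {e} → e ∉ C → u e ≡ 0ℤ)
    signVector {C} circ with dichotomy A tu C
    ... | inj₂ unimodular = contradiction
      (Equivalence.from (rep C) λ c c-off Ac≡0 → unimodular zeroSubgroup c c-off Ac≡0) (proj₁ circ)
    ... | inj₁ (v , v± , v-off , (x , v≢0) , Av≡0) = u , Ku , u-on , u-off
      where
      u : Fin n → ℤ
      u e = proj₁ (sign⇒fromℤ (v± e))
      fromℤ-u : ∀ e → fromℤ (u e) ≡ v e
      fromℤ-u e = proj₁ (proj₂ (sign⇒fromℤ (v± e)))
      Ku : Kernel u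
      Ku i = trans (∑-cong λ e → cong (_* A i e) (fromℤ-u e)) (Av≡0 i)
      u-off : ∀ {e} → e ∉ C → u e ≡ 0ℤ
      u-off e∉C = fromℤ-injective (trans (fromℤ-u _) (v-off e∉C))
      -- A zero of u on C would make u a dependency of an independent set.
      u-on : ∀ {e} → e ∈ C → IsUnit (u e)
      u-on {e} e∈C with proj₂ (proj₂ (sign⇒fromℤ (v± e)))
      ... | inj₂ unit = unit
      ... | inj₁ ue≡0 = contradiction
        (trans (sym (fromℤ-u x)) (cong fromℤ (kernel⇒0 (circuit⁻ circ e∈C) Ku off x))) v≢0
        where
        off : ∀ {y} → y ∉ C - e → u y ≡ 0ℤ
        off {y} y∉ with y ∈? C
        ... | no  y∉C = u-off y∉C
        ... | yes y∈C with y Fin.≟ e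
        ...   | yes refl = ue≡0
        ...   | no  y≢e  = contradiction (x∈p∧x≢y⇒x∈p-y y∈C y≢e) y∉

  circuitLattice : CircuitLattice M
  circuitLattice = record
    { K                = Kernel
    ; K-cong           = λ u≗v Ku i → trans (∑-cong λ e → cong (λ k → fromℤ k * A i e) (sym (u≗v e))) (Ku i)
    ; K-+              = λ {u} {v} Ku Kv i → trans (row-+ i u v) (cong₂ _+_ (Ku i) (Kv i))
    ; K-neg            = λ {u} Ku i → trans (row-neg i u) (cong -_ (Ku i))
    ; K-halve          = λ {u} Kuu i → x+x≡0⇒x≡0 (row i u) (trans (sym (row-+ i u u)) (Kuu i))
    ; independent⇒0    = kernel⇒0
    ; independent⇒even = kernel⇒even
    ; circuitVector    = signVector
    }

-- Parity and sign vectors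

Odd : ℤ → Set
Odd k = ∃[ h ] k ≡ 1ℤ ℤ.+ (h ℤ.+ h)

double-injective : ∀ {h k} → h ℤ.+ h ≡ k ℤ.+ k → h ≡ k
double-injective {h} {k} eq = ℤ.*-cancelˡ-≡ (ℤ.+ 2) h k (trans (2* h) (trans eq (sym (2* k))))
  where
  open ℤ.+-*-Solver
  2* : ∀ h → (ℤ.+ 2) ℤ.* h ≡ h ℤ.+ h
  2* = solve 1 (λ h → con (ℤ.+ 2) :* h := h :+ h) refl

1≢double : ∀ h → 1ℤ ≢ h ℤ.+ h
1≢double +0            ()
1≢double +[1+ zero ]   ()
1≢double +[1+ suc n ]  ()
1≢double (-[1+ n ])    ()

parity : ∀ k → Even k ⊎ Odd k
parity (ℤ.+ zero) = inj₁ (0ℤ , refl)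
parity (ℤ.+ suc n) with parity (ℤ.+ n)
... | inj₁ (h , eq) = inj₂ (h , cong (λ k → 1ℤ ℤ.+ k) eq)
... | inj₂ (h , eq) = inj₁ (1ℤ ℤ.+ h , trans (cong (λ k → 1ℤ ℤ.+ k) eq)
  (solve 1 (λ h → con 1ℤ :+ (con 1ℤ :+ (h :+ h)) := (con 1ℤ :+ h) :+ (con 1ℤ :+ h)) refl h))
  where open ℤ.+-*-Solver
parity (-[1+ zero ]) = inj₂ (-1ℤ , refl)
parity (-[1+ suc n ]) with parity (-[1+ n ])
... | inj₁ (h , eq) = inj₂ (-1ℤ ℤ.+ h , trans (cong (λ k → -1ℤ ℤ.+ k) eq)
  (solve 1 (λ h → con -1ℤ :+ (h :+ h) := con 1ℤ :+ ((con -1ℤ :+ h) :+ (con -1ℤ :+ h))) refl h))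
  where open ℤ.+-*-Solver
... | inj₂ (h , eq) = inj₁ (h , trans (cong (λ k → -1ℤ ℤ.+ k) eq)
  (solve 1 (λ h → con -1ℤ :+ (con 1ℤ :+ (h :+ h)) := h :+ h) refl h))
  where open ℤ.+-*-Solver

even∧odd⇒⊥ : ∀ {k} → Even k → ¬ Odd k
even∧odd⇒⊥ (h , refl) (j , eq) = 1≢double (h ℤ.+ ℤ.- j) (begin
  1ℤ                                        ≡⟨ solve 1 (λ j → con 1ℤ := (con 1ℤ :+ (j :+ j)) :+ :- (j :+ j)) refl j ⟩
  (1ℤ ℤ.+ (j ℤ.+ j)) ℤ.+ ℤ.- (j ℤ.+ j)      ≡⟨ cong (λ k → k ℤ.+ ℤ.- (j ℤ.+ j)) eq ⟨
  (h ℤ.+ h) ℤ.+ ℤ.- (j ℤ.+ j)               ≡⟨ solve 2 (λ h j → (h :+ h) :+ :- (j :+ j) := (h :+ :- j) :+ (h :+ :- j)) refl h j ⟩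
  (h ℤ.+ ℤ.- j) ℤ.+ (h ℤ.+ ℤ.- j)           ∎)
  where
  open ≡-Reasoning
  open ℤ.+-*-Solver

even-+ : ∀ {j k} → Even j → Even k → Even (j ℤ.+ k)
even-+ (h , refl) (i , refl) = h ℤ.+ i ,
  solve 2 (λ h i → (h :+ h) :+ (i :+ i) := (h :+ i) :+ (h :+ i)) refl h i
  where open ℤ.+-*-Solver

odd-+ : ∀ {j k} → Odd j → Even k → Odd (j ℤ.+ k)
odd-+ (h , refl) (i , refl) = h ℤ.+ i ,
  solve 2 (λ h i → (con 1ℤ :+ (h :+ h)) :+ (i :+ i) := con 1ℤ :+ ((h :+ i) :+ (h :+ i))) refl h i
  where open ℤ.+-*-Solver

even-0 : Even 0ℤ
even-0 = 0ℤ , refl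

unit-odd : ∀ {k} → IsUnit k → Odd k
unit-odd (inj₁ refl) = 0ℤ , refl
unit-odd (inj₂ refl) = -1ℤ , refl

unit-neg : ∀ {k} → IsUnit k → IsUnit (ℤ.- k)
unit-neg (inj₁ refl) = inj₂ refl
unit-neg (inj₂ refl) = inj₁ refl

unit-* : ∀ {j k} → IsUnit j → IsUnit k → IsUnit (j ℤ.* k)
unit-* (inj₁ refl) (inj₁ refl) = inj₁ refl
unit-* (inj₁ refl) (inj₂ refl) = inj₂ refl
unit-* (inj₂ refl) (inj₁ refl) = inj₂ refl
unit-* (inj₂ refl) (inj₂ refl) = inj₁ refl

unit-+-even : ∀ {j k} → IsUnit j → IsUnit k → Even (j ℤ.+ k)
unit-+-even (inj₁ refl) (inj₁ refl) = 1ℤ , refl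
unit-+-even (inj₁ refl) (inj₂ refl) = 0ℤ , refl
unit-+-even (inj₂ refl) (inj₁ refl) = 0ℤ , refl
unit-+-even (inj₂ refl) (inj₂ refl) = -1ℤ , refl

unit-square : ∀ {k} → IsUnit k → k ℤ.* k ≡ 1ℤ
unit-square (inj₁ refl) = refl
unit-square (inj₂ refl) = refl

unit≢0 : ∀ {k} → IsUnit k → k ≢ 0ℤ
unit≢0 (inj₁ refl) ()
unit≢0 (inj₂ refl) ()

SignValue : ℤ → Set
SignValue k = k ≡ 0ℤ ⊎ IsUnit k

-- With `v` a sign, `h` is half of `g` rounded up or down: an even `g` determines it, an odd `g`
-- leaves two choices that differ by one. The later constructions choose `g` by the values at which
-- `h` is forced.
half-0 : ∀ {g v h} → SignValue v → g ≡ v ℤ.+ (h ℤ.+ h) → g ≡ 0ℤ → v ≡ 0ℤ × h ≡ 0ℤ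
half-0 {h = h} (inj₁ refl) eq refl =
  refl , sym (double-injective {0ℤ} {h} (trans eq (ℤ.+-identityˡ (h ℤ.+ h))))
half-0 {h = h} (inj₂ u) eq refl with unit-odd u
... | j , refl = contradiction (odd-+ (j , refl) (h , refl)) λ odd → even∧odd⇒⊥ even-0 (subst Odd (sym eq) odd)

half-2 : ∀ {g v h} → SignValue v → g ≡ v ℤ.+ (h ℤ.+ h) → g ≡ ℤ.+ 2 → h ≡ 1ℤ
half-2 {h = h} (inj₁ refl) eq refl = sym (double-injective {1ℤ} {h} (trans eq (ℤ.+-identityˡ (h ℤ.+ h))))
half-2 {h = h} (inj₂ u) eq refl =
  ⊥-elim (even∧odd⇒⊥ (1ℤ , refl) (subst Odd (sym eq) (odd-+ (unit-odd u) (h , refl))))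

half-1 : ∀ {g v h} → SignValue v → g ≡ v ℤ.+ (h ℤ.+ h) → g ≡ 1ℤ →
  (v ≡ 1ℤ × h ≡ 0ℤ) ⊎ (v ≡ -1ℤ × h ≡ 1ℤ)
half-1 {h = h} (inj₁ refl) eq refl = ⊥-elim (1≢double h (trans eq (ℤ.+-identityˡ (h ℤ.+ h))))
half-1 {h = h} (inj₂ (inj₁ refl)) eq refl =
  inj₁ (refl , sym (double-injective {0ℤ} {h} (∙-cancelˡ 1ℤ 0ℤ (h ℤ.+ h) eq)))
half-1 {h = h} (inj₂ (inj₂ refl)) eq refl =
  inj₂ (refl , sym (double-injective {1ℤ} {h} (∙-cancelˡ -1ℤ (ℤ.+ 2) (h ℤ.+ h) eq)))

half--1 : ∀ {g v h} → SignValue v → g ≡ v ℤ.+ (h ℤ.+ h) → g ≡ -1ℤ → h ≡ 0ℤ ⊎ h ≡ -1ℤ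
half--1 {g} {v} {h} v± eq refl
  with half-1 {1ℤ} {ℤ.- v} {ℤ.- h} (neg± v±) (trans (cong ℤ.-_ eq) (solve 2 (λ v h → :- (v :+ (h :+ h)) := :- v :+ (:- h :+ :- h)) refl v h)) refl
  where
  open ℤ.+-*-Solver
  neg± : ∀ {k} → SignValue k → SignValue (ℤ.- k)
  neg± (inj₁ refl) = inj₁ refl
  neg± (inj₂ u)    = inj₂ (unit-neg u)
... | inj₁ (_ , -h≡0) = inj₁ (ℤ.neg-injective -h≡0)
... | inj₂ (_ , -h≡1) = inj₂ (ℤ.neg-injective -h≡1)

module _ {n} {P : Fin n → Set} (P? : Decidable P) where
  select : Subset n
  select = tabulate (does ∘ P?)

  ∈-select⁺ : ∀ {e} → P e → e ∈ select
  ∈-select⁺ {e} Pe = lookup⇒[]= e select (trans (lookup∘tabulate (does ∘ P?) e) (dec-true (P? e) Pe))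

  ∈-select⁻ : ∀ {e} → e ∈ select → P e
  ∈-select⁻ {e} e∈ with P? e | trans (sym (lookup∘tabulate (does ∘ P?) e)) ([]=⇒lookup e∈)
  ... | yes Pe | _  = Pe
  ... | no  _  | ()

odd? : ∀ k → Dec (Odd k)
odd? k with parity k
... | inj₁ even = no (even∧odd⇒⊥ even)
... | inj₂ odd  = yes odd

oddSupport : ∀ {n} → (Fin n → ℤ) → Subset n
oddSupport g = select λ e → odd? (g e)

module _ {n} (g : Fin n → ℤ) where
  ∈-oddSupport⁺ : ∀ {e} → Odd (g e) → e ∈ oddSupport g
  ∈-oddSupport⁺ = ∈-select⁺ λ e → odd? (g e)

  ∈-oddSupport⁻ : ∀ {e} → e ∈ oddSupport g → Odd (g e)
  ∈-oddSupport⁻ = ∈-select⁻ λ e → odd? (g e)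

  ∉-oddSupport⁻ : ∀ {e} → e ∉ oddSupport g → Even (g e)
  ∉-oddSupport⁻ {e} e∉ with parity (g e)
  ... | inj₁ even = even
  ... | inj₂ odd  = contradiction (∈-oddSupport⁺ odd) e∉

abstract
  indicator : ∀ {n} → Subset n → Fin n → ℤ
  indicator S e = if does (e ∈? S) then 1ℤ else 0ℤ

  indicator-∈ : ∀ {n} {S : Subset n} {e} → e ∈ S → indicator S e ≡ 1ℤ
  indicator-∈ {S = S} {e} e∈S rewrite dec-true (e ∈? S) e∈S = refl

  indicator-∉ : ∀ {n} {S : Subset n} {e} → e ∉ S → indicator S e ≡ 0ℤ
  indicator-∉ {S = S} {e} e∉S rewrite dec-false (e ∈? S) e∉S = refl

-- Rounding, cycles modulo 2 and reorientation

module LatticeProperties {n} {M : Matroid n} (L : CircuitLattice M) where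
  open Matroid M
  open MatroidProperties M
  open CircuitLattice L

  K-− : ∀ {u v} → K u → K v → K (λ e → u e ℤ.+ ℤ.- v e)
  K-− Ku Kv = K-+ Ku (K-neg Kv)

  K-multiple : ∀ {u} m → K u → K (λ e → ℤ.+ m ℤ.* u e)
  K-multiple {u} zero    Ku = K-cong (λ e → trans (ℤ.+-inverseʳ (u e)) (sym (ℤ.*-zeroˡ (u e)))) (K-− Ku Ku)
  K-multiple {u} (suc m) Ku = K-cong (λ e → sym (ℤ.suc-* (ℤ.+ m) (u e))) (K-+ Ku (K-multiple m Ku))

  K-scale : ∀ {u} k → K u → K (λ e → k ℤ.* u e)
  K-scale     (ℤ.+ m)    Ku = K-multiple m Ku
  K-scale {u} (-[1+ m ]) Ku = K-cong (λ e → ℤ.neg-distribˡ-* (ℤ.+ suc m) (u e)) (K-neg (K-multiple (suc m) Ku))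

  record Rounding (g : Fin n → ℤ) (S : Subset n) : Set where
    field
      {v h} : Fin n → ℤ
      K-v   : K v
      K-h   : K h
      v-on  : ∀ {e} → e ∈ S → IsUnit (v e)
      v-off : ∀ {e} → e ∉ S → v e ≡ 0ℤ
      split : ∀ e → g e ≡ v e ℤ.+ (h e ℤ.+ h e)

    v-sign : ∀ e → SignValue (v e)
    v-sign e with e ∈? S
    ... | yes e∈S = inj₂ (v-on e∈S)
    ... | no  e∉S = inj₁ (v-off e∉S)

  abstract
    -- The odd support of an integral vector of the kernel is a disjoint union of
    -- circuits, whose sign vectors add up to v.
    round : ∀ {g S} → K g → (∀ {e} → e ∈ S → Odd (g e)) → (∀ {e} → e ∉ S → Even (g e)) → Rounding g S
    round {g} {S} = go ∣ S ∣ S ℕ.≤-refl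
      where
      go : ∀ k {g} S → ∣ S ∣ ℕ.≤ k → K g → (∀ {e} → e ∈ S → Odd (g e)) → (∀ {e} → e ∉ S → Even (g e)) → Rounding g S
      go k {g} S ∣S∣≤k Kg odd even with indep? S
      -- Only entries on the independent set `S` could be odd, so unimodularity makes all of `g`
      -- even: `S` is in fact empty and `g` is twice a kernel vector.
      ... | yes indep = record
        { v = λ _ → 0ℤ ; h = λ e → proj₁ (all-even e)
        ; K-v   = K-cong (λ e → ℤ.*-zeroˡ (g e)) (K-scale 0ℤ Kg)
        ; K-h   = K-halve (K-cong (λ e → proj₂ (all-even e)) Kg)
        ; v-on  = λ {e} e∈S → ⊥-elim (even∧odd⇒⊥ (all-even e) (odd e∈S))
        ; v-off = λ _ → refl
        ; split = λ e → trans (proj₂ (all-even e)) (sym (ℤ.+-identityˡ _))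
        }
        where
        all-even : ∀ e → Even (g e)
        all-even = independent⇒even indep Kg even
      ... | no dep = step k ∣S∣≤k
        where
        C-exists : ∃[ C ] Circuit C × C ⊆ S
        C-exists = circuit-within dep
        C : Subset n
        C = proj₁ C-exists
        circ : Circuit C
        circ = proj₁ (proj₂ C-exists)
        C⊆S : C ⊆ S
        C⊆S = proj₂ (proj₂ C-exists)
        c : Fin n → ℤ
        c = proj₁ (circuitVector circ)
        Kc : K c
        Kc = proj₁ (proj₂ (circuitVector circ))
        c-on : ∀ {e} → e ∈ C → IsUnit (c e)
        c-on = proj₁ (proj₂ (proj₂ (circuitVector circ)))
        c-off : ∀ {e} → e ∉ C → c e ≡ 0ℤ
        c-off = proj₂ (proj₂ (proj₂ (circuitVector circ)))
        g′ : Fin n → ℤ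
        g′ e = g e ℤ.+ ℤ.- c e
        g′-off : ∀ {e} → e ∉ C → g e ≡ g′ e
        g′-off {e} e∉C = trans (sym (ℤ.+-identityʳ (g e))) (cong (λ k → g e ℤ.+ ℤ.- k) (sym (c-off e∉C)))
        odd-unit : ∀ {j k} → Odd j → IsUnit k → Even (j ℤ.+ k)
        odd-unit (h , refl) (inj₁ refl) = h ℤ.+ 1ℤ ,
          solve 1 (λ h → (con 1ℤ :+ (h :+ h)) :+ con 1ℤ := (h :+ con 1ℤ) :+ (h :+ con 1ℤ)) refl h
          where open ℤ.+-*-Solver
        odd-unit (h , refl) (inj₂ refl) = h ,
          solve 1 (λ h → (con 1ℤ :+ (h :+ h)) :+ con -1ℤ := h :+ h) refl h
          where open ℤ.+-*-Solver
        odd′ : ∀ {e} → e ∈ S ─ C → Odd (g′ e)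
        odd′ e∈ = subst Odd (g′-off (p─q-disjoint S C e∈)) (odd (p─q⊆p S C e∈))
        even′ : ∀ {e} → e ∉ S ─ C → Even (g′ e)
        even′ {e} e∉ with e ∈? C
        ... | yes e∈C = odd-unit (odd (C⊆S e∈C)) (unit-neg (c-on e∈C))
        ... | no  e∉C = subst Even (g′-off e∉C) (even λ e∈S → e∉ (x∈p∧x∉q⇒x∈p─q e∈S e∉C))
        smaller : ∣ S ─ C ∣ ℕ.< ∣ S ∣
        smaller = let e , e∈C , _ = ⊉circuit indep-⊥ circ
                  in p∩q≢∅⇒∣p─q∣<∣p∣ S C (e , x∈p∩q⁺ (C⊆S e∈C , e∈C))
        step : ∀ k → ∣ S ∣ ℕ.≤ k → Rounding g S
        step zero    ∣S∣≤0 = contradiction (ℕ.<-≤-trans smaller ∣S∣≤0) λ ()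
        step (suc k) ∣S∣≤k = record
          { v = λ e → R.v e ℤ.+ c e ; h = R.h
          ; K-v   = K-+ R.K-v Kc
          ; K-h   = R.K-h
          ; v-on  = v-on
          ; v-off = λ e∉S → cong₂ ℤ._+_ (R.v-off (e∉S ∘ p─q⊆p S C)) (c-off (e∉S ∘ C⊆S))
          ; split = λ e → trans
              (solve 2 (λ g c → g := (g :+ :- c) :+ c) refl (g e) (c e))
              (trans (cong (λ k → k ℤ.+ c e) (R.split e))
                (solve 3 (λ v h c → (v :+ (h :+ h)) :+ c := (v :+ c) :+ (h :+ h)) refl (R.v e) (R.h e) (c e)))
          }
          where
          open ℤ.+-*-Solver
          module R = Rounding (go k (S ─ C) (ℕ.≤-pred (ℕ.<-≤-trans smaller ∣S∣≤k)) (K-− Kg Kc) odd′ even′)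
          v-on : ∀ {e} → e ∈ S → IsUnit (R.v e ℤ.+ c e)
          v-on {e} e∈S with e ∈? C
          ... | yes e∈C = subst IsUnit
            (trans (sym (ℤ.+-identityˡ (c e))) (cong (λ k → k ℤ.+ c e) (sym (R.v-off λ e∈ → p─q-disjoint S C e∈ e∈C))))
            (c-on e∈C)
          ... | no  e∉C = subst IsUnit
            (trans (sym (ℤ.+-identityʳ (R.v e))) (cong (λ k → R.v e ℤ.+ k) (sym (c-off e∉C))))
            (R.v-on (x∈p∧x∉q⇒x∈p─q e∈S e∉C))

  -- A cycle modulo 2, witnessed by a signing that lies in the integral kernel. By rounding, every
  -- odd support of a kernel vector is of this kind.
  Cycle : Subset n → Set
  Cycle S = Σ (Fin n → ℤ) λ u → K u × (∀ {e} → e ∈ S → IsUnit (u e)) × (∀ {e} → e ∉ S → u e ≡ 0ℤ)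

  rounding⇒cycle : ∀ {g S} → Rounding g S → Cycle S
  rounding⇒cycle R = v , K-v , v-on , v-off
    where open Rounding R

  -- The sum of the two signings is odd exactly on the symmetric difference, whatever the signs on
  -- the intersection, and rounding turns it into a signing again.
  cycle-△ : ∀ {X Y} → Cycle X → Cycle Y → Cycle (X △ Y)
  cycle-△ {X} {Y} (u , Ku , u-on , u-off) (v , Kv , v-on , v-off) =
    rounding⇒cycle (round (K-+ Ku Kv) odd even)
    where
    odd : ∀ {e} → e ∈ X △ Y → Odd (u e ℤ.+ v e)
    odd {e} e∈ with x∈△⁻ X Y e∈
    ... | inj₁ (e∈X , e∉Y) = odd-+ (unit-odd (u-on e∈X)) (subst Even (sym (v-off e∉Y)) even-0)
    ... | inj₂ (e∉X , e∈Y) = subst Odd (ℤ.+-comm (v e) (u e))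
      (odd-+ (unit-odd (v-on e∈Y)) (subst Even (sym (u-off e∉X)) even-0))
    even : ∀ {e} → e ∉ X △ Y → Even (u e ℤ.+ v e)
    even {e} e∉ with e ∈? X | e ∈? Y
    ... | yes e∈X | yes e∈Y = unit-+-even (u-on e∈X) (v-on e∈Y)
    ... | yes e∈X | no  e∉Y = contradiction (x∈△ˡ e∈X e∉Y) e∉
    ... | no  e∉X | yes e∈Y = contradiction (x∈△ʳ e∉X e∈Y) e∉
    ... | no  e∉X | no  e∉Y = even-+ (subst Even (sym (u-off e∉X)) even-0) (subst Even (sym (v-off e∉Y)) even-0)

  cycle-dependent : ∀ {S e} → Cycle S → e ∈ S → ¬ Indep S
  cycle-dependent {e = e} (u , Ku , u-on , u-off) e∈S indep =
    unit≢0 (u-on e∈S) (independent⇒0 indep Ku u-off e)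

  circuits-△-dependent : ∀ {C D} → Circuit C → Circuit D → C ≢ D → ¬ Indep (C △ D)
  circuits-△-dependent circC circD C≢D =
    let x , x∈C , x∉D = circuit-⊈ circC circD C≢D
    in cycle-dependent (cycle-△ (circuitVector circC) (circuitVector circD)) (x∈△ˡ x∈C x∉D)

  indicator-cycle : ∀ {S} → K (indicator S) → Cycle S
  indicator-cycle {S} KS = indicator S , KS , (λ e∈S → inj₁ (indicator-∈ e∈S)) , indicator-∉

  abstract
    -- Elimination: if a circuit inside `S` avoids `f`, a multiple of its vector clears an entry of
    -- `g` on that circuit and leaves `g f` untouched. `S` loses an element, and the search goes on.
    circuit-through : ∀ {g S f} → K g → (∀ {e} → e ∉ S → g e ≡ 0ℤ) → g f ≢ 0ℤ → ∃[ C ] Circuit C × f ∈ C × C ⊆ S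
    circuit-through {S = S} = go ∣ S ∣ S ℕ.≤-refl
      where
      go : ∀ k {g} S {f} → ∣ S ∣ ℕ.≤ k → K g → (∀ {e} → e ∉ S → g e ≡ 0ℤ) → g f ≢ 0ℤ →
        ∃[ C ] Circuit C × f ∈ C × C ⊆ S
      go k {g} S {f} ∣S∣≤k Kg g-off gf≢0
        with circuit-within {S} (λ indep → gf≢0 (independent⇒0 indep Kg g-off f))
      ... | C , circ , C⊆S with f ∈? C
      ...   | yes f∈C = C , circ , f∈C , C⊆S
      ...   | no  f∉C = step k ∣S∣≤k
        where
        c : Fin n → ℤ
        c = proj₁ (circuitVector circ)
        Kc : K c
        Kc = proj₁ (proj₂ (circuitVector circ))
        c-on : ∀ {e} → e ∈ C → IsUnit (c e)
        c-on = proj₁ (proj₂ (proj₂ (circuitVector circ)))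
        c-off : ∀ {e} → e ∉ C → c e ≡ 0ℤ
        c-off = proj₂ (proj₂ (proj₂ (circuitVector circ)))
        e-exists : ∃[ e ] e ∈ C × e ∉ ⊥
        e-exists = ⊉circuit indep-⊥ circ
        e : Fin n
        e = proj₁ e-exists
        e∈C : e ∈ C
        e∈C = proj₁ (proj₂ e-exists)
        -- The coefficient should be `g e` divided by `c e`; the unit `c e` is its own inverse.
        g′ : Fin n → ℤ
        g′ x = g x ℤ.+ ℤ.- ((g e ℤ.* c e) ℤ.* c x)
        g′-off-C : ∀ {x} → x ∉ C → g′ x ≡ g x
        g′-off-C {x} x∉C = trans (cong (λ k → g x ℤ.+ ℤ.- ((g e ℤ.* c e) ℤ.* k)) (c-off x∉C))
          (solve 2 (λ g k → g :+ :- (k :* con 0ℤ) := g) refl (g x) (g e ℤ.* c e))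
          where open ℤ.+-*-Solver
        g′e≡0 : g′ e ≡ 0ℤ
        g′e≡0 = trans (cong (λ k → g e ℤ.+ ℤ.- k) (trans (ℤ.*-assoc (g e) (c e) (c e))
          (trans (cong (g e ℤ.*_) (unit-square (c-on e∈C))) (ℤ.*-identityʳ (g e))))) (ℤ.+-inverseʳ (g e))
        g′-off : ∀ {x} → x ∉ S - e → g′ x ≡ 0ℤ
        g′-off {x} x∉ with x Fin.≟ e
        ... | yes refl = g′e≡0
        ... | no  x≢e  = trans (g′-off-C (x∉S ∘ C⊆S)) (g-off x∉S)
          where
          x∉S : x ∉ S
          x∉S x∈S = x∉ (x∈p∧x≢y⇒x∈p-y x∈S x≢e)
        smaller : ∣ S - e ∣ ℕ.< ∣ S ∣
        smaller = x∈p⇒∣p-x∣<∣p∣ (C⊆S e∈C)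
        step : ∀ k → ∣ S ∣ ℕ.≤ k → ∃[ C ] Circuit C × f ∈ C × C ⊆ S
        step zero    ∣S∣≤0 = contradiction (ℕ.<-≤-trans smaller ∣S∣≤0) λ ()
        step (suc k) ∣S∣≤k =
          let D , circD , f∈D , D⊆ = go k (S - e) {f} (ℕ.≤-pred (ℕ.<-≤-trans smaller ∣S∣≤k))
                (K-− Kg (K-scale (g e ℤ.* c e) Kc)) g′-off (gf≢0 ∘ trans (sym (g′-off-C f∉C)))
          in D , circD , f∈D , p─q⊆p S ⁅ e ⁆ ∘ D⊆

  -- Multiplying coordinates by units preserves zeros, parity and units, and the conditions that tie
  -- the lattice to `M` involve nothing else.
  reorient : (σ : Fin n → ℤ) → (∀ e → IsUnit (σ e)) → CircuitLattice M
  reorient σ σ± = record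
    { K                = λ u → K (λ e → σ e ℤ.* u e)
    ; K-cong           = λ u≗v → K-cong λ e → cong (σ e ℤ.*_) (u≗v e)
    ; K-+              = λ {u} {v} Ku Kv → K-cong (λ e → sym (ℤ.*-distribˡ-+ (σ e) (u e) (v e))) (K-+ Ku Kv)
    ; K-neg            = λ {u} Ku → K-cong (λ e → ℤ.neg-distribʳ-* (σ e) (u e)) (K-neg Ku)
    ; K-halve          = λ {u} Kuu → K-halve (K-cong (λ e → ℤ.*-distribˡ-+ (σ e) (u e) (u e)) Kuu)
    ; independent⇒0    = λ {S} {u} indep Ku u-off e → trans (sym (σσ u e))
        (trans (cong (σ e ℤ.*_) (independent⇒0 indep Ku
          (λ {x} x∉S → trans (cong (σ x ℤ.*_) (u-off x∉S)) (ℤ.*-zeroʳ (σ x))) e)) (ℤ.*-zeroʳ (σ e)))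
    ; independent⇒even = λ {S} {u} indep Ku u-off e → subst Even (σσ u e)
        (σ-even e (independent⇒even indep Ku (λ {x} x∉S → σ-even x (u-off x∉S)) e))
    ; circuitVector    = λ circ →
        let u , Ku , u-on , u-off = circuitVector circ
        in (λ e → σ e ℤ.* u e) , K-cong (λ e → sym (σσ u e)) Ku , (λ {e} e∈C → unit-* (σ± e) (u-on e∈C))
           , (λ {e} e∉C → trans (cong (σ e ℤ.*_) (u-off e∉C)) (ℤ.*-zeroʳ (σ e)))
    }
    where
    σσ : ∀ u e → σ e ℤ.* (σ e ℤ.* u e) ≡ u e
    σσ u e = trans (sym (ℤ.*-assoc (σ e) (σ e) (u e)))
      (trans (cong (λ k → k ℤ.* u e) (unit-square (σ± e))) (ℤ.*-identityˡ (u e)))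
    σ-even : ∀ e {k} → Even k → Even (σ e ℤ.* k)
    σ-even e (h , refl) = σ e ℤ.* h , ℤ.*-distribˡ-+ (σ e) h h

-- A minimal pair of intersecting circuits whose difference is not a circuit

record MinimalPair {n} (M : Matroid n) (C₁ C₂ : Subset n) : Set where
  open Matroid M
  field
    circ₁   : Circuit C₁
    circ₂   : Circuit C₂
    C₁≢C₂   : C₁ ≢ C₂
    {o}     : Fin n
    o∈C₁    : o ∈ C₁
    o∈C₂    : o ∈ C₂
    ¬circ-T : ¬ Circuit (C₁ △ C₂)
    -- The missed element `u` makes `X ∪ Y` a proper subset of `C₁ ∪ C₂`, and this is the form in
    -- which induction on the size of the union delivers minimality.
    minimal : ∀ {X Y i u} → Circuit X → Circuit Y → X ≢ Y → X ⊆ C₁ ∪ C₂ → Y ⊆ C₁ ∪ C₂ →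
      i ∈ X → i ∈ Y → u ∈ C₁ ∪ C₂ → u ∉ X → u ∉ Y → Circuit (X △ Y)

module Minimal {n} {M : Matroid n} (L : CircuitLattice M) {C₁ C₂} (pair : MinimalPair M C₁ C₂) where
  open Matroid M
  open MatroidProperties M
  open CircuitLattice L
  open LatticeProperties L
  open MinimalPair pair

  U T : Subset n
  U = C₁ ∪ C₂
  T = C₁ △ C₂

  C₁⊆U : C₁ ⊆ U
  C₁⊆U = p⊆p∪q C₂

  C₂⊆U : C₂ ⊆ U
  C₂⊆U = q⊆p∪q C₁ C₂

  T⊆U : T ⊆ U
  T⊆U = △-⊆ C₁⊆U C₂⊆U

  N∌T : ∀ {e} → e ∈ C₁ → e ∈ C₂ → e ∉ T
  N∌T = x∉△-both

  U─C₁⊆C₂ : ∀ {x} → x ∈ U → x ∉ C₁ → x ∈ C₂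
  U─C₁⊆C₂ x∈U x∉C₁ with x∈p∪q⁻ C₁ C₂ x∈U
  ... | inj₁ x∈C₁ = contradiction x∈C₁ x∉C₁
  ... | inj₂ x∈C₂ = x∈C₂

  U─C₂⊆C₁ : ∀ {x} → x ∈ U → x ∉ C₂ → x ∈ C₁
  U─C₂⊆C₁ x∈U x∉C₂ with x∈p∪q⁻ C₁ C₂ x∈U
  ... | inj₁ x∈C₁ = x∈C₁
  ... | inj₂ x∈C₂ = contradiction x∈C₂ x∉C₂

  T-dependent : ¬ Indep T
  T-dependent = circuits-△-dependent circ₁ circ₂ C₁≢C₂

  -- The common element `o` lies outside `T`, so a circuit inside `T` differs from `C₁` and is
  -- therefore not contained in it.
  meets-C₂ : ∀ {D} → Circuit D → D ⊆ T → ∃[ x ] x ∈ D × x ∉ C₁ × x ∈ C₂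
  meets-C₂ {D} circD D⊆T =
    let x , x∈D , x∉C₁ = circuit-⊈ circD circ₁ (λ D≡C₁ → N∌T o∈C₁ o∈C₂ (D⊆T (subst (o ∈_) (sym D≡C₁) o∈C₁)))
    in x , x∈D , x∉C₁ , U─C₁⊆C₂ (T⊆U (D⊆T x∈D)) x∉C₁

  meets-C₁ : ∀ {D} → Circuit D → D ⊆ T → ∃[ x ] x ∈ D × x ∈ C₁ × x ∉ C₂
  meets-C₁ {D} circD D⊆T =
    let x , x∈D , x∉C₂ = circuit-⊈ circD circ₂ (λ D≡C₂ → N∌T o∈C₁ o∈C₂ (D⊆T (subst (o ∈_) (sym D≡C₂) o∈C₂)))
    in x , x∈D , U─C₂⊆C₁ (T⊆U (D⊆T x∈D)) x∉C₂ , x∉C₂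

  private
    -- Two uses of minimality, with `A` and `B` being `C₁` and `C₂` in either order. `A` and `D`
    -- share `u` and miss `t`, so `A △ D` is a circuit; it shares `o` with `B`, both miss `u`, and
    -- their difference is `T △ D`.
    complement-half : ∀ {A B D t u} → Circuit A → Circuit B → A ⊆ U → B ⊆ U → A △ B ≡ T → o ∈ A → o ∈ B →
      Circuit D → D ⊆ T → t ∈ B → t ∉ A → t ∉ D → u ∈ D → u ∈ A → u ∉ B → Circuit (T △ D)
    complement-half {A} {B} {D} circA circB A⊆U B⊆U A△B≡T o∈A o∈B circD D⊆T t∈B t∉A t∉D u∈D u∈A u∉B =
      subst Circuit A△D△B≡T△D
        (minimal circ-A△D circB A△D≢B (△-⊆ A⊆U (T⊆U ∘ D⊆T)) B⊆U (x∈△ˡ o∈A o∉D) o∈B (A⊆U u∈A) (x∉△-both u∈A u∈D) u∉B)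
      where
      o∉D : o ∉ D
      o∉D o∈D = N∌T o∈C₁ o∈C₂ (D⊆T o∈D)
      circ-A△D : Circuit (A △ D)
      circ-A△D = minimal circA circD (λ A≡D → o∉D (subst (o ∈_) A≡D o∈A)) A⊆U (T⊆U ∘ D⊆T)
        u∈A u∈D (B⊆U t∈B) t∉A t∉D
      A△D≢B : A △ D ≢ B
      A△D≢B refl = ¬circ-T (subst Circuit (trans (sym (△-cancelˡ A D)) A△B≡T) circD)
      A△D△B≡T△D : (A △ D) △ B ≡ T △ D
      A△D△B≡T△D = trans (cong (_△ B) (△-comm A D))
        (trans (△-assoc D A B) (trans (cong (D △_) A△B≡T) (△-comm D T)))

  complement : ∀ {D} → Circuit D → D ⊆ T → Circuit (T △ D)
  complement {D} circD D⊆T with ⊈⇒∃ (λ T⊆D → ¬circ-T (subst Circuit (⊆-antisym D⊆T T⊆D) circD))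
  ... | t , t∈T , t∉D with x∈△⁻ C₁ C₂ t∈T
  ...   | inj₁ (t∈C₁ , t∉C₂) =
    let u , u∈D , u∉C₁ , u∈C₂ = meets-C₂ circD D⊆T
    in complement-half circ₂ circ₁ C₂⊆U C₁⊆U (△-comm C₂ C₁) o∈C₂ o∈C₁ circD D⊆T t∈C₁ t∉C₂ t∉D u∈D u∈C₂ u∉C₁
  ...   | inj₂ (t∉C₁ , t∈C₂) =
    let u , u∈D , u∈C₁ , u∉C₂ = meets-C₁ circD D⊆T
    in complement-half circ₁ circ₂ C₁⊆U C₂⊆U refl o∈C₁ o∈C₂ circD D⊆T t∈C₂ t∉C₁ t∉D u∈D u∈C₁ u∉C₂

  T△-⊆ : ∀ {D} → D ⊆ T → T △ D ⊆ T
  T△-⊆ D⊆T = △-⊆ id D⊆T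

  private
    -- Three uses of minimality, always with `f` as the missed element: `X △ Z` is a circuit through
    -- the shared `i`, then `X △ T` through `j`, and finally `T` itself through `e`.
    crossing⇒⊥ : ∀ {X Z e f i j} → Circuit X → X ⊆ U → e ∈ C₁ → e ∈ C₂ → e ∈ X → f ∈ C₁ → f ∈ C₂ → f ∉ X →
      Circuit Z → Z ⊆ T → i ∈ X → i ∈ Z → j ∈ X → j ∈ T △ Z → Empty.⊥
    crossing⇒⊥ {X} {Z} {e} {f} {i} {j} circX X⊆U e∈C₁ e∈C₂ e∈X f∈C₁ f∈C₂ f∉X circZ Z⊆T i∈X i∈Z j∈X j∈T△Z =
      ¬circ-T (subst Circuit (△-cancelˡ X T) (minimal circX circ-X△T X≢X△T X⊆U (△-⊆ X⊆U T⊆U)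
        e∈X (x∈△ˡ e∈X e∉T) f∈U f∉X (x∉△-neither f∉X f∉T)))
      where
      f∈U : f ∈ U
      f∈U = C₁⊆U f∈C₁
      e∉T : e ∉ T
      e∉T = N∌T e∈C₁ e∈C₂
      f∉T : f ∉ T
      f∉T = N∌T f∈C₁ f∈C₂
      j∉Z : j ∉ Z
      j∉Z j∈Z = x∉△-both (T△-⊆ Z⊆T j∈T△Z) j∈Z j∈T△Z
      circ-X△Z : Circuit (X △ Z)
      circ-X△Z = minimal circX circZ (λ X≡Z → e∉T (Z⊆T (subst (e ∈_) X≡Z e∈X))) X⊆U (T⊆U ∘ Z⊆T)
        i∈X i∈Z f∈U f∉X (f∉T ∘ Z⊆T)
      circ-X△T : Circuit (X △ T)
      circ-X△T = subst Circuit
        (trans (△-assoc X Z (T △ Z)) (cong (X △_) (trans (cong (Z △_) (△-comm T Z)) (△-cancelˡ Z T))))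
        (minimal circ-X△Z (complement circZ Z⊆T)
          (λ eq → e∉T (T△-⊆ Z⊆T (subst (e ∈_) eq (x∈△ˡ e∈X (e∉T ∘ Z⊆T)))))
          (△-⊆ X⊆U (T⊆U ∘ Z⊆T)) (T⊆U ∘ T△-⊆ Z⊆T) (x∈△ˡ j∈X j∉Z) j∈T△Z
          f∈U (x∉△-neither f∉X (f∉T ∘ Z⊆T)) (f∉T ∘ T△-⊆ Z⊆T))
      X≢X△T : X ≢ X △ T
      X≢X△T X≡ = x∉△-both j∈X (T△-⊆ Z⊆T j∈T△Z) (subst (j ∈_) X≡ j∈X)

  -- A circuit `X` that misses `f` has an element `i` outside `C₁`, hence in `T`. It lies in one of
  -- the complementary circuits `D` and `T △ D`, whose roles are symmetric.
  circuit-⊇N : ∀ {X e f} → Circuit X → X ⊆ U → e ∈ C₁ → e ∈ C₂ → e ∈ X → f ∈ C₁ → f ∈ C₂ → f ∈ X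
  circuit-⊇N {X} {e} {f} circX X⊆U e∈C₁ e∈C₂ e∈X f∈C₁ f∈C₂ =
    decidable-stable (f ∈? X) λ f∉X →
      let i , i∈X , i∉C₁ = circuit-⊈ circX circ₁ λ X≡C₁ → f∉X (subst (f ∈_) (sym X≡C₁) f∈C₁)
          D , circD , D⊆T = circuit-within T-dependent
          i∈T = x∈△ʳ i∉C₁ (U─C₁⊆C₂ (X⊆U i∈X) i∉C₁)
      in [ (λ i∈D → impossible f∉X i∈X i∉C₁ circD D⊆T i∈D)
         , (λ i∉D → impossible f∉X i∈X i∉C₁ (complement circD D⊆T) (T△-⊆ D⊆T) (x∈△ˡ i∈T i∉D))
         ]′ (∈⊎∉ i D)
    where
    ∈⊎∉ : ∀ i (D : Subset n) → i ∈ D ⊎ i ∉ D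
    ∈⊎∉ i D with i ∈? D
    ... | yes i∈D = inj₁ i∈D
    ... | no  i∉D = inj₂ i∉D
    -- X meets only the part D of the partition of T into D and T △ D, but then
    -- the circuit X △ C₁ meets both parts.
    impossible : ∀ {i D} → f ∉ X → i ∈ X → i ∉ C₁ → Circuit D → D ⊆ T → i ∈ D → Empty.⊥
    impossible {i} {D} f∉X i∈X i∉C₁ circD D⊆T i∈D =
      let D′⊆T = T△-⊆ D⊆T
          circD′ = complement circD D⊆T
          m₁ , m₁∈D′ , m₁∈C₁ , m₁∉C₂ = meets-C₁ circD′ D′⊆T
          m₂ , m₂∈D′ , m₂∉C₁ , m₂∈C₂ = meets-C₂ circD′ D′⊆T
          circY = minimal circX circ₁ (λ X≡C₁ → i∉C₁ (subst (i ∈_) X≡C₁ i∈X)) X⊆U C₁⊆U e∈X e∈C₁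
            (C₂⊆U m₂∈C₂) (avoids m₂∈D′) m₂∉C₁
      -- `e` and `f` exchange roles: `X △ C₁` contains `f` and misses `e`.
      in crossing⇒⊥ circY (△-⊆ X⊆U C₁⊆U) f∈C₁ f∈C₂ (x∈△ʳ f∉X f∈C₁) e∈C₁ e∈C₂ (x∉△-both e∈X e∈C₁)
           circD D⊆T (x∈△ˡ i∈X i∉C₁) i∈D (x∈△ʳ (avoids m₁∈D′) m₁∈C₁) m₁∈D′
      where
      avoids : ∀ {m} → m ∈ T △ D → m ∉ X
      avoids m∈D′ m∈X = crossing⇒⊥ circX X⊆U e∈C₁ e∈C₂ e∈X f∈C₁ f∈C₂ f∉X circD D⊆T i∈X i∈D m∈X m∈D′

  -- `C₁ △ Z` equals `C₂ △ (T △ Z)`. The circuits `C₂` and `T △ Z` meet outside `C₁`, and both miss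
  -- an element of `Z` that lies in `C₁` only.
  C₁△-circuit : ∀ {Z} → Circuit Z → Z ⊆ T → Circuit (C₁ △ Z)
  C₁△-circuit {Z} circZ Z⊆T =
    let Z′⊆T = T△-⊆ Z⊆T
        circZ′ = complement circZ Z⊆T
        i , i∈Z′ , i∉C₁ , i∈C₂ = meets-C₂ circZ′ Z′⊆T
        u , u∈Z , u∈C₁ , u∉C₂ = meets-C₁ circZ Z⊆T
    in subst Circuit
      (trans (sym (△-assoc C₂ T Z)) (cong (_△ Z) (trans (cong (C₂ △_) (△-comm C₁ C₂)) (△-cancelˡ C₂ C₁))))
      (minimal circ₂ circZ′ (λ C₂≡Z′ → N∌T o∈C₁ o∈C₂ (Z′⊆T (subst (o ∈_) C₂≡Z′ o∈C₂)))
        C₂⊆U (T⊆U ∘ Z′⊆T) i∈C₂ i∈Z′ (C₁⊆U u∈C₁) u∉C₂ (x∉△-both (Z⊆T u∈Z) u∈Z))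

  cycle-T : Cycle T
  cycle-T = cycle-△ (circuitVector circ₁) (circuitVector circ₂)

  -- For a circuit `Z` inside `S`, the nonempty cycle `T △ S` is a dependent subset of the circuit
  -- `T △ Z`. So the two are equal, and `S` equals `Z`.
  cycle-in-T : ∀ {S x} → Cycle S → S ⊆ T → x ∈ S → S ≢ T → Circuit S
  cycle-in-T {S} cycS S⊆T x∈S S≢T =
    let Z , circZ , Z⊆S = circuit-within (cycle-dependent cycS x∈S)
        t , t∈T , t∉S = ⊈⇒∃ λ T⊆S → S≢T (⊆-antisym S⊆T T⊆S)
        T△S≡T△Z = circuit-minimal (complement circZ (S⊆T ∘ Z⊆S)) (T△S⊆T△Z Z⊆S)
          (cycle-dependent (cycle-△ cycle-T cycS) (x∈△ˡ t∈T t∉S))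
    in subst Circuit (trans (sym (△-cancelˡ T Z)) (trans (cong (T △_) (sym T△S≡T△Z)) (△-cancelˡ T S))) circZ
    where
    T△S⊆T△Z : ∀ {Z} → Z ⊆ S → T △ S ⊆ T △ Z
    T△S⊆T△Z Z⊆S x∈ with x∈△⁻ T S x∈
    ... | inj₁ (x∈T , x∉S) = x∈△ˡ x∈T (x∉S ∘ Z⊆S)
    ... | inj₂ (x∉T , x∈S) = contradiction (S⊆T x∈S) x∉T

  -- A nonzero value at `f` would give a circuit through `f` inside `U - e`, whereas a circuit in
  -- `U` that meets N contains all of N. Applied to differences, this lets the value at `o` decide
  -- the values on N.
  vanishes-on-N : ∀ {g e f} → K g → (∀ {x} → x ∉ U → g x ≡ 0ℤ) →
    e ∈ C₁ → e ∈ C₂ → g e ≡ 0ℤ → f ∈ C₁ → f ∈ C₂ → g f ≡ 0ℤ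
  vanishes-on-N {g} {e} {f} Kg g-off e∈C₁ e∈C₂ ge≡0 f∈C₁ f∈C₂ =
    decidable-stable (g f ℤ.≟ 0ℤ) λ gf≢0 →
      let C , circ , f∈C , C⊆U-e = circuit-through Kg off gf≢0
      in p─q-disjoint U ⁅ e ⁆
           (C⊆U-e (circuit-⊇N circ (p─q⊆p U ⁅ e ⁆ ∘ C⊆U-e) f∈C₁ f∈C₂ f∈C e∈C₁ e∈C₂)) (x∈⁅x⁆ e)
    where
    off : ∀ {x} → x ∉ U - e → g x ≡ 0ℤ
    off {x} x∉ with x Fin.≟ e
    ... | yes refl = ge≡0
    ... | no  x≢e  = g-off λ x∈U → x∉ (x∈p∧x≢y⇒x∈p-y x∈U x≢e)

  -- `S` contains all of N, so `S △ C₁` is a cycle inside `T`. It is empty, equal to `T`, or a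
  -- circuit `Z`; accordingly `S` is `C₁`, `C₂` or `C₁ △ Z`.
  cycle-meeting-N : ∀ {S e} → Cycle S → S ⊆ U → e ∈ C₁ → e ∈ C₂ → e ∈ S → Circuit S
  cycle-meeting-N {S} {e} cycS@(v , Kv , v-on , v-off) S⊆U e∈C₁ e∈C₂ e∈S with nonempty? (S △ C₁)
  ... | no empty = subst Circuit C₁≡S circ₁
    where
    C₁≡S : C₁ ≡ S
    C₁≡S = ⊆-antisym
      (λ {x} x∈C₁ → decidable-stable (x ∈? S) λ x∉S → empty (x , x∈△ʳ x∉S x∈C₁))
      (λ {x} x∈S → decidable-stable (x ∈? C₁) λ x∉C₁ → empty (x , x∈△ˡ x∈S x∉C₁))
  ... | yes (z , z∈) = [ (λ S△C₁≡T → subst Circuit (S≡C₂ S△C₁≡T) circ₂)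
                       , (λ S△C₁≢T → subst Circuit S≡ (C₁△-circuit (cycle-in-T (cycle-△ cycS (circuitVector circ₁)) S△C₁⊆T z∈ S△C₁≢T) S△C₁⊆T))
                       ]′ (≡⊎≢ (S △ C₁))
    where
    ≡⊎≢ : ∀ X → X ≡ T ⊎ X ≢ T
    ≡⊎≢ X with X ⊆? T | T ⊆? X
    ... | yes X⊆T | yes T⊆X = inj₁ (⊆-antisym X⊆T T⊆X)
    ... | no  X⊈T | _       = inj₂ λ { refl → X⊈T id }
    ... | _       | no  T⊈X = inj₂ λ { refl → T⊈X id }
    N⊆S : ∀ {f} → f ∈ C₁ → f ∈ C₂ → f ∈ S
    N⊆S f∈C₁ f∈C₂ =
      let C , circ , e∈C , C⊆S = circuit-through Kv v-off (unit≢0 (v-on e∈S))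
      in C⊆S (circuit-⊇N circ (S⊆U ∘ C⊆S) e∈C₁ e∈C₂ e∈C f∈C₁ f∈C₂)
    S△C₁⊆T : S △ C₁ ⊆ T
    S△C₁⊆T {x} x∈ with x∈△⁻ S C₁ x∈
    ... | inj₁ (x∈S , x∉C₁) = x∈△ʳ x∉C₁ (U─C₁⊆C₂ (S⊆U x∈S) x∉C₁)
    ... | inj₂ (x∉S , x∈C₁) = x∈△ˡ x∈C₁ λ x∈C₂ → x∉S (N⊆S x∈C₁ x∈C₂)
    S≡ : C₁ △ (S △ C₁) ≡ S
    S≡ = trans (cong (C₁ △_) (△-comm S C₁)) (△-cancelˡ C₁ S)
    S≡C₂ : S △ C₁ ≡ T → C₂ ≡ S
    S≡C₂ eq = trans (sym (△-cancelˡ C₁ C₂)) (trans (cong (C₁ △_) (sym eq)) S≡)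

  -- Positive circuits in the reoriented lattice

  module Positive (K-C₁ : K (indicator C₁)) (K-T : K (indicator T)) (¬skew : ¬ HasSkewCircuits) where

    x y : Fin n → ℤ
    x = indicator C₁
    y = indicator T

    o∉T : o ∉ T
    o∉T = N∌T o∈C₁ o∈C₂

    record LevelRounding (g : Fin n → ℤ) : Set where
      field
        {v h}  : Fin n → ℤ
        K-h    : K h
        v-sign : ∀ e → SignValue (v e)
        v-N    : ∀ {e} → e ∈ C₁ → e ∈ C₂ → v e ≡ 1ℤ
        split  : ∀ e → g e ≡ v e ℤ.+ (h e ℤ.+ h e)

      h-0 : ∀ {e} → g e ≡ 0ℤ → h e ≡ 0ℤ
      h-0 {e} = proj₂ ∘ half-0 (v-sign e) (split e)

      h-1 : ∀ {e} → g e ≡ 1ℤ → h e ≡ 0ℤ ⊎ h e ≡ 1ℤ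
      h-1 {e} ge≡1 with half-1 (v-sign e) (split e) ge≡1
      ... | inj₁ (_ , he≡0) = inj₁ he≡0
      ... | inj₂ (_ , he≡1) = inj₂ he≡1

      h-2 : ∀ {e} → g e ≡ ℤ.+ 2 → h e ≡ 1ℤ
      h-2 {e} = half-2 (v-sign e) (split e)

      h--1 : ∀ {e} → g e ≡ -1ℤ → h e ≡ 0ℤ ⊎ h e ≡ -1ℤ
      h--1 {e} = half--1 (v-sign e) (split e)

      h-N : ∀ {e} → e ∈ C₁ → e ∈ C₂ → g e ≡ 1ℤ → h e ≡ 0ℤ
      h-N {e} e∈C₁ e∈C₂ ge≡1 with half-1 (v-sign e) (split e) ge≡1
      ... | inj₁ (_ , he≡0) = he≡0
      ... | inj₂ (ve≡-1 , _) with trans (sym (v-N e∈C₁ e∈C₂)) ve≡-1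
      ...   | ()

    roundOdd : ∀ {g} → K g → Rounding g (oddSupport g)
    roundOdd {g} Kg = round Kg (∈-oddSupport⁻ g) (∉-oddSupport⁻ g)

    abstract
      -- Because `v + 2 h = - v + 2 (h + v)`, the sign vector may be negated, so `v o = 1` can be
      -- arranged. Then `v - x` vanishes at `o`, hence on all of N.
      levelRounding : ∀ {g} → K g → (∀ {e} → e ∉ U → g e ≡ 0ℤ) → g o ≡ 1ℤ → LevelRounding g
      levelRounding {g} Kg g-off go≡1 = normalise (half-1 (v-sign o) (split o) go≡1)
        where
        open Rounding (roundOdd Kg)
        constant : ∀ {v h : Fin n → ℤ} → K v → (∀ e → SignValue (v e)) → (∀ e → g e ≡ v e ℤ.+ (h e ℤ.+ h e)) →
          v o ≡ 1ℤ → ∀ {e} → e ∈ C₁ → e ∈ C₂ → v e ≡ 1ℤ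
        constant {v} {h} Kv v± g≡ vo≡1 {e} e∈C₁ e∈C₂ = trans
          (ℤ.i-j≡0⇒i≡j (v e) (x e) (vanishes-on-N (K-− Kv K-C₁)
            (λ {f} f∉U → cong₂ (λ a b → a ℤ.+ ℤ.- b)
              (proj₁ (half-0 {h = h f} (v± f) (g≡ f) (g-off f∉U))) (indicator-∉ (f∉U ∘ C₁⊆U)))
            o∈C₁ o∈C₂ (cong₂ (λ a b → a ℤ.+ ℤ.- b) vo≡1 (indicator-∈ o∈C₁)) e∈C₁ e∈C₂))
          (indicator-∈ e∈C₁)
        normalise : (v o ≡ 1ℤ × h o ≡ 0ℤ) ⊎ (v o ≡ -1ℤ × h o ≡ 1ℤ) → LevelRounding g
        normalise (inj₁ (vo≡1 , _)) = record
          { K-h = K-h ; v-sign = v-sign ; v-N = constant {v} {h} K-v v-sign split vo≡1 ; split = split }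
        normalise (inj₂ (vo≡-1 , _)) = record
          { v = v′ ; h = h′ ; K-h = K-+ K-h K-v ; v-sign = v′-sign
          ; v-N = constant {v′} {h′} (K-neg K-v) v′-sign split′ (cong ℤ.-_ vo≡-1) ; split = split′ }
          where
          v′ h′ : Fin n → ℤ
          v′ e = ℤ.- v e
          h′ e = h e ℤ.+ v e
          v′-sign : ∀ e → SignValue (v′ e)
          v′-sign e with v-sign e
          ... | inj₁ ve≡0 = inj₁ (cong ℤ.-_ ve≡0)
          ... | inj₂ unit = inj₂ (unit-neg unit)
          split′ : ∀ e → g e ≡ v′ e ℤ.+ (h′ e ℤ.+ h′ e)
          split′ e = trans (split e) (solve 2 (λ v h → v :+ (h :+ h) := :- v :+ ((h :+ v) :+ (h :+ v))) refl (v e) (h e))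
            where open ℤ.+-*-Solver

    -- `g = x + x′ - y` is 2 on N, 0 on `C₁ △ X` and odd on the rest `S` of `T`. Writing
    -- `g = v + 2 h`, the vector `y + h` is odd at `o` and on `T △ S`, so its odd support is a
    -- circuit meeting N that contains the cycle `T △ S`. If `t` were in `C₁ △ X`, this cycle would
    -- be nonempty and equal to that circuit, although `o` is not in `T`. Since `C₁ △ X` lies in
    -- `T`, the conclusion amounts to `X = C₁`.
    unique-positive : ∀ {X t} → K (indicator X) → X ⊆ U → (∀ {e} → e ∈ C₁ → e ∈ C₂ → e ∈ X) →
      t ∈ T → t ∉ C₁ △ X
    unique-positive {X} {t} K-X X⊆U N⊆X t∈T t∈C₁△X = o∉T (△-⊆ id S⊆T (subst (o ∈_) (sym T△S≡S″) o∈S″))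
      where
      x′ g : Fin n → ℤ
      x′ = indicator X
      g e = (x e ℤ.+ x′ e) ℤ.+ ℤ.- y e
      Kg : K g
      Kg = K-− (K-+ K-C₁ K-X) K-T
      S : Subset n
      S = T ─ (C₁ △ X)
      S⊆T : S ⊆ T
      S⊆T = p─q⊆p T (C₁ △ X)
      g-at : ∀ {e a b c} → x e ≡ a → x′ e ≡ b → y e ≡ c → g e ≡ (a ℤ.+ b) ℤ.+ ℤ.- c
      g-at refl refl refl = refl
      g-N : ∀ {e} → e ∈ C₁ → e ∈ C₂ → g e ≡ ℤ.+ 2
      g-N e∈C₁ e∈C₂ = g-at (indicator-∈ e∈C₁) (indicator-∈ (N⊆X e∈C₁ e∈C₂)) (indicator-∉ (N∌T e∈C₁ e∈C₂))
      g-∉U : ∀ {e} → e ∉ U → g e ≡ 0ℤ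
      g-∉U e∉U = g-at (indicator-∉ (e∉U ∘ C₁⊆U)) (indicator-∉ (e∉U ∘ X⊆U)) (indicator-∉ (e∉U ∘ T⊆U))
      g-T─S : ∀ {e} → e ∈ T → e ∈ C₁ △ X → g e ≡ 0ℤ
      g-T─S e∈T e∈ with x∈△⁻ C₁ X e∈
      ... | inj₁ (e∈C₁ , e∉X) = g-at (indicator-∈ e∈C₁) (indicator-∉ e∉X) (indicator-∈ e∈T)
      ... | inj₂ (e∉C₁ , e∈X) = g-at (indicator-∉ e∉C₁) (indicator-∈ e∈X) (indicator-∈ e∈T)
      odd : ∀ {e} → e ∈ S → Odd (g e)
      odd {e} e∈S with e ∈? C₁ | e ∈? X
      ... | yes e∈C₁ | yes e∈X = 0ℤ , g-at (indicator-∈ e∈C₁) (indicator-∈ e∈X) (indicator-∈ (S⊆T e∈S))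
      ... | no  e∉C₁ | no  e∉X = -1ℤ , g-at (indicator-∉ e∉C₁) (indicator-∉ e∉X) (indicator-∈ (S⊆T e∈S))
      ... | yes e∈C₁ | no  e∉X = contradiction (x∈△ˡ e∈C₁ e∉X) (p─q-disjoint T (C₁ △ X) e∈S)
      ... | no  e∉C₁ | yes e∈X = contradiction (x∈△ʳ e∉C₁ e∈X) (p─q-disjoint T (C₁ △ X) e∈S)
      even : ∀ {e} → e ∉ S → Even (g e)
      even {e} e∉S with e ∈? C₁ | e ∈? C₂
      ... | yes e∈C₁ | yes e∈C₂ = 1ℤ , g-N e∈C₁ e∈C₂
      ... | no  e∉C₁ | no  e∉C₂ = 0ℤ , g-∉U ([ e∉C₁ , e∉C₂ ]′ ∘ x∈p∪q⁻ C₁ C₂)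
      ... | yes e∈C₁ | no  e∉C₂ = 0ℤ , g-T─S (x∈△ˡ e∈C₁ e∉C₂)
        (decidable-stable (e ∈? (C₁ △ X)) λ e∉ → e∉S (x∈p∧x∉q⇒x∈p─q (x∈△ˡ e∈C₁ e∉C₂) e∉))
      ... | no  e∉C₁ | yes e∈C₂ = 0ℤ , g-T─S (x∈△ʳ e∉C₁ e∈C₂)
        (decidable-stable (e ∈? (C₁ △ X)) λ e∉ → e∉S (x∈p∧x∉q⇒x∈p─q (x∈△ʳ e∉C₁ e∈C₂) e∉))
      R : Rounding g S
      R = round Kg odd even
      open Rounding R
      f : Fin n → ℤ
      f e = y e ℤ.+ h e
      S″ : Subset n
      S″ = oddSupport f
      o∈S″ : o ∈ S″
      o∈S″ = ∈-oddSupport⁺ f (0ℤ , cong₂ ℤ._+_ (indicator-∉ o∉T) (half-2 (v-sign o) (split o) (g-N o∈C₁ o∈C₂)))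
      S″⊆U : S″ ⊆ U
      S″⊆U {e} e∈S″ = decidable-stable (e ∈? U) λ e∉U → even∧odd⇒⊥
        (0ℤ , cong₂ ℤ._+_ (indicator-∉ (e∉U ∘ T⊆U)) (proj₂ (half-0 {h = h e} (v-sign e) (split e) (g-∉U e∉U))))
        (∈-oddSupport⁻ f e∈S″)
      circ-S″ : Circuit S″
      circ-S″ = cycle-meeting-N (rounding⇒cycle (roundOdd (K-+ K-T K-h))) S″⊆U o∈C₁ o∈C₂ o∈S″
      T△S⊆S″ : T △ S ⊆ S″
      T△S⊆S″ {e} e∈ with x∈△⁻ T S e∈
      ... | inj₂ (e∉T , e∈S) = contradiction (S⊆T e∈S) e∉T
      ... | inj₁ (e∈T , e∉S) = ∈-oddSupport⁺ f (0ℤ , cong₂ ℤ._+_ (indicator-∈ e∈T)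
        (proj₂ (half-0 {h = h e} (v-sign e) (split e) (g-T─S e∈T
          (decidable-stable (e ∈? (C₁ △ X)) λ e∉ → e∉S (x∈p∧x∉q⇒x∈p─q e∈T e∉))))))
      T△S≡S″ : T △ S ≡ S″
      T△S≡S″ = circuit-minimal circ-S″ T△S⊆S″ (cycle-dependent (cycle-△ cycle-T (rounding⇒cycle R))
        (x∈△ˡ t∈T λ t∈S → p─q-disjoint T (C₁ △ X) t∈S t∈C₁△X))

    -- Let `g = x + z = v + 2 h`. Then `w = g - h` is half of `g` with the opposite rounding, and it
    -- takes only the values 0 and 1, since `z` is not negative off `C₁`. It is 1 on N and 0
    -- wherever `z` is -1, so a negative entry of `z` would make it the indicator of a second
    -- positive set containing N.
    nonnegative : ∀ {z} → K z → (∀ e → SignValue (z e)) → (∀ {e} → e ∉ T → z e ≡ 0ℤ) →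
      (∀ {e} → e ∉ C₁ → z e ≢ -1ℤ) → ∀ e → z e ≢ -1ℤ
    nonnegative {z} Kz z± z-off z-C₂ e ze≡-1 = unique-positive
      (K-cong value (K-− Kg K-h)) X⊆U N⊆X e∈T (x∈△ˡ e∈C₁ e∉X)
      where
      g : Fin n → ℤ
      g e = x e ℤ.+ z e
      Kg : K g
      Kg = K-+ K-C₁ Kz
      g-at : ∀ {e a b} → x e ≡ a → z e ≡ b → g e ≡ a ℤ.+ b
      g-at refl refl = refl
      g-∉U : ∀ {e} → e ∉ U → g e ≡ 0ℤ
      g-∉U e∉U = g-at (indicator-∉ (e∉U ∘ C₁⊆U)) (z-off (e∉U ∘ T⊆U))
      g-N : ∀ {e} → e ∈ C₁ → e ∈ C₂ → g e ≡ 1ℤ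
      g-N e∈C₁ e∈C₂ = g-at (indicator-∈ e∈C₁) (z-off (N∌T e∈C₁ e∈C₂))
      open LevelRounding (levelRounding Kg g-∉U (g-N o∈C₁ o∈C₂))
      w : Fin n → ℤ
      w e = g e ℤ.+ ℤ.- h e
      w-at : ∀ {e a b} → g e ≡ a → h e ≡ b → w e ≡ a ℤ.+ ℤ.- b
      w-at refl refl = refl
      w-1 : ∀ {e} → g e ≡ 1ℤ → w e ≡ 0ℤ ⊎ w e ≡ 1ℤ
      w-1 ge≡1 with h-1 ge≡1
      ... | inj₁ he≡0 = inj₂ (w-at ge≡1 he≡0)
      ... | inj₂ he≡1 = inj₁ (w-at ge≡1 he≡1)
      w-01 : ∀ e → w e ≡ 0ℤ ⊎ w e ≡ 1ℤ
      w-01 e with e ∈? C₁ | z± e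
      ... | yes e∈C₁ | inj₁ ze≡0          = w-1 (g-at (indicator-∈ e∈C₁) ze≡0)
      ... | yes e∈C₁ | inj₂ (inj₁ ze≡1)  = let ge≡2 = g-at (indicator-∈ e∈C₁) ze≡1 in inj₂ (w-at ge≡2 (h-2 ge≡2))
      ... | yes e∈C₁ | inj₂ (inj₂ ze≡-1) = let ge≡0 = g-at (indicator-∈ e∈C₁) ze≡-1 in inj₁ (w-at ge≡0 (h-0 ge≡0))
      ... | no  e∉C₁ | inj₁ ze≡0          = let ge≡0 = g-at (indicator-∉ e∉C₁) ze≡0 in inj₁ (w-at ge≡0 (h-0 ge≡0))
      ... | no  e∉C₁ | inj₂ (inj₁ ze≡1)  = w-1 (g-at (indicator-∉ e∉C₁) ze≡1)
      ... | no  e∉C₁ | inj₂ (inj₂ ze≡-1) = contradiction ze≡-1 (z-C₂ e∉C₁)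
      X : Subset n
      X = select λ e → w e ℤ.≟ 1ℤ
      value : ∀ e → w e ≡ indicator X e
      value e with w-01 e
      ... | inj₁ we≡0 = trans we≡0 (sym (indicator-∉ λ e∈X →
        contradiction (trans (sym we≡0) (∈-select⁻ (λ e → w e ℤ.≟ 1ℤ) e∈X)) λ ()))
      ... | inj₂ we≡1 = trans we≡1 (sym (indicator-∈ (∈-select⁺ (λ e → w e ℤ.≟ 1ℤ) we≡1)))
      w-0-∉X : ∀ {e} → g e ≡ 0ℤ → e ∉ X
      w-0-∉X ge≡0 e∈X = contradiction
        (trans (sym (w-at ge≡0 (h-0 ge≡0))) (∈-select⁻ (λ e → w e ℤ.≟ 1ℤ) e∈X)) λ ()
      X⊆U : X ⊆ U
      X⊆U {e} e∈X = decidable-stable (e ∈? U) λ e∉U → w-0-∉X (g-∉U e∉U) e∈X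
      N⊆X : ∀ {e} → e ∈ C₁ → e ∈ C₂ → e ∈ X
      N⊆X e∈C₁ e∈C₂ = ∈-select⁺ (λ e → w e ℤ.≟ 1ℤ) (w-at (g-N e∈C₁ e∈C₂) (h-N e∈C₁ e∈C₂ (g-N e∈C₁ e∈C₂)))
      e∈C₁ : e ∈ C₁
      e∈C₁ = decidable-stable (e ∈? C₁) λ e∉C₁ → z-C₂ e∉C₁ ze≡-1
      e∈T : e ∈ T
      e∈T = decidable-stable (e ∈? T) λ e∉T → contradiction (trans (sym (z-off e∉T)) ze≡-1) λ ()
      e∉X : e ∉ X
      e∉X = w-0-∉X (g-at (indicator-∈ e∈C₁) ze≡-1)

    record PositiveCircuit (P : Subset n) : Set where
      field
        K-P : K (indicator P)
        P⊆T : P ⊆ T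
        {point} : Fin n
        point∈P : point ∈ P
        P≢T : P ≢ T

      circuit : Circuit P
      circuit = cycle-in-T (indicator-cycle K-P) P⊆T point∈P P≢T

    open PositiveCircuit

    complement-positive : ∀ {P} → PositiveCircuit P → PositiveCircuit (T △ P)
    complement-positive {P} pos = record
      { K-P = K-cong value (K-− K-T (K-P pos))
      ; P⊆T = T△-⊆ (P⊆T pos)
      ; point∈P = let t , t∈T , t∉P = ⊈⇒∃ λ T⊆P → P≢T pos (⊆-antisym (P⊆T pos) T⊆P) in x∈△ˡ t∈T t∉P
      ; P≢T = λ T△P≡T → x∉△-both (P⊆T pos (point∈P pos)) (point∈P pos) (subst (point pos ∈_) (sym T△P≡T) (P⊆T pos (point∈P pos)))
      }
      where
      value : ∀ e → y e ℤ.+ ℤ.- indicator P e ≡ indicator (T △ P) e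
      value e with e ∈? T | e ∈? P
      ... | yes e∈T | yes e∈P = trans (cong₂ (λ a b → a ℤ.+ ℤ.- b) (indicator-∈ e∈T) (indicator-∈ e∈P)) (sym (indicator-∉ (x∉△-both e∈T e∈P)))
      ... | yes e∈T | no  e∉P = trans (cong₂ (λ a b → a ℤ.+ ℤ.- b) (indicator-∈ e∈T) (indicator-∉ e∉P)) (sym (indicator-∈ (x∈△ˡ e∈T e∉P)))
      ... | no  e∉T | yes e∈P = contradiction (P⊆T pos e∈P) e∉T
      ... | no  e∉T | no  e∉P = trans (cong₂ (λ a b → a ℤ.+ ℤ.- b) (indicator-∉ e∉T) (indicator-∉ e∉P)) (sym (indicator-∉ (x∉△-neither e∉T e∉P)))

    record Mixed (Z : Subset n) : Set where
      field
        {z}   : Fin n → ℤ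
        K-z   : K z
        z-on  : ∀ {e} → e ∈ Z → IsUnit (z e)
        z-off : ∀ {e} → e ∉ Z → z e ≡ 0ℤ
        {a b} : Fin n
        za≡1  : z a ≡ 1ℤ
        zb≡-1 : z b ≡ -1ℤ
        {H}   : Subset n
        posH  : PositiveCircuit H
        z⁻∈H  : ∀ {e} → z e ≡ -1ℤ → e ∈ H
        z⁺∉H  : ∀ {e} → z e ≡ 1ℤ → e ∉ H

    -- H is the support of the half h in y − z = v + 2 h.
    mixed : ∀ {Z} {z : Fin n → ℤ} → Z ⊆ T → K z → (∀ {e} → e ∈ Z → IsUnit (z e)) → (∀ {e} → e ∉ Z → z e ≡ 0ℤ) →
      ∀ {a b} → z a ≡ 1ℤ → z b ≡ -1ℤ → Mixed Z
    mixed {Z} {z} Z⊆T Kz z-on z-off {a} {b} za≡1 zb≡-1 = record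
      { K-z = Kz ; z-on = z-on ; z-off = z-off ; za≡1 = za≡1 ; zb≡-1 = zb≡-1
      ; posH = record
          { K-P = K-cong value K-h
          ; P⊆T = H⊆T
          ; point∈P = z⁻∈H zb≡-1
          ; P≢T = λ H≡T → z⁺∉H za≡1 (subst (a ∈_) (sym H≡T) (on-T za≡1 λ ()))
          }
      ; z⁻∈H = z⁻∈H ; z⁺∉H = z⁺∉H }
      where
      on-T : ∀ {e k} → z e ≡ k → k ≢ 0ℤ → e ∈ T
      on-T {e} ze≡k k≢0 = decidable-stable (e ∈? T) λ e∉T → k≢0 (trans (sym ze≡k) (z-off (e∉T ∘ Z⊆T)))
      g : Fin n → ℤ
      g e = y e ℤ.+ ℤ.- z e
      g-at : ∀ {e c d} → y e ≡ c → z e ≡ d → g e ≡ c ℤ.+ ℤ.- d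
      g-at refl refl = refl
      open Rounding (roundOdd (K-− K-T Kz))
      h-0 : ∀ {e} → g e ≡ 0ℤ → h e ≡ 0ℤ
      h-0 {e} = proj₂ ∘ half-0 (v-sign e) (split e)
      H : Subset n
      H = select λ e → h e ℤ.≟ 1ℤ
      ∈H : ∀ {e} → h e ≡ 1ℤ → e ∈ H
      ∈H = ∈-select⁺ λ e → h e ℤ.≟ 1ℤ
      ∉H : ∀ {e} → h e ≡ 0ℤ → e ∉ H
      ∉H he≡0 e∈H = contradiction (trans (sym he≡0) (∈-select⁻ (λ e → h e ℤ.≟ 1ℤ) e∈H)) λ ()
      g-∉T : ∀ {e} → e ∉ T → g e ≡ 0ℤ
      g-∉T e∉T = g-at (indicator-∉ e∉T) (z-off (e∉T ∘ Z⊆T))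
      h⁺ : ∀ {e} → z e ≡ 1ℤ → h e ≡ 0ℤ
      h⁺ ze≡1 = h-0 (g-at (indicator-∈ (on-T ze≡1 λ ())) ze≡1)
      h⁻ : ∀ {e} → z e ≡ -1ℤ → h e ≡ 1ℤ
      h⁻ {e} ze≡-1 = half-2 (v-sign e) (split e) (g-at (indicator-∈ (on-T ze≡-1 λ ())) ze≡-1)
      h-01 : ∀ e → h e ≡ 0ℤ ⊎ h e ≡ 1ℤ
      h-01 e with e ∈? Z | e ∈? T
      ... | _ | no e∉T = inj₁ (h-0 (g-∉T e∉T))
      ... | yes e∈Z | yes _ with z-on e∈Z
      ...   | inj₁ ze≡1  = inj₁ (h⁺ ze≡1)
      ...   | inj₂ ze≡-1 = inj₂ (h⁻ ze≡-1)
      h-01 e | no e∉Z | yes e∈T with half-1 (v-sign e) (split e) (g-at (indicator-∈ e∈T) (z-off e∉Z))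
      ...   | inj₁ (_ , he≡0) = inj₁ he≡0
      ...   | inj₂ (_ , he≡1) = inj₂ he≡1
      value : ∀ e → h e ≡ indicator H e
      value e with h-01 e
      ... | inj₁ he≡0 = trans he≡0 (sym (indicator-∉ (∉H he≡0)))
      ... | inj₂ he≡1 = trans he≡1 (sym (indicator-∈ (∈H he≡1)))
      H⊆T : H ⊆ T
      H⊆T {e} e∈H = decidable-stable (e ∈? T) λ e∉T → ∉H (h-0 (g-∉T e∉T)) e∈H
      z⁻∈H : ∀ {e} → z e ≡ -1ℤ → e ∈ H
      z⁻∈H = ∈H ∘ h⁻
      z⁺∉H : ∀ {e} → z e ≡ 1ℤ → e ∉ H
      z⁺∉H = ∉H ∘ h⁺

    positive⊎mixed : ∀ {Z} → Circuit Z → Z ⊆ T → PositiveCircuit Z ⊎ Mixed Z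
    positive⊎mixed {Z} circZ Z⊆T
      with circuitVector circZ
    ... | z , Kz , z-on , z-off with Fin.any? (λ e → z e ℤ.≟ 1ℤ) | Fin.any? (λ e → z e ℤ.≟ -1ℤ)
    ... | yes (a , za≡1) | yes (b , zb≡-1) = inj₂ (mixed Z⊆T Kz z-on z-off za≡1 zb≡-1)
    ... | _ | no ¬neg = inj₁ record
      { K-P = K-cong value Kz ; P⊆T = Z⊆T ; point∈P = proj₁ (proj₂ (⊉circuit indep-⊥ circZ))
      ; P≢T = λ Z≡T → ¬circ-T (subst Circuit Z≡T circZ) }
      where
      value : ∀ e → z e ≡ indicator Z e
      value e with e ∈? Z
      ... | no  e∉Z = trans (z-off e∉Z) (sym (indicator-∉ e∉Z))
      ... | yes e∈Z with z-on e∈Z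
      ...   | inj₁ ze≡1  = trans ze≡1 (sym (indicator-∈ e∈Z))
      ...   | inj₂ ze≡-1 = contradiction (e , ze≡-1) ¬neg
    ... | no ¬pos | yes _ = inj₁ record
      { K-P = K-cong value (K-neg Kz) ; P⊆T = Z⊆T ; point∈P = proj₁ (proj₂ (⊉circuit indep-⊥ circZ))
      ; P≢T = λ Z≡T → ¬circ-T (subst Circuit Z≡T circZ) }
      where
      value : ∀ e → ℤ.- z e ≡ indicator Z e
      value e with e ∈? Z
      ... | no  e∉Z = trans (cong ℤ.-_ (z-off e∉Z)) (sym (indicator-∉ e∉Z))
      ... | yes e∈Z with z-on e∈Z
      ...   | inj₁ ze≡1  = contradiction (e , ze≡1) ¬pos
      ...   | inj₂ ze≡-1 = trans (cong ℤ.-_ ze≡-1) (sym (indicator-∈ e∈Z))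

    module _ {Z} (Z⊆T : Z ⊆ T) (Z≢T : Z ≢ T) (mix : Mixed Z) where
      open Mixed mix

      a∈Z : a ∈ Z
      a∈Z = decidable-stable (a ∈? Z) λ a∉Z → contradiction (trans (sym za≡1) (z-off a∉Z)) λ ()

      b∈Z : b ∈ Z
      b∈Z = decidable-stable (b ∈? Z) λ b∉Z → contradiction (trans (sym zb≡-1) (z-off b∉Z)) λ ()

      -- Adding `z` to the indicator of `H` removes the negative elements of `z`, all in `H`, and
      -- inserts the positive ones, none in `H`; the sum is again an indicator.
      twist : PositiveCircuit (H △ Z)
      twist = record
        { K-P = K-cong value (K-+ (K-P posH) K-z)
        ; P⊆T = △-⊆ (P⊆T posH) Z⊆T
        ; point∈P = x∈△ʳ (z⁺∉H za≡1) a∈Z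
        ; P≢T = λ H△Z≡T → x∉△-both (z⁻∈H zb≡-1) b∈Z (subst (b ∈_) (sym H△Z≡T) (Z⊆T b∈Z))
        }
        where
        value : ∀ e → indicator H e ℤ.+ z e ≡ indicator (H △ Z) e
        value e with e ∈? Z | e ∈? H
        ... | no  e∉Z | no  e∉H = trans (cong₂ ℤ._+_ (indicator-∉ e∉H) (z-off e∉Z)) (sym (indicator-∉ (x∉△-neither e∉H e∉Z)))
        ... | no  e∉Z | yes e∈H = trans (cong₂ ℤ._+_ (indicator-∈ e∈H) (z-off e∉Z)) (sym (indicator-∈ (x∈△ˡ e∈H e∉Z)))
        ... | yes e∈Z | no  e∉H with z-on e∈Z
        ...   | inj₁ ze≡1  = trans (cong₂ ℤ._+_ (indicator-∉ e∉H) ze≡1) (sym (indicator-∈ (x∈△ʳ e∉H e∈Z)))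
        ...   | inj₂ ze≡-1 = contradiction (z⁻∈H ze≡-1) e∉H
        value e | yes e∈Z | yes e∈H with z-on e∈Z
        ...   | inj₁ ze≡1  = contradiction e∈H (z⁺∉H ze≡1)
        ...   | inj₂ ze≡-1 = trans (cong₂ ℤ._+_ (indicator-∈ e∈H) ze≡-1) (sym (indicator-∉ (x∉△-both e∈H e∈Z)))

      twist≢H : H △ Z ≢ H
      twist≢H H△Z≡H = z⁺∉H za≡1 (subst (a ∈_) H△Z≡H (x∈△ʳ (z⁺∉H za≡1) a∈Z))

      twist≢T△H : H △ Z ≢ T △ H
      twist≢T△H eq = Z≢T (trans (sym (△-cancelˡ H Z)) (trans (cong (H △_) (trans eq (△-comm T H))) (△-cancelˡ H T)))

    positive-exists : ∃[ P ] PositiveCircuit P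
    positive-exists =
      let Z , circZ , Z⊆T = circuit-within T-dependent
      in [ (λ pos → Z , pos) , (λ mix → Mixed.H mix , Mixed.posH mix) ]′ (positive⊎mixed circZ Z⊆T)

    -- `Z` is neither empty nor `T`, so `H △ Z` differs from `H` and from `T △ H`. Hence if `H` is
    -- one of `P` and `T △ P`, then `H △ Z` is neither.
    other-positive : ∀ {P Z} → Z ⊆ T → Z ≢ T → Mixed Z → ∃[ Q ] PositiveCircuit Q × Q ≢ P × Q ≢ T △ P
    other-positive {P} {Z} Z⊆T Z≢T mix = choose (≡-dec Bool._≟_ H P) (≡-dec Bool._≟_ H (T △ P))
      where
      open Mixed mix
      choose : Dec (H ≡ P) → Dec (H ≡ T △ P) → ∃[ Q ] PositiveCircuit Q × Q ≢ P × Q ≢ T △ P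
      choose (no H≢P)  (no H≢T△P)  = H , posH , H≢P , H≢T△P
      choose (yes H≡P) _           = H △ Z , twist Z⊆T Z≢T mix
        , (λ eq → twist≢H Z⊆T Z≢T mix (trans eq (sym H≡P)))
        , (λ eq → twist≢T△H Z⊆T Z≢T mix (trans eq (cong (T △_) (sym H≡P))))
      choose (no _)    (yes H≡T△P) = H △ Z , twist Z⊆T Z≢T mix
        , (λ eq → twist≢T△H Z⊆T Z≢T mix (trans eq (trans (sym (△-cancelˡ T P)) (cong (T △_) (sym H≡T△P)))))
        , (λ eq → twist≢H Z⊆T Z≢T mix (trans eq (sym H≡T△P)))

    -- Here the absence of skew circuits enters: the disjoint circuits `P` and `T △ P` admit a third
    -- circuit in their union, which is positive itself or yields a suitable positive circuit by
    -- rounding.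
    second-positive : ∀ {P} → PositiveCircuit P → ∃[ Q ] PositiveCircuit Q × Q ≢ P × Q ≢ T △ P
    second-positive {P} pos = from-circuit
      (¬skew⇒circuit ¬skew (circuit pos) (circuit (complement-positive pos)) λ x∈P → x∉△-both (P⊆T pos x∈P) x∈P)
      where
      from-circuit : (∃[ Z ] Circuit Z × Z ⊆ P ∪ (T △ P) × Z ≢ P × Z ≢ T △ P) →
        ∃[ Q ] PositiveCircuit Q × Q ≢ P × Q ≢ T △ P
      from-circuit (Z , circZ , Z⊆ , Z≢P , Z≢T△P) =
        [ (λ posZ → Z , posZ , Z≢P , Z≢T△P)
        , other-positive Z⊆T (λ Z≡T → ¬circ-T (subst Circuit Z≡T circZ))
        ]′ (positive⊎mixed circZ Z⊆T)
        where
        Z⊆T : Z ⊆ T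
        Z⊆T z∈Z = [ P⊆T pos , T△-⊆ (P⊆T pos) ]′ (x∈p∪q⁻ P (T △ P) (Z⊆ z∈Z))

    -- On `T` the vector `t` is 1 on `P ∩ Q`, 0 on `P △ Q` and -1 elsewhere. Let `w` be the half of
    -- `x + t`. By `nonnegative`, applied to the indicators of `P` and of `Q` minus `w`, the value 1
    -- of `w` occurs only on `P ∩ Q`, so `t - w` is supported on the circuit `E` formed by the two
    -- opposite blocks. It is 0 at `d` and -1 at `a`, but a kernel vector supported on the
    -- independent set `E - d` is zero.
    ¬opposite-blocks : ∀ {P Q d a} → PositiveCircuit P → PositiveCircuit Q → Q ≢ P → Q ≢ T △ P →
      d ∈ P → d ∈ Q → d ∈ C₁ → a ∈ T → a ∉ P → a ∉ Q → a ∉ C₁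
    ¬opposite-blocks {P} {Q} {d} {a} posP posQ Q≢P Q≢T△P d∈P d∈Q d∈C₁ a∈T a∉P a∉Q a∈C₁ =
      contradiction (trans (sym t-w-a) (independent⇒0 (circuit⁻ circ-E d∈E) (K-− K-t K-h) t-w-off a)) λ ()
      where
      p q t u : Fin n → ℤ
      p = indicator P
      q = indicator Q
      t e = (p e ℤ.+ q e) ℤ.+ ℤ.- y e
      u e = x e ℤ.+ t e
      K-t : K t
      K-t = K-− (K-+ (K-P posP) (K-P posQ)) K-T
      u-at : ∀ {e i j k l} → x e ≡ i → p e ≡ j → q e ≡ k → y e ≡ l → u e ≡ i ℤ.+ ((j ℤ.+ k) ℤ.+ ℤ.- l)
      u-at refl refl refl refl = refl
      ∉T-P : ∀ {e} → e ∉ T → p e ≡ 0ℤ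
      ∉T-P e∉T = indicator-∉ (e∉T ∘ P⊆T posP)
      ∉T-Q : ∀ {e} → e ∉ T → q e ≡ 0ℤ
      ∉T-Q e∉T = indicator-∉ (e∉T ∘ P⊆T posQ)
      u-∉U : ∀ {e} → e ∉ U → u e ≡ 0ℤ
      u-∉U e∉U = let e∉T = e∉U ∘ T⊆U in u-at (indicator-∉ (e∉U ∘ C₁⊆U)) (∉T-P e∉T) (∉T-Q e∉T) (indicator-∉ e∉T)
      u-N : ∀ {e} → e ∈ C₁ → e ∉ T → u e ≡ 1ℤ
      u-N e∈C₁ e∉T = u-at (indicator-∈ e∈C₁) (∉T-P e∉T) (∉T-Q e∉T) (indicator-∉ e∉T)
      open LevelRounding (levelRounding (K-+ K-C₁ K-t) u-∉U (u-N o∈C₁ o∉T)) renaming (h to w)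

      w-∉T : ∀ {e} → e ∉ T → w e ≡ 0ℤ
      w-∉T {e} e∉T with e ∈? C₁ | e ∈? C₂
      ... | yes e∈C₁ | yes e∈C₂ = h-N e∈C₁ e∈C₂ (u-N e∈C₁ e∉T)
      ... | yes e∈C₁ | no  e∉C₂ = contradiction (x∈△ˡ e∈C₁ e∉C₂) e∉T
      ... | no  e∉C₁ | yes e∈C₂ = contradiction (x∈△ʳ e∉C₁ e∈C₂) e∉T
      ... | no  e∉C₁ | no  e∉C₂ = h-0 (u-∉U ([ e∉C₁ , e∉C₂ ]′ ∘ x∈p∪q⁻ C₁ C₂))

      Value : Fin n → Set
      Value e = w e ≡ 0ℤ
        ⊎ (w e ≡ 1ℤ × (e ∉ C₁ → e ∈ P × e ∈ Q))
        ⊎ (w e ≡ -1ℤ × e ∉ P × e ∉ Q)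

      value₀₁ : ∀ {e} → u e ≡ 1ℤ → (e ∉ C₁ → e ∈ P × e ∈ Q) → Value e
      value₀₁ ue≡1 e∈P∩Q with h-1 ue≡1
      ... | inj₁ we≡0 = inj₁ we≡0
      ... | inj₂ we≡1 = inj₂ (inj₁ (we≡1 , e∈P∩Q))

      value : ∀ e → Value e
      value e with e ∈? T
      ... | no e∉T = inj₁ (w-∉T e∉T)
      ... | yes e∈T with e ∈? C₁ | e ∈? P | e ∈? Q
      ...   | yes e∈C₁ | yes e∈P | yes e∈Q = inj₂ (inj₁
        ( h-2 (u-at (indicator-∈ e∈C₁) (indicator-∈ e∈P) (indicator-∈ e∈Q) (indicator-∈ e∈T))
        , λ e∉C₁ → contradiction e∈C₁ e∉C₁))
      ...   | yes e∈C₁ | yes e∈P | no  e∉Q = value₀₁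
        (u-at (indicator-∈ e∈C₁) (indicator-∈ e∈P) (indicator-∉ e∉Q) (indicator-∈ e∈T)) λ e∉C₁ → contradiction e∈C₁ e∉C₁
      ...   | yes e∈C₁ | no  e∉P | yes e∈Q = value₀₁
        (u-at (indicator-∈ e∈C₁) (indicator-∉ e∉P) (indicator-∈ e∈Q) (indicator-∈ e∈T)) λ e∉C₁ → contradiction e∈C₁ e∉C₁
      ...   | yes e∈C₁ | no  e∉P | no  e∉Q = inj₁
        (h-0 (u-at (indicator-∈ e∈C₁) (indicator-∉ e∉P) (indicator-∉ e∉Q) (indicator-∈ e∈T)))
      ...   | no  e∉C₁ | yes e∈P | yes e∈Q = value₀₁
        (u-at (indicator-∉ e∉C₁) (indicator-∈ e∈P) (indicator-∈ e∈Q) (indicator-∈ e∈T)) λ _ → e∈P , e∈Q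
      ...   | no  e∉C₁ | yes e∈P | no  e∉Q = inj₁
        (h-0 (u-at (indicator-∉ e∉C₁) (indicator-∈ e∈P) (indicator-∉ e∉Q) (indicator-∈ e∈T)))
      ...   | no  e∉C₁ | no  e∉P | yes e∈Q = inj₁
        (h-0 (u-at (indicator-∉ e∉C₁) (indicator-∉ e∉P) (indicator-∈ e∈Q) (indicator-∈ e∈T)))
      ...   | no  e∉C₁ | no  e∉P | no  e∉Q
        with h--1 (u-at (indicator-∉ e∉C₁) (indicator-∉ e∉P) (indicator-∉ e∉Q) (indicator-∈ e∈T))
      ...     | inj₁ we≡0  = inj₁ we≡0
      ...     | inj₂ we≡-1 = inj₂ (inj₂ (we≡-1 , e∉P , e∉Q))

      -- R is P or Q, and the nonnegative vector is indicator R − w.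
      w⁺⊆ : ∀ {R} → PositiveCircuit R → (∀ {e} → e ∈ P → e ∈ Q → e ∈ R) → (∀ {e} → e ∉ P → e ∉ Q → e ∉ R) →
        ∀ {e} → w e ≡ 1ℤ → e ∈ R
      w⁺⊆ {R} posR P∩Q⊆R R⊆P∪Q {e} we≡1 = decidable-stable (e ∈? R) λ e∉R →
        nonnegative (K-− (K-P posR) K-h) z-sign z-off z-C₂ e (z-at (indicator-∉ e∉R) we≡1)
        where
        z : Fin n → ℤ
        z e = indicator R e ℤ.+ ℤ.- w e
        z-at : ∀ {e i j} → indicator R e ≡ i → w e ≡ j → z e ≡ i ℤ.+ ℤ.- j
        z-at refl refl = refl
        z-off : ∀ {e} → e ∉ T → z e ≡ 0ℤ
        z-off e∉T = z-at (indicator-∉ (e∉T ∘ P⊆T posR)) (w-∉T e∉T)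
        z-sign : ∀ e → SignValue (z e)
        z-sign e with e ∈? R | value e
        ... | yes e∈R | inj₁ we≡0              = inj₂ (inj₁ (z-at (indicator-∈ e∈R) we≡0))
        ... | no  e∉R | inj₁ we≡0              = inj₁ (z-at (indicator-∉ e∉R) we≡0)
        ... | yes e∈R | inj₂ (inj₁ (we≡1 , _)) = inj₁ (z-at (indicator-∈ e∈R) we≡1)
        ... | no  e∉R | inj₂ (inj₁ (we≡1 , _)) = inj₂ (inj₂ (z-at (indicator-∉ e∉R) we≡1))
        ... | no  e∉R | inj₂ (inj₂ (we≡-1 , _)) = inj₂ (inj₁ (z-at (indicator-∉ e∉R) we≡-1))
        ... | yes e∈R | inj₂ (inj₂ (_ , e∉P , e∉Q)) = contradiction e∈R (R⊆P∪Q e∉P e∉Q)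
        z-C₂ : ∀ {e} → e ∉ C₁ → z e ≢ -1ℤ
        z-C₂ {e} e∉C₁ ze≡-1 with e ∈? R | value e
        ... | yes e∈R | inj₁ we≡0              = contradiction (trans (sym (z-at (indicator-∈ e∈R) we≡0)) ze≡-1) λ ()
        ... | no  e∉R | inj₁ we≡0              = contradiction (trans (sym (z-at (indicator-∉ e∉R) we≡0)) ze≡-1) λ ()
        ... | yes e∈R | inj₂ (inj₁ (we≡1 , _)) = contradiction (trans (sym (z-at (indicator-∈ e∈R) we≡1)) ze≡-1) λ ()
        ... | no  e∉R | inj₂ (inj₁ (_ , e∈P∩Q)) = let e∈P , e∈Q = e∈P∩Q e∉C₁ in e∉R (P∩Q⊆R e∈P e∈Q)
        ... | no  e∉R | inj₂ (inj₂ (we≡-1 , _)) = contradiction (trans (sym (z-at (indicator-∉ e∉R) we≡-1)) ze≡-1) λ ()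
        ... | yes e∈R | inj₂ (inj₂ (_ , e∉P , e∉Q)) = R⊆P∪Q e∉P e∉Q e∈R

      w⁺⊆P : ∀ {e} → w e ≡ 1ℤ → e ∈ P
      w⁺⊆P = w⁺⊆ posP (λ e∈P _ → e∈P) λ e∉P _ → e∉P

      w⁺⊆Q : ∀ {e} → w e ≡ 1ℤ → e ∈ Q
      w⁺⊆Q = w⁺⊆ posQ (λ _ e∈Q → e∈Q) λ _ e∉Q → e∉Q

      E : Subset n
      E = T △ (P △ Q)

      P△Q⊆T : P △ Q ⊆ T
      P△Q⊆T = △-⊆ (P⊆T posP) (P⊆T posQ)

      circ-E : Circuit E
      circ-E =
        let e , e∈P , e∉Q = circuit-⊈ (circuit posP) (circuit posQ) (Q≢P ∘ sym)
        in complement (cycle-in-T (cycle-△ (indicator-cycle (K-P posP)) (indicator-cycle (K-P posQ))) P△Q⊆T (x∈△ˡ e∈P e∉Q)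
             λ P△Q≡T → Q≢T△P (trans (sym (△-cancelˡ P Q)) (trans (cong (P △_) P△Q≡T) (△-comm P T)))) P△Q⊆T

      d∈E : d ∈ E
      d∈E = x∈△ˡ (P⊆T posP d∈P) (x∉△-both d∈P d∈Q)

      t-w-at : ∀ {e i j k l} → p e ≡ i → q e ≡ j → y e ≡ k → w e ≡ l →
        t e ℤ.+ ℤ.- w e ≡ ((i ℤ.+ j) ℤ.+ ℤ.- k) ℤ.+ ℤ.- l
      t-w-at refl refl refl refl = refl

      t-w-a : t a ℤ.+ ℤ.- w a ≡ -1ℤ
      t-w-a = t-w-at (indicator-∉ a∉P) (indicator-∉ a∉Q) (indicator-∈ a∈T)
        (h-0 (u-at (indicator-∈ a∈C₁) (indicator-∉ a∉P) (indicator-∉ a∉Q) (indicator-∈ a∈T)))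

      t-w-d : t d ℤ.+ ℤ.- w d ≡ 0ℤ
      t-w-d = t-w-at (indicator-∈ d∈P) (indicator-∈ d∈Q) (indicator-∈ (P⊆T posP d∈P))
        (h-2 (u-at (indicator-∈ d∈C₁) (indicator-∈ d∈P) (indicator-∈ d∈Q) (indicator-∈ (P⊆T posP d∈P))))

      w-△ : ∀ {e} → e ∈ P △ Q → w e ≡ 0ℤ
      w-△ {e} e∈ with value e
      ... | inj₁ we≡0 = we≡0
      ... | inj₂ (inj₁ (we≡1 , _)) = contradiction e∈ (x∉△-both (w⁺⊆P we≡1) (w⁺⊆Q we≡1))
      ... | inj₂ (inj₂ (_ , e∉P , e∉Q)) = contradiction e∈ (x∉△-neither e∉P e∉Q)

      t-w-off : ∀ {e} → e ∉ E - d → t e ℤ.+ ℤ.- w e ≡ 0ℤ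
      t-w-off {e} e∉ with e Fin.≟ d | e ∈? T
      ... | yes refl | _      = t-w-d
      ... | no _     | no e∉T = t-w-at (∉T-P e∉T) (∉T-Q e∉T) (indicator-∉ e∉T) (w-∉T e∉T)
      ... | no e≢d   | yes e∈T = on-△ (decidable-stable (e ∈? (P △ Q)) λ e∉△ → e∉ (x∈p∧x≢y⇒x∈p-y (x∈△ˡ e∈T e∉△) e≢d))
        where
        on-△ : e ∈ P △ Q → t e ℤ.+ ℤ.- w e ≡ 0ℤ
        on-△ e∈ with x∈△⁻ P Q e∈
        ... | inj₁ (e∈P , e∉Q) = t-w-at (indicator-∈ e∈P) (indicator-∉ e∉Q) (indicator-∈ e∈T) (w-△ e∈)
        ... | inj₂ (e∉P , e∈Q) = t-w-at (indicator-∉ e∉P) (indicator-∈ e∈Q) (indicator-∈ e∈T) (w-△ e∈)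

    -- Replacing `Q` by `T △ Q` exchanges the two pairs of opposite blocks.
    ¬opposite-blocks′ : ∀ {P Q b c} → PositiveCircuit P → PositiveCircuit Q → Q ≢ P → Q ≢ T △ P →
      b ∈ P → b ∉ Q → b ∈ C₁ → c ∉ P → c ∈ Q → c ∉ C₁
    ¬opposite-blocks′ {P} {Q} posP posQ Q≢P Q≢T△P b∈P b∉Q b∈C₁ c∉P c∈Q =
      ¬opposite-blocks posP (complement-positive posQ)
        (λ eq → Q≢T△P (trans (sym (△-cancelˡ T Q)) (cong (T △_) eq)))
        (λ eq → Q≢P (trans (sym (△-cancelˡ T Q)) (trans (cong (T △_) eq) (△-cancelˡ T P))))
        b∈P (x∈△ˡ (P⊆T posP b∈P) b∉Q) b∈C₁ (P⊆T posQ c∈Q) c∉P (x∉△-both (P⊆T posQ c∈Q) c∈Q)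

    -- Every circuit of T meets C₁, so C₁ misses at most one of the four blocks
    -- into which P and Q divide T.
    crossing-positive⇒⊥ : ∀ {P Q} → PositiveCircuit P → PositiveCircuit Q → Q ≢ P → Q ≢ T △ P → Empty.⊥
    crossing-positive⇒⊥ {P} {Q} posP posQ Q≢P Q≢T△P = blocks
      (meets-C₁ (circuit posP) (P⊆T posP)) (meets-C₁ (circuit posQ) (P⊆T posQ))
      (meets-C₁ (circuit (complement-positive posP)) (T△-⊆ (P⊆T posP)))
      (meets-C₁ (circuit (complement-positive posQ)) (T△-⊆ (P⊆T posQ)))
      where
      ∉complement : ∀ {R e} → PositiveCircuit R → e ∈ T △ R → e ∉ R
      ∉complement posR e∈ e∈R = x∉△-both (P⊆T posR e∈R) e∈R e∈
      MeetsC₁ : Subset n → Set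
      MeetsC₁ D = ∃[ e ] e ∈ D × e ∈ C₁ × e ∉ C₂
      blocks : MeetsC₁ P → MeetsC₁ Q → MeetsC₁ (T △ P) → MeetsC₁ (T △ Q) → Empty.⊥
      blocks (p , p∈P , p∈C₁ , _) (q , q∈Q , q∈C₁ , _) (p̄ , p̄∈ , p̄∈C₁ , _) (q̄ , q̄∈ , q̄∈C₁ , _) =
        cases (p ∈? Q) (q ∈? P) (p̄ ∈? Q) (q̄ ∈? P)
        where
        p̄∉P : p̄ ∉ P
        p̄∉P = ∉complement posP p̄∈
        q̄∉Q : q̄ ∉ Q
        q̄∉Q = ∉complement posQ q̄∈
        p̄∈T : p̄ ∈ T
        p̄∈T = T△-⊆ (P⊆T posP) p̄∈
        q̄∈T : q̄ ∈ T
        q̄∈T = T△-⊆ (P⊆T posQ) q̄∈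
        cases : Dec (p ∈ Q) → Dec (q ∈ P) → Dec (p̄ ∈ Q) → Dec (q̄ ∈ P) → Empty.⊥
        cases (yes p∈Q) _ (no p̄∉Q) _ =
          ¬opposite-blocks posP posQ Q≢P Q≢T△P p∈P p∈Q p∈C₁ p̄∈T p̄∉P p̄∉Q p̄∈C₁
        cases (yes p∈Q) _ (yes p̄∈Q) (no q̄∉P) =
          ¬opposite-blocks posP posQ Q≢P Q≢T△P p∈P p∈Q p∈C₁ q̄∈T q̄∉P q̄∉Q q̄∈C₁
        cases (yes p∈Q) _ (yes p̄∈Q) (yes q̄∈P) =
          ¬opposite-blocks′ posP posQ Q≢P Q≢T△P q̄∈P q̄∉Q q̄∈C₁ p̄∉P p̄∈Q p̄∈C₁
        cases (no p∉Q) (no q∉P) _ _ =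
          ¬opposite-blocks′ posP posQ Q≢P Q≢T△P p∈P p∉Q p∈C₁ q∉P q∈Q q∈C₁
        cases (no p∉Q) (yes q∈P) (yes p̄∈Q) _ =
          ¬opposite-blocks′ posP posQ Q≢P Q≢T△P p∈P p∉Q p∈C₁ p̄∉P p̄∈Q p̄∈C₁
        cases (no p∉Q) (yes q∈P) (no p̄∉Q) _ =
          ¬opposite-blocks posP posQ Q≢P Q≢T△P q∈P q∈Q q∈C₁ p̄∈T p̄∉P p̄∉Q p̄∈C₁

    absurd : Empty.⊥
    absurd = first positive-exists
      where
      second : ∀ {P} → PositiveCircuit P → (∃[ Q ] PositiveCircuit Q × Q ≢ P × Q ≢ T △ P) → Empty.⊥
      second posP (Q , posQ , Q≢P , Q≢T△P) = crossing-positive⇒⊥ posP posQ Q≢P Q≢T△P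
      first : ∃ PositiveCircuit → Empty.⊥
      first (P , posP) = second posP (second-positive posP)

-- Reorientation and induction on the size of the union

module _ {n} {M : Matroid n} (L : CircuitLattice M) {C₁ C₂} (pair : MinimalPair M C₁ C₂)
  (¬skew : ¬ Matroid.HasSkewCircuits M) where
  open CircuitLattice L
  open LatticeProperties L
  open MinimalPair pair
  open Minimal L pair

  -- Reversing the elements where x₁, respectively − x₂ off C₁, is negative
  -- turns x₁ into the indicator of C₁ and x₁ − x₂ into that of T.
  module Orientation {x₁ x₂ : Fin n → ℤ} (K-x₁ : K x₁) (K-x₂ : K x₂)
    (x₁-on : ∀ {e} → e ∈ C₁ → IsUnit (x₁ e)) (x₁-off : ∀ {e} → e ∉ C₁ → x₁ e ≡ 0ℤ)
    (x₂-on : ∀ {e} → e ∈ C₂ → IsUnit (x₂ e)) (x₂-off : ∀ {e} → e ∉ C₂ → x₂ e ≡ 0ℤ)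
    (agree : x₁ o ≡ x₂ o) where

    y : Fin n → ℤ
    y e = x₁ e ℤ.+ ℤ.- x₂ e

    y-at : ∀ {e i j} → x₁ e ≡ i → x₂ e ≡ j → y e ≡ i ℤ.+ ℤ.- j
    y-at refl refl = refl

    -- Agreement at `o` spreads to all of N, so the support of `x₁ - x₂` is exactly `T`.
    y-N : ∀ {e} → e ∈ C₁ → e ∈ C₂ → y e ≡ 0ℤ
    y-N = vanishes-on-N (K-− K-x₁ K-x₂)
      (λ e∉U → y-at (x₁-off (e∉U ∘ C₁⊆U)) (x₂-off (e∉U ∘ C₂⊆U)))
      o∈C₁ o∈C₂ (trans (y-at agree refl) (ℤ.+-inverseʳ (x₂ o)))

    orientationAt : ∀ e → Dec (e ∈ C₁) → Dec (e ∈ C₂) → ∃[ s ] IsUnit s ×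
      x₁ e ≡ s ℤ.* indicator C₁ e × y e ≡ s ℤ.* indicator T e
    orientationAt e (yes e∈C₁) (yes e∈C₂) = x₁ e , x₁-on e∈C₁
      , sym (trans (cong (x₁ e ℤ.*_) (indicator-∈ e∈C₁)) (ℤ.*-identityʳ (x₁ e)))
      , trans (y-N e∈C₁ e∈C₂) (sym (trans (cong (x₁ e ℤ.*_) (indicator-∉ (N∌T e∈C₁ e∈C₂))) (ℤ.*-zeroʳ (x₁ e))))
    orientationAt e (yes e∈C₁) (no  e∉C₂) = x₁ e , x₁-on e∈C₁
      , sym (trans (cong (x₁ e ℤ.*_) (indicator-∈ e∈C₁)) (ℤ.*-identityʳ (x₁ e)))
      , trans (trans (y-at refl (x₂-off e∉C₂)) (ℤ.+-identityʳ (x₁ e)))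
          (sym (trans (cong (x₁ e ℤ.*_) (indicator-∈ (x∈△ˡ e∈C₁ e∉C₂))) (ℤ.*-identityʳ (x₁ e))))
    orientationAt e (no  e∉C₁) (yes e∈C₂) = ℤ.- x₂ e , unit-neg (x₂-on e∈C₂)
      , trans (x₁-off e∉C₁) (sym (trans (cong (ℤ.- x₂ e ℤ.*_) (indicator-∉ e∉C₁)) (ℤ.*-zeroʳ (ℤ.- x₂ e))))
      , trans (trans (y-at (x₁-off e∉C₁) refl) (ℤ.+-identityˡ (ℤ.- x₂ e)))
          (sym (trans (cong (ℤ.- x₂ e ℤ.*_) (indicator-∈ (x∈△ʳ e∉C₁ e∈C₂))) (ℤ.*-identityʳ (ℤ.- x₂ e))))
    orientationAt e (no  e∉C₁) (no  e∉C₂) = 1ℤ , inj₁ refl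
      , trans (x₁-off e∉C₁) (cong (1ℤ ℤ.*_) (sym (indicator-∉ e∉C₁)))
      , trans (y-at (x₁-off e∉C₁) (x₂-off e∉C₂)) (cong (1ℤ ℤ.*_) (sym (indicator-∉ (x∉△-neither e∉C₁ e∉C₂))))

    orientation : ∀ e → ∃[ s ] IsUnit s × x₁ e ≡ s ℤ.* indicator C₁ e × y e ≡ s ℤ.* indicator T e
    orientation e = orientationAt e (e ∈? C₁) (e ∈? C₂)

    contradictory : Empty.⊥
    contradictory = Minimal.Positive.absurd
      (reorient (proj₁ ∘ orientation) (proj₁ ∘ proj₂ ∘ orientation)) pair
      (K-cong (proj₁ ∘ proj₂ ∘ proj₂ ∘ orientation) K-x₁)
      (K-cong (proj₂ ∘ proj₂ ∘ proj₂ ∘ orientation) (K-− K-x₁ K-x₂)) ¬skew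

  -- The two circuit vectors are units at `o`, so they agree there after negating one of them if
  -- necessary.
  minimal-pair⇒⊥ : Empty.⊥
  minimal-pair⇒⊥ = vectors (circuitVector circ₁) (circuitVector circ₂)
    where
    equal⊎opposite : ∀ {j k} → IsUnit j → IsUnit k → j ≡ k ⊎ j ≡ ℤ.- k
    equal⊎opposite (inj₁ refl) (inj₁ refl) = inj₁ refl
    equal⊎opposite (inj₁ refl) (inj₂ refl) = inj₂ refl
    equal⊎opposite (inj₂ refl) (inj₁ refl) = inj₂ refl
    equal⊎opposite (inj₂ refl) (inj₂ refl) = inj₁ refl
    vectors : Cycle C₁ → Cycle C₂ → Empty.⊥
    vectors (x₁ , K-x₁ , x₁-on , x₁-off) (x₂ , K-x₂ , x₂-on , x₂-off) =
      [ Orientation.contradictory K-x₁ K-x₂ x₁-on x₁-off x₂-on x₂-off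
      , Orientation.contradictory K-x₁ (K-neg K-x₂) x₁-on x₁-off
          (λ e∈C₂ → unit-neg (x₂-on e∈C₂)) (λ e∉C₂ → cong ℤ.-_ (x₂-off e∉C₂))
      ]′ (equal⊎opposite (x₁-on o∈C₁) (x₂-on o∈C₂))

module _ {n} {M : Matroid n} (L : CircuitLattice M) where
  open Matroid M
  open MatroidProperties M

  ¬skew⇒circuitDifference : ¬ HasSkewCircuits → CircuitDifference
  ¬skew⇒circuitDifference ¬skew {C} {D} = induct (suc ∣ C ∪ D ∣) ℕ.≤-refl
    where
    induct : ∀ k {C D} → ∣ C ∪ D ∣ ℕ.< k → Circuit C → Circuit D → C ≢ D → Nonempty (C ∩ D) → Circuit (C △ D)
    induct (suc k) {C} {D} (s≤s ∣C∪D∣≤k) circC circD C≢D (o , o∈) = decidable-stable (circuit? (C △ D)) λ ¬circ →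
      let o∈C , o∈D = x∈p∩q⁻ C D o∈ in minimal-pair⇒⊥ L record
        { circ₁ = circC ; circ₂ = circD ; C₁≢C₂ = C≢D ; o∈C₁ = o∈C ; o∈C₂ = o∈D ; ¬circ-T = ¬circ ; minimal = smaller } ¬skew
      where
      smaller : ∀ {X Y i u} → Circuit X → Circuit Y → X ≢ Y → X ⊆ C ∪ D → Y ⊆ C ∪ D →
        i ∈ X → i ∈ Y → u ∈ C ∪ D → u ∉ X → u ∉ Y → Circuit (X △ Y)
      smaller {X} {Y} {i} circX circY X≢Y X⊆ Y⊆ i∈X i∈Y u∈ u∉X u∉Y = induct k
        (ℕ.<-≤-trans (∣⊆-x∣ (λ e∈ → [ X⊆ , Y⊆ ]′ (x∈p∪q⁻ X Y e∈)) u∈ (λ u∈∪ → [ u∉X , u∉Y ]′ (x∈p∪q⁻ X Y u∈∪))) ∣C∪D∣≤k)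
        circX circY X≢Y (i , x∈p∩q⁺ (i∈X , i∈Y))

theorem1p1 : ∀ {n : ℕ} (M : Matroid n) → Matroid.Connected M → Regular M →
    Matroid.CircuitDifference M ⇔ (¬ Matroid.HasSkewCircuits M)
theorem1p1 M connected (m , A , tu , rep) = mk⇔
  (MatroidProperties.circuitDifference⇒¬skew M connected)
  (¬skew⇒circuitDifference {M = M} (circuitLattice A tu rep))
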